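{- Let $N \geq 2$ be an integer. Then there exist positive integers $a, b$ with $N = a+b$ such that $\Omega(ab) \leq 20$ if $N$ is even and $\Omega(ab) \leq 21$ if $N$ is odd.
   Context: $\Omega(n)$ denotes the number of prime factors of $n$ counted with multiplicity. -}

module Defs where

open import Data.Nat.Base using (ℕ; zero; suc)
open import Data.List.Base using (length)
open import Data.Nat.Primality.Factorisation using (factorise; factors)

-- Ω n : number of prime factors of n counted with multiplicity,
-- i.e. the length of the (unique up to permutation) prime factorisation.
-- Convention Ω 0 = 0 (never used: the theorem only applies Ω to positive numbers).
Ω : ℕ → ℕ
Ω zero = 0
Ω (suc n) = length (factors (factorise (suc n)))

{-# OPTIONS --safe #-}

-- Write 4 ^ m ≤ N < 4 ^ (m + 1) and consider the t < N that are odd (N even) or ≡ 2 mod 4 (N odd), with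
-- the weight
--   19 L(t) - Σ_p ([p ∣ t] + [p ∣ N - t] + 19 [p² ∣ t] + 19 [p² ∣ N - t]) W(t),
-- where p runs over the primes of (2 ^ K , 2 ^ (m + 1)] and L ≤ X ≤ W are the Brun–Hooley bounds for the
-- indicator X of the t such that no odd prime ≤ 2 ^ K divides t (N - t). If the weight is positive, then
-- X(t) = 1 and the primes of (2 ^ K , 2 ^ (m + 1)] contribute at most 18 to Ω(t (N - t)), none of them
-- squared; t and N - t have at most one larger prime factor each, since both are below 4 ^ (m + 1). Hence
-- Ω(t (N - t)) ≤ 20, or 21 with the factor 2 of t when N is odd.
--
-- The weight is positive on average. L and W are combinations of indicators of residue classes, so the
-- sum over t is the mean of the weight times the number of t, up to the number of terms. By Chebyshev the
-- sum of 2 / p over (2 ^ i , 2 ^ (i + 1)] is at most 4 / i, hence the sum over (2 ^ K , 2 ^ (64 K)] at most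
-- 18 < 19, while W has at most 2 ^ (28 K) terms up to a constant, and 4 ^ (32 K) ≤ N. For small m ≥ 16 it
-- suffices to take K = 4 and the exact indicator X for L and W. A smaller N is 1 + (N - 1) or 2 + (N - 2),
-- with an odd second summand below 3 ^ 21.

module Submission where

open import Defs
open import Data.Nat using (ℕ; _+_; _*_; _≤_; _<_; _%_)
open import Data.Product using (∃-syntax; _×_)
open import Relation.Binary.PropositionalEquality using (_≡_)

import Data.Integer.Properties as ℤₚ
import Data.Integer.Tactic.RingSolver as ℤS
import Data.Nat.Divisibility as ℕ∣
import Data.Nat.DivMod as DM
import Data.Nat.Properties as ℕₚ
import Data.Nat.Tactic.RingSolver as ℕS
import Data.Rational.Properties as ℚₚ
open import Data.Bool.Base using (true; false; if_then_else_)
open import Data.Empty using (⊥-elim)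
open import Data.Integer.Base as ℤ using (ℤ; +_)
open import Data.Integer.Divisibility.Signed using (_∣_; _∣?_; divides; ∣⇒∣ᵤ; ∣ᵤ⇒∣; ∣-trans; ∣-refl; ∣m∣n⇒∣m+n; ∣m∣n⇒∣m-n; ∣m⇒∣m*n)
open import Data.Integer.DivMod using (_%ℕ_; _/ℕ_; n%ℕd<d; a≡a%ℕn+[a/ℕn]*n)
open import Data.List.Base using (List; []; _∷_; map; length; _++_)
open import Data.List.Membership.Propositional using (_∈_)
open import Data.List.Membership.Propositional.Properties using (∈-++⁺ˡ; ∈-++⁺ʳ)
open import Data.List.Properties using (length-++; map-++)
open import Data.List.Relation.Binary.Permutation.Propositional.Properties using (↭-length)
open import Data.List.Relation.Unary.All as All using (All; []; _∷_)
open import Data.List.Relation.Unary.All.Properties using (++⁺)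
open import Data.List.Relation.Unary.Any using (here; there)
open import Data.Nat.Base as ℕ using (zero; suc; NonZero; _!)
open import Data.Nat.Combinatorics using (_C_; nCk+nC[k+1]≡[n+1]C[k+1]; nCk≡nC[n∸k]; nCn≡1; nCk≡n!/k![n-k]!; k![n∸k]!∣n!)
open import Data.Nat.Coprimality using (Coprime; coprime-divisor; coprime-Bézout)
open import Data.Nat.GCD using (module Bézout)
open import Data.Nat.ListAction using (product)
open import Data.Nat.ListAction.Properties using (product-++)
open import Data.Nat.Primality using (Prime; prime?; prime[2]; ¬prime[1]; euclidsLemma; prime⇒irreducible; prime⇒nonZero; prime⇒nonTrivial; productOfPrimes≢0)
open import Data.Nat.Primality.Factorisation using (PrimeFactorisation; factorise; factorisationUnique; factorisationHasAllPrimeFactors)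
open import Data.Product using (_,_; proj₁; proj₂)
open import Data.Rational.Base using (ℚ; 0ℚ; 1ℚ; 1/_; positive; nonNegative) renaming (_+_ to _⊕_; _*_ to _⊗_; _-_ to _⊖_; -_ to ⊝_; _≤_ to _≼_; _<_ to _≺_)
open import Data.Sum.Base using (_⊎_; inj₁; inj₂; [_,_]′)
open import Function.Base using (_∘_)
open import Relation.Binary.PropositionalEquality using (refl; sym; trans; cong; cong₂; subst; subst₂; module ≡-Reasoning)
open import Relation.Nullary using (Dec; does; yes; no; ¬_; _because_)
open import Relation.Nullary.Decidable.Core using (dec⇒maybe)
open import Tactic.RingSolver using (solve-∀)
open import Tactic.RingSolver.Core.AlmostCommutativeRing using (AlmostCommutativeRing; fromCommutativeRing)
open PrimeFactorisation

-- Rational numbers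

-- The number of terms of `W`, times a number of primes that can reach 2 ^ m, must stay below 4 ^ m
-- up to the mean of `W`. Inclusion-exclusion over all primes up to 2 ^ K at once would need too
-- high a degree, so the sieve is built in layers (2 ^ k , 2 ^ (2 k)], each cut at its own degree.
-- On every layer the sum of 2 / p is at most 3. The top layer is cut at degree 12 and each lower
-- one two degrees later: the relative losses then halve from layer to layer, while the exponents 12
-- K + 14 K / 2 + 16 K / 4 + ... sum to 28 K.
--
-- The value 18 comes from the ratio m / K. As K runs only through 8 · 2 ^ J, the ratio is
-- controlled up to a factor of two, between 32 > 28 and 64 = 2 ^ 6, and each of the six doublings
-- of the exponent costs 3.
--
-- Only the upper half of Chebyshev's theorem enters. The mean of `W` is bounded below by a constant
-- times 39 ^ (- J), which is merely polynomial in 1 / K and hence harmless beside powers of 2 ^ K.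
--
-- Means are estimated on all residue classes of all admissible moduli simultaneously. This makes it
-- possible to adjoin one prime at a time by the Chinese remainder theorem.

ℚ-ring : AlmostCommutativeRing _ _
ℚ-ring = fromCommutativeRing ℚₚ.+-*-commutativeRing (λ x → dec⇒maybe (0ℚ ℚₚ.≟ x))

-- Most inequalities below are proved by exhibiting the difference as a visibly nonnegative
-- expression `c` and leaving the identity to the ring solver.
≼-diff : ∀ {a b c} → 0ℚ ≼ c → b ≡ a ⊕ c → a ≼ b
≼-diff {a} {b} {c} 0≤c refl = subst (_≼ a ⊕ c) (ℚₚ.+-identityʳ a) (ℚₚ.+-monoʳ-≤ a 0≤c)

0≼⊖ : ∀ {a b} → a ≼ b → 0ℚ ≼ b ⊖ a
0≼⊖ {a} {b} a≤b = subst (_≼ b ⊖ a) (ℚₚ.+-inverseʳ a) (ℚₚ.+-monoˡ-≤ (⊝ a) a≤b)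

0≼⊕ : ∀ {a b} → 0ℚ ≼ a → 0ℚ ≼ b → 0ℚ ≼ a ⊕ b
0≼⊕ p q = ℚₚ.+-mono-≤ p q

0≼⊗ : ∀ {a b} → 0ℚ ≼ a → 0ℚ ≼ b → 0ℚ ≼ a ⊗ b
0≼⊗ {a} {b} p q = subst (_≼ a ⊗ b) (ℚₚ.*-zeroʳ a) (ℚₚ.*-monoˡ-≤-nonNeg a {{nonNegative p}} q)

⊗-monoˡ : ∀ {a b c} → 0ℚ ≼ c → a ≼ b → a ⊗ c ≼ b ⊗ c
⊗-monoˡ {c = c} p q = ℚₚ.*-monoʳ-≤-nonNeg c {{nonNegative p}} q

⊗-monoʳ : ∀ {a b c} → 0ℚ ≼ c → a ≼ b → c ⊗ a ≼ c ⊗ b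
⊗-monoʳ {c = c} p q = ℚₚ.*-monoˡ-≤-nonNeg c {{nonNegative p}} q

⊗-mono : ∀ {a b c d} → 0ℚ ≼ c → 0ℚ ≼ b → a ≼ b → c ≼ d → a ⊗ c ≼ b ⊗ d
⊗-mono p q r s = ℚₚ.≤-trans (⊗-monoˡ p r) (⊗-monoʳ q s)

⊗-cancel : ∀ {a b} c → 0ℚ ≺ c → c ⊗ a ≼ c ⊗ b → a ≼ b
⊗-cancel c p = ℚₚ.*-cancelˡ-≤-pos c {{positive p}}

0≺1 : 0ℚ ≺ 1ℚ
0≺1 = ℚₚ.positive⁻¹ 1ℚ

0≼1 : 0ℚ ≼ 1ℚ
0≼1 = ℚₚ.<⇒≤ 0≺1

⊕-interchange : ∀ a b c d → (a ⊕ b) ⊕ (c ⊕ d) ≡ (a ⊕ c) ⊕ (b ⊕ d)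
⊕-interchange = solve-∀ ℚ-ring

-- Abstract, since the recursion is unary and must not be unfolded on a large literal.
abstract
  ι : ℕ → ℚ
  ι zero    = 0ℚ
  ι (suc n) = 1ℚ ⊕ ι n

  ι-0 : ι 0 ≡ 0ℚ
  ι-0 = refl

  ι-suc : ∀ n → ι (suc n) ≡ 1ℚ ⊕ ι n
  ι-suc n = refl

ι-1 : ι 1 ≡ 1ℚ
ι-1 = trans (ι-suc 0) (trans (cong (1ℚ ⊕_) ι-0) (ℚₚ.+-identityʳ 1ℚ))

0≼ι : ∀ n → 0ℚ ≼ ι n
0≼ι zero    = ℚₚ.≤-reflexive (sym ι-0)
0≼ι (suc n) = subst (0ℚ ≼_) (sym (ι-suc n)) (0≼⊕ 0≼1 (0≼ι n))

ι-+ : ∀ m n → ι (m ℕ.+ n) ≡ ι m ⊕ ι n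
ι-+ zero    n = sym (trans (cong (_⊕ ι n) ι-0) (ℚₚ.+-identityˡ (ι n)))
ι-+ (suc m) n = begin
  ι (suc (m ℕ.+ n))    ≡⟨ ι-suc (m ℕ.+ n) ⟩
  1ℚ ⊕ ι (m ℕ.+ n)     ≡⟨ cong (1ℚ ⊕_) (ι-+ m n) ⟩
  1ℚ ⊕ (ι m ⊕ ι n)     ≡⟨ sym (ℚₚ.+-assoc 1ℚ (ι m) (ι n)) ⟩
  (1ℚ ⊕ ι m) ⊕ ι n     ≡⟨ cong (_⊕ ι n) (sym (ι-suc m)) ⟩
  ι (suc m) ⊕ ι n      ∎
  where open ≡-Reasoning

ι-* : ∀ m n → ι (m ℕ.* n) ≡ ι m ⊗ ι n
ι-* zero    n = trans ι-0 (sym (trans (cong (_⊗ ι n) ι-0) (ℚₚ.*-zeroˡ (ι n))))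
ι-* (suc m) n = begin
  ι (n ℕ.+ m ℕ.* n)       ≡⟨ ι-+ n (m ℕ.* n) ⟩
  ι n ⊕ ι (m ℕ.* n)       ≡⟨ cong (ι n ⊕_) (ι-* m n) ⟩
  ι n ⊕ ι m ⊗ ι n         ≡⟨ eq (ι m) (ι n) ⟩
  (1ℚ ⊕ ι m) ⊗ ι n        ≡⟨ cong (_⊗ ι n) (sym (ι-suc m)) ⟩
  ι (suc m) ⊗ ι n         ∎
  where
  open ≡-Reasoning
  eq : ∀ a b → b ⊕ a ⊗ b ≡ (1ℚ ⊕ a) ⊗ b
  eq = solve-∀ ℚ-ring

ι-mono : ∀ {m n} → m ℕ.≤ n → ι m ≼ ι n
ι-mono {m} {n} m≤n = ≼-diff (0≼ι (n ℕ.∸ m)) (trans (cong ι (sym (ℕₚ.m+[n∸m]≡n m≤n))) (ι-+ m (n ℕ.∸ m)))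

0≺ι : ∀ n .{{_ : NonZero n}} → 0ℚ ≺ ι n
0≺ι (suc n) = ℚₚ.<-≤-trans 0≺1 (subst (_≼ ι (suc n)) ι-1 (ι-mono {1} {suc n} (ℕ.s≤s ℕ.z≤n)))

ι-mono-< : ∀ {m n} → m ℕ.< n → ι m ≺ ι n
ι-mono-< {m} {n} m<n = ℚₚ.<-≤-trans lt (ι-mono m<n)
  where
  lt : ι m ≺ ι (suc m)
  lt = subst₂ _≺_ (ℚₚ.+-identityˡ (ι m)) (sym (ι-suc m)) (ℚₚ.+-monoˡ-< (ι m) 0≺1)

ι-cancel-< : ∀ {m n} → ι m ≺ ι n → m ℕ.< n
ι-cancel-< {m} {n} lt = ℕₚ.≰⇒> λ n≤m → ℚₚ.<-irrefl refl (ℚₚ.<-≤-trans lt (ι-mono n≤m))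

abstract
  -- Total, with value 0 at 0, so that nonnegativity needs no side condition; abstract, so that
  -- reciprocals of literals are never computed.
  inv : ℕ → ℚ
  inv zero    = 0ℚ
  inv (suc n) = 1/_ (ι (suc n)) {{ℚₚ.pos⇒nonZero (ι (suc n)) {{positive (0≺ι (suc n))}}}}

  ι⊗inv : ∀ n .{{_ : NonZero n}} → ι n ⊗ inv n ≡ 1ℚ
  ι⊗inv (suc n) = ℚₚ.*-inverseʳ (ι (suc n)) {{ℚₚ.pos⇒nonZero (ι (suc n)) {{positive (0≺ι (suc n))}}}}

  0≼inv : ∀ n → 0ℚ ≼ inv n
  0≼inv zero    = ℚₚ.≤-refl
  0≼inv (suc n) = ⊗-cancel (ι (suc n)) (0≺ι (suc n))
    (subst₂ _≼_ (sym (ℚₚ.*-zeroʳ (ι (suc n)))) (sym (ι⊗inv (suc n))) 0≼1)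

≼inv : ∀ {a} n .{{_ : NonZero n}} → ι n ⊗ a ≼ 1ℚ → a ≼ inv n
≼inv {a} n p = ⊗-cancel (ι n) (0≺ι n) (subst (ι n ⊗ a ≼_) (sym (ι⊗inv n)) p)

inv-anti : ∀ {m n} .{{_ : NonZero m}} → m ℕ.≤ n → inv n ≼ inv m
inv-anti {m} {n} m≤n = ≼inv m (subst (ι m ⊗ inv n ≼_) (ι⊗inv n {{ℕ.>-nonZero n>0}}) (⊗-monoˡ (0≼inv n) (ι-mono m≤n)))
  where
  n>0 : 0 ℕ.< n
  n>0 = ℕₚ.<-≤-trans (ℕ.>-nonZero⁻¹ m) m≤n

infixr 8 _^ℚ_
_^ℚ_ : ℚ → ℕ → ℚ
a ^ℚ zero  = 1ℚ
a ^ℚ suc n = a ⊗ a ^ℚ n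

0≼^ℚ : ∀ {a} n → 0ℚ ≼ a → 0ℚ ≼ a ^ℚ n
0≼^ℚ zero    p = 0≼1
0≼^ℚ (suc n) p = 0≼⊗ p (0≼^ℚ n p)

^ℚ-mono : ∀ {a b} n → 0ℚ ≼ a → a ≼ b → a ^ℚ n ≼ b ^ℚ n
^ℚ-mono zero    p q = ℚₚ.≤-refl
^ℚ-mono (suc n) p q = ⊗-mono (0≼^ℚ n p) (ℚₚ.≤-trans p q) q (^ℚ-mono n p q)

ι-^ : ∀ m n → ι (m ℕ.^ n) ≡ ι m ^ℚ n
ι-^ m zero    = ι-1
ι-^ m (suc n) = trans (ι-* m (m ℕ.^ n)) (cong (ι m ⊗_) (ι-^ m n))

-- Truncated inclusion–exclusion

-- [dbl b] rather than [2 * b], so that the parity of a degree is visible by pattern matching.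
dbl : ℕ → ℕ
dbl zero    = zero
dbl (suc b) = suc (suc (dbl b))

-- T r gs = Σ_{i ≤ r} (-1)^i e_i(gs), with e_i the elementary symmetric polynomials.
T : ℕ → List ℚ → ℚ
T zero    gs       = 1ℚ
T (suc r) []       = 1ℚ
T (suc r) (g ∷ gs) = T (suc r) gs ⊖ g ⊗ T r gs

e : ℕ → List ℚ → ℚ
e zero    gs       = 1ℚ
e (suc r) []       = 0ℚ
e (suc r) (g ∷ gs) = e (suc r) gs ⊕ g ⊗ e r gs

-- The product of the factors 1 - g, expanded in the same shape as `T`, so that the comparison with
-- `T` and the passage to means follow one recursion.
V : List ℚ → ℚ
V []       = 1ℚ
V (g ∷ gs) = V gs ⊖ g ⊗ V gs

sumℚ : List ℚ → ℚ
sumℚ []       = 0ℚ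
sumℚ (g ∷ gs) = g ⊕ sumℚ gs

Unit : ℚ → Set
Unit g = 0ℚ ≼ g × g ≼ 1ℚ

V-factor : ∀ g v → v ⊖ g ⊗ v ≡ (1ℚ ⊖ g) ⊗ v
V-factor = solve-∀ ℚ-ring

0≼V : ∀ {gs} → All Unit gs → 0ℚ ≼ V gs
0≼V []                      = 0≼1
0≼V {g ∷ gs} ((p , q) ∷ us) = subst (0ℚ ≼_) (sym (V-factor g (V gs))) (0≼⊗ (0≼⊖ q) (0≼V us))

0≼e : ∀ r {gs} → All Unit gs → 0ℚ ≼ e r gs
0≼e zero    us             = 0≼1
0≼e (suc r) []             = ℚₚ.≤-refl
0≼e (suc r) ((p , _) ∷ us) = 0≼⊕ (0≼e (suc r) us) (0≼⊗ p (0≼e r us))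

0≼sumℚ : ∀ {gs} → All Unit gs → 0ℚ ≼ sumℚ gs
0≼sumℚ []             = ℚₚ.≤-refl
0≼sumℚ ((p , _) ∷ us) = 0≼⊕ p (0≼sumℚ us)

V-++ : ∀ gs hs → V (gs ++ hs) ≡ V gs ⊗ V hs
V-++ []       hs = sym (ℚₚ.*-identityˡ (V hs))
V-++ (g ∷ gs) hs = trans (cong (λ v → v ⊖ g ⊗ v) (V-++ gs hs)) (eq g (V gs) (V hs))
  where
  eq : ∀ g v w → v ⊗ w ⊖ g ⊗ (v ⊗ w) ≡ (v ⊖ g ⊗ v) ⊗ w
  eq = solve-∀ ℚ-ring

sumℚ-++ : ∀ gs hs → sumℚ (gs ++ hs) ≡ sumℚ gs ⊕ sumℚ hs
sumℚ-++ []       hs = sym (ℚₚ.+-identityˡ (sumℚ hs))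
sumℚ-++ (g ∷ gs) hs = trans (cong (g ⊕_) (sumℚ-++ gs hs)) (sym (ℚₚ.+-assoc g (sumℚ gs) (sumℚ hs)))

-- The union bound, for arbitrary weights in [0, 1] (the Weierstrass product inequality).
1⊖sum≼V : ∀ {gs} → All Unit gs → 1ℚ ⊖ sumℚ gs ≼ V gs
1⊖sum≼V []                      = ℚₚ.≤-refl
1⊖sum≼V {g ∷ gs} ((p , q) ∷ us) =
  ≼-diff (0≼⊕ (0≼⊗ (0≼⊖ q) (0≼⊖ (1⊖sum≼V us))) (0≼⊗ p (0≼sumℚ us))) (eq g (sumℚ gs) (V gs))
  where
  eq : ∀ g s v → v ⊖ g ⊗ v ≡ (1ℚ ⊖ (g ⊕ s)) ⊕ ((1ℚ ⊖ g) ⊗ (v ⊖ (1ℚ ⊖ s)) ⊕ g ⊗ s)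
  eq = solve-∀ ℚ-ring

mutual
  -- The Bonferroni inequalities. A new entry g subtracts g times the truncation of the previous
  -- degree, whose parity is opposite, so the two bounds are proved together. Entries in [0, 1]
  -- cover both the indicators `Es` and their means `gs`.
  V≼T : ∀ b {gs} → All Unit gs → V gs ≼ T (dbl b) gs
  V≼T zero    []       = ℚₚ.≤-refl
  V≼T zero {g ∷ gs} ((p , q) ∷ us) = ℚₚ.≤-trans
    (≼-diff (0≼⊗ p (0≼V us)) (eq g (V gs))) (V≼T zero us)
    where
    eq : ∀ g v → v ≡ (v ⊖ g ⊗ v) ⊕ g ⊗ v
    eq = solve-∀ ℚ-ring
  V≼T (suc b) []       = ℚₚ.≤-refl
  V≼T (suc b) {g ∷ gs} ((p , q) ∷ us) =
    ≼-diff (0≼⊕ (0≼⊖ (V≼T (suc b) us)) (0≼⊗ p (0≼⊖ (T≼V b us))))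
           (eq g (V gs) (T (suc (suc (dbl b))) gs) (T (suc (dbl b)) gs))
    where
    eq : ∀ g v s t → s ⊖ g ⊗ t ≡ (v ⊖ g ⊗ v) ⊕ ((s ⊖ v) ⊕ g ⊗ (v ⊖ t))
    eq = solve-∀ ℚ-ring

  T≼V : ∀ b {gs} → All Unit gs → T (suc (dbl b)) gs ≼ V gs
  T≼V b       []       = ℚₚ.≤-refl
  T≼V b {g ∷ gs} ((p , q) ∷ us) =
    ≼-diff (0≼⊕ (0≼⊖ (T≼V b us)) (0≼⊗ p (0≼⊖ (V≼T b us))))
           (eq g (V gs) (T (suc (dbl b)) gs) (T (dbl b) gs))
    where
    eq : ∀ g v s t → v ⊖ g ⊗ v ≡ (s ⊖ g ⊗ t) ⊕ ((v ⊖ s) ⊕ g ⊗ (t ⊖ v))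
    eq = solve-∀ ℚ-ring

mutual
  -- Consecutive truncations differ by the one symmetric polynomial between them, added or
  -- subtracted according to parity. There are two statements so that no sign (-1) ^ r appears.
  T-even : ∀ b gs → T (dbl b) gs ≡ T (suc (dbl b)) gs ⊕ e (suc (dbl b)) gs
  T-even b [] = trans (lem b) (sym (ℚₚ.+-identityʳ 1ℚ))
    where
    lem : ∀ b → T (dbl b) [] ≡ 1ℚ
    lem zero    = refl
    lem (suc b) = refl
  T-even zero (g ∷ gs) = trans (T-even zero gs) (eq (T 1 gs) (e 1 gs) g)
    where
    eq : ∀ t e g → t ⊕ e ≡ (t ⊖ g ⊗ 1ℚ) ⊕ (e ⊕ g ⊗ 1ℚ)
    eq = solve-∀ ℚ-ring
  T-even (suc b) (g ∷ gs) = begin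
    t₂ ⊖ g ⊗ t₁               ≡⟨ eq₁ g t₁ t₂ e₂ ⟩
    t₂ ⊖ g ⊗ (t₁ ⊕ e₂) ⊕ g ⊗ e₂ ≡⟨ cong₂ (λ x y → x ⊖ g ⊗ y ⊕ g ⊗ e₂) (T-even (suc b) gs) (sym (T-odd b gs)) ⟩
    (t₃ ⊕ e₃) ⊖ g ⊗ t₂ ⊕ g ⊗ e₂ ≡⟨ eq₂ g t₂ t₃ e₂ e₃ ⟩
    (t₃ ⊖ g ⊗ t₂) ⊕ (e₃ ⊕ g ⊗ e₂) ∎
    where
    open ≡-Reasoning
    t₁ = T (suc (dbl b)) gs
    t₂ = T (dbl (suc b)) gs
    t₃ = T (suc (dbl (suc b))) gs
    e₂ = e (dbl (suc b)) gs
    e₃ = e (suc (dbl (suc b))) gs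
    eq₁ : ∀ g t₁ t₂ e₂ → t₂ ⊖ g ⊗ t₁ ≡ t₂ ⊖ g ⊗ (t₁ ⊕ e₂) ⊕ g ⊗ e₂
    eq₁ = solve-∀ ℚ-ring
    eq₂ : ∀ g t₂ t₃ e₂ e₃ → (t₃ ⊕ e₃) ⊖ g ⊗ t₂ ⊕ g ⊗ e₂ ≡ (t₃ ⊖ g ⊗ t₂) ⊕ (e₃ ⊕ g ⊗ e₂)
    eq₂ = solve-∀ ℚ-ring

  T-odd : ∀ b gs → T (dbl (suc b)) gs ≡ T (suc (dbl b)) gs ⊕ e (dbl (suc b)) gs
  T-odd b [] = sym (ℚₚ.+-identityʳ 1ℚ)
  T-odd b (g ∷ gs) = begin
    t₂ ⊖ g ⊗ t₁                       ≡⟨ cong (λ x → x ⊖ g ⊗ t₁) (T-odd b gs) ⟩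
    (t₁ ⊕ e₂) ⊖ g ⊗ t₁                ≡⟨ eq g t₁ e₁ e₂ ⟩
    (t₁ ⊖ g ⊗ (t₁ ⊕ e₁)) ⊕ (e₂ ⊕ g ⊗ e₁) ≡⟨ cong (λ x → (t₁ ⊖ g ⊗ x) ⊕ (e₂ ⊕ g ⊗ e₁)) (sym (T-even b gs)) ⟩
    (t₁ ⊖ g ⊗ t₀) ⊕ (e₂ ⊕ g ⊗ e₁)     ∎
    where
    open ≡-Reasoning
    t₀ = T (dbl b) gs
    t₁ = T (suc (dbl b)) gs
    t₂ = T (dbl (suc b)) gs
    e₁ = e (suc (dbl b)) gs
    e₂ = e (dbl (suc b)) gs
    eq : ∀ g t₁ e₁ e₂ → (t₁ ⊕ e₂) ⊖ g ⊗ t₁ ≡ (t₁ ⊖ g ⊗ (t₁ ⊕ e₁)) ⊕ (e₂ ⊕ g ⊗ e₁)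
    eq = solve-∀ ℚ-ring

-- The truncation one degree further is already a lower bound, so the excess is at most the first
-- omitted term.
T≼V⊕e : ∀ b {gs} → All Unit gs → T (dbl b) gs ≼ V gs ⊕ e (suc (dbl b)) gs
T≼V⊕e b {gs} us = subst (_≼ V gs ⊕ e (suc (dbl b)) gs) (sym (T-even b gs))
  (ℚₚ.+-monoˡ-≤ (e (suc (dbl b)) gs) (T≼V b us))

-- The left side consists of the first two terms of the binomial expansion; the induction drops a
-- term in g².
bernoulli : ∀ r {g s} → 0ℚ ≼ g → 0ℚ ≼ s →
  s ^ℚ suc r ⊕ ι (suc r) ⊗ (g ⊗ s ^ℚ r) ≼ (g ⊕ s) ^ℚ suc r
bernoulli zero    {g} {s} p q = ℚₚ.≤-reflexive
  (trans (cong (λ i → s ⊗ 1ℚ ⊕ i ⊗ (g ⊗ 1ℚ)) ι-1) (eq g s))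
  where
  eq : ∀ g s → s ⊗ 1ℚ ⊕ 1ℚ ⊗ (g ⊗ 1ℚ) ≡ (g ⊕ s) ⊗ 1ℚ
  eq = solve-∀ ℚ-ring
bernoulli (suc r) {g} {s} p q = ℚₚ.≤-trans
  (≼-diff (0≼⊗ (0≼ι (suc r)) (0≼⊗ p (0≼⊗ p (0≼^ℚ r q)))) eq′)
  (⊗-monoʳ (0≼⊕ p q) (bernoulli r p q))
  where
  eq : ∀ i g s t → (g ⊕ s) ⊗ (s ⊗ t ⊕ i ⊗ (g ⊗ t)) ≡ (s ⊗ (s ⊗ t) ⊕ (1ℚ ⊕ i) ⊗ (g ⊗ (s ⊗ t))) ⊕ i ⊗ (g ⊗ (g ⊗ t))
  eq = solve-∀ ℚ-ring
  eq′ : (g ⊕ s) ⊗ (s ^ℚ suc r ⊕ ι (suc r) ⊗ (g ⊗ s ^ℚ r)) ≡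
        (s ^ℚ suc (suc r) ⊕ ι (suc (suc r)) ⊗ (g ⊗ s ^ℚ suc r)) ⊕ ι (suc r) ⊗ (g ⊗ (g ⊗ s ^ℚ r))
  eq′ = trans (eq (ι (suc r)) g s (s ^ℚ r))
    (cong (λ i → (s ^ℚ suc (suc r) ⊕ i ⊗ (g ⊗ s ^ℚ suc r)) ⊕ ι (suc r) ⊗ (g ⊗ (g ⊗ s ^ℚ r))) (sym (ι-suc (suc r))))

-- Each product of r distinct entries occurs r! times in the expanded power. The induction adds one
-- entry g and lets `bernoulli` absorb its contribution.
e-bound : ∀ r {gs} → All Unit gs → ι (r !) ⊗ e r gs ≼ sumℚ gs ^ℚ r
e-bound zero    us = ℚₚ.≤-reflexive (trans (cong (_⊗ 1ℚ) ι-1) (ℚₚ.*-identityʳ 1ℚ))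
e-bound (suc r) [] = ℚₚ.≤-reflexive (trans (ℚₚ.*-zeroʳ (ι (suc r !))) (sym (ℚₚ.*-zeroˡ (0ℚ ^ℚ r))))
e-bound (suc r) {g ∷ gs} ((p , q) ∷ us) = ℚₚ.≤-trans
  (ℚₚ.≤-trans (ℚₚ.≤-reflexive eq′)
    (ℚₚ.+-mono-≤ (e-bound (suc r) us) (⊗-monoʳ (0≼ι (suc r)) (⊗-monoʳ p (e-bound r us)))))
  (bernoulli r p (0≼sumℚ us))
  where
  eq : ∀ f g x y → (f ⊗ (x ⊕ g ⊗ y)) ≡ f ⊗ x ⊕ g ⊗ (f ⊗ y)
  eq = solve-∀ ℚ-ring
  eq₂ : ∀ i j g y → g ⊗ ((i ⊗ j) ⊗ y) ≡ i ⊗ (g ⊗ (j ⊗ y))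
  eq₂ = solve-∀ ℚ-ring
  eq′ : ι (suc r !) ⊗ (e (suc r) gs ⊕ g ⊗ e r gs) ≡ ι (suc r !) ⊗ e (suc r) gs ⊕ ι (suc r) ⊗ (g ⊗ (ι (r !) ⊗ e r gs))
  eq′ = trans (eq (ι (suc r !)) g (e (suc r) gs) (e r gs))
    (cong (ι (suc r !) ⊗ e (suc r) gs ⊕_)
      (trans (cong (λ f → g ⊗ (f ⊗ e r gs)) (ι-* (suc r) (r !))) (eq₂ (ι (suc r)) (ι (r !)) g (e r gs))))

-- Residue classes and the Chinese remainder theorem

sumTo : ℕ → (ℕ → ℚ) → ℚ
sumTo zero    f = 0ℚ
sumTo (suc n) f = sumTo n f ⊕ f n

sumTo-cong : ∀ n {f g} → (∀ t → t ℕ.< n → f t ≡ g t) → sumTo n f ≡ sumTo n g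
sumTo-cong zero    h = refl
sumTo-cong (suc n) h = cong₂ _⊕_ (sumTo-cong n (λ t lt → h t (ℕₚ.m<n⇒m<1+n lt))) (h n ℕₚ.≤-refl)

sumTo-⊕ : ∀ n f g → sumTo n (λ t → f t ⊕ g t) ≡ sumTo n f ⊕ sumTo n g
sumTo-⊕ zero    f g = refl
sumTo-⊕ (suc n) f g = trans (cong (_⊕ (f n ⊕ g n)) (sumTo-⊕ n f g)) (⊕-interchange (sumTo n f) (sumTo n g) (f n) (g n))

sumTo-⊗ : ∀ n c f → sumTo n (λ t → c ⊗ f t) ≡ c ⊗ sumTo n f
sumTo-⊗ zero    c f = sym (ℚₚ.*-zeroʳ c)
sumTo-⊗ (suc n) c f = trans (cong (_⊕ c ⊗ f n) (sumTo-⊗ n c f)) (sym (ℚₚ.*-distribˡ-+ c (sumTo n f) (f n)))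

sumTo-nonneg : ∀ n {f} → (∀ t → 0ℚ ≼ f t) → 0ℚ ≼ sumTo n f
sumTo-nonneg zero    h = ℚₚ.≤-refl
sumTo-nonneg (suc n) h = 0≼⊕ (sumTo-nonneg n h) (h n)

sumTo-mono : ∀ {m n} f → (∀ t → 0ℚ ≼ f t) → m ℕ.≤ n → sumTo m f ≼ sumTo n f
sumTo-mono {m} {n} f h m≤n with ℕₚ.≤⇒≤′ m≤n
... | p = go p
  where
  go : ∀ {n} → m ℕ.≤′ n → sumTo m f ≼ sumTo n f
  go ℕ.≤′-refl           = ℚₚ.≤-refl
  go (ℕ.≤′-step {n} p) = ℚₚ.≤-trans (go p) (≼-diff (h n) refl)

∃-positive : ∀ n f → 0ℚ ≺ sumTo n f → ∃[ t ] (t ℕ.< n × 0ℚ ≺ f t)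
∃-positive zero    f p = ⊥-elim (ℚₚ.<-irrefl refl p)
∃-positive (suc n) f p with 0ℚ ℚₚ.<? f n | 0ℚ ℚₚ.<? sumTo n f
... | yes q | _     = n , ℕₚ.≤-refl , q
... | no ¬q | yes q with ∃-positive n f q
...   | t , t<n , r = t , ℕₚ.m<n⇒m<1+n t<n , r
∃-positive (suc n) f p | no ¬q | no ¬r =
  ⊥-elim (ℚₚ.<-irrefl refl (ℚₚ.<-≤-trans p (ℚₚ.+-mono-≤ (ℚₚ.≮⇒≥ ¬r) (ℚₚ.≮⇒≥ ¬q))))

ind : ∀ {P : Set} → Dec P → ℚ
ind d = if does d then 1ℚ else 0ℚ

ind-unit : ∀ {P : Set} (d : Dec P) → Unit (ind d)
ind-unit (yes _) = 0≼1 , ℚₚ.≤-refl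
ind-unit (no _)  = ℚₚ.≤-refl , 0≼1

ind-yes : ∀ {P : Set} (d : Dec P) → P → ind d ≡ 1ℚ
ind-yes (yes _) p = refl
ind-yes (no ¬p) p = ⊥-elim (¬p p)

ind-no : ∀ {P : Set} (d : Dec P) → ¬ P → ind d ≡ 0ℚ
ind-no (yes p) ¬p = ⊥-elim (¬p p)
ind-no (no _)  ¬p = refl

ind-cong : ∀ {P Q : Set} (d : Dec P) (d′ : Dec Q) → (P → Q) → (Q → P) → ind d ≡ ind d′
ind-cong (yes p) d′ f g = sym (ind-yes d′ (f p))
ind-cong (no ¬p) d′ f g = sym (ind-no d′ (¬p ∘ g))

ind-× : ∀ {P Q R : Set} (d : Dec P) (d₁ : Dec Q) (d₂ : Dec R) → (P → Q × R) → (Q → R → P) → ind d ≡ ind d₁ ⊗ ind d₂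
ind-× d (yes q) (yes r) f g = ind-yes d (g q r)
ind-× d (yes q) (no ¬r) f g = ind-no d (¬r ∘ proj₂ ∘ f)
ind-× d (no ¬q) d₂      f g = trans (ind-no d (¬q ∘ proj₁ ∘ f)) (sym (ℚₚ.*-zeroˡ (ind d₂)))

-- The residue is an integer because the representative built in `cls-crt` may be negative.
cls : ℕ → ℤ → ℕ → ℚ
cls q x t = ind (+ q ∣? (+ t ℤ.- x))

cls-shift : ∀ q x y → + q ∣ (x ℤ.- y) → ∀ t → cls q x t ≡ cls q y t
cls-shift q x y d t = ind-cong (+ q ∣? (+ t ℤ.- x)) (+ q ∣? (+ t ℤ.- y))
  (λ p → subst (+ q ∣_) (eq₁ (+ t) x y) (∣m∣n⇒∣m+n p d))
  (λ p → subst (+ q ∣_) (eq₂ (+ t) x y) (∣m∣n⇒∣m-n p d))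
  where
  eq₁ : ∀ t x y → (t ℤ.- x) ℤ.+ (x ℤ.- y) ≡ t ℤ.- y
  eq₁ = ℤS.solve-∀
  eq₂ : ∀ t x y → (t ℤ.- y) ℤ.- (x ℤ.- y) ≡ t ℤ.- x
  eq₂ = ℤS.solve-∀

cls-period : ∀ q x t → cls q x (t ℕ.+ q) ≡ cls q x t
cls-period q x t = ind-cong (+ q ∣? (+ (t ℕ.+ q) ℤ.- x)) (+ q ∣? (+ t ℤ.- x))
  (λ p → subst (+ q ∣_) (eq₁ (+ t) (+ q) x) (∣m∣n⇒∣m-n (subst (λ z → + q ∣ (z ℤ.- x)) (ℤₚ.pos-+ t q) p) ∣-refl))
  (λ p → subst (λ z → + q ∣ (z ℤ.- x)) (sym (ℤₚ.pos-+ t q)) (subst (+ q ∣_) (eq₂ (+ t) (+ q) x) (∣m∣n⇒∣m+n p ∣-refl)))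
  where
  eq₁ : ∀ t q x → ((t ℤ.+ q) ℤ.- x) ℤ.- q ≡ t ℤ.- x
  eq₁ = ℤS.solve-∀
  eq₂ : ∀ t q x → (t ℤ.- x) ℤ.+ q ≡ (t ℤ.+ q) ℤ.- x
  eq₂ = ℤS.solve-∀

sumTo-shift : ∀ q f → (∀ t → f (t ℕ.+ q) ≡ f t) → ∀ n → sumTo (n ℕ.+ q) f ≡ sumTo n f ⊕ sumTo q f
sumTo-shift q f h zero    = sym (ℚₚ.+-identityˡ (sumTo q f))
sumTo-shift q f h (suc n) = trans (cong₂ _⊕_ (sumTo-shift q f h n) (h n)) (eq (sumTo n f) (sumTo q f) (f n))
  where
  eq : ∀ a b c → (a ⊕ b) ⊕ c ≡ (a ⊕ c) ⊕ b
  eq = solve-∀ ℚ-ring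

sumTo-shifts : ∀ q f → (∀ t → f (t ℕ.+ q) ≡ f t) → ∀ s k → sumTo (s ℕ.+ k ℕ.* q) f ≡ sumTo s f ⊕ ι k ⊗ sumTo q f
sumTo-shifts q f h s zero = trans (cong (λ n → sumTo n f) (ℕₚ.+-identityʳ s))
  (sym (trans (cong (λ z → sumTo s f ⊕ z ⊗ sumTo q f) ι-0) (eq (sumTo s f) (sumTo q f))))
  where
  eq : ∀ a b → a ⊕ 0ℚ ⊗ b ≡ a
  eq = solve-∀ ℚ-ring
sumTo-shifts q f h s (suc k) = begin
  sumTo (s ℕ.+ (q ℕ.+ k ℕ.* q)) f               ≡⟨ cong (λ n → sumTo n f) (trans (cong (s ℕ.+_) (ℕₚ.+-comm q (k ℕ.* q))) (sym (ℕₚ.+-assoc s (k ℕ.* q) q))) ⟩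
  sumTo (s ℕ.+ k ℕ.* q ℕ.+ q) f                 ≡⟨ sumTo-shift q f h (s ℕ.+ k ℕ.* q) ⟩
  sumTo (s ℕ.+ k ℕ.* q) f ⊕ sumTo q f           ≡⟨ cong (_⊕ sumTo q f) (sumTo-shifts q f h s k) ⟩
  sumTo s f ⊕ ι k ⊗ sumTo q f ⊕ sumTo q f       ≡⟨ eq (sumTo s f) (ι k) (sumTo q f) ⟩
  sumTo s f ⊕ (1ℚ ⊕ ι k) ⊗ sumTo q f            ≡⟨ cong (λ z → sumTo s f ⊕ z ⊗ sumTo q f) (sym (ι-suc k)) ⟩
  sumTo s f ⊕ ι (suc k) ⊗ sumTo q f             ∎
  where
  open ≡-Reasoning
  eq : ∀ a k b → a ⊕ k ⊗ b ⊕ b ≡ a ⊕ (1ℚ ⊕ k) ⊗ b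
  eq = solve-∀ ℚ-ring

sum-≟-before : ∀ n r → n ℕ.≤ r → sumTo n (λ t → ind (t ℕₚ.≟ r)) ≡ 0ℚ
sum-≟-before zero    r le = refl
sum-≟-before (suc n) r le = trans (cong₂ _⊕_ (sum-≟-before n r (ℕₚ.<⇒≤ le)) (ind-no (n ℕₚ.≟ r) (ℕₚ.<⇒≢ le))) refl

sum-≟ : ∀ n r → r ℕ.< n → sumTo n (λ t → ind (t ℕₚ.≟ r)) ≡ 1ℚ
sum-≟ (suc n) r (ℕ.s≤s r≤n) with n ℕₚ.≟ r
... | yes refl = trans (cong (_⊕ ind (n ℕₚ.≟ n)) (sum-≟-before n n ℕₚ.≤-refl))
                       (trans (ℚₚ.+-identityˡ _) (ind-yes (n ℕₚ.≟ n) refl))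
... | no n≢r   = trans (cong₂ _⊕_ (sum-≟ n r (ℕₚ.≤∧≢⇒< r≤n (n≢r ∘ sym))) (ind-no (n ℕₚ.≟ r) n≢r)) (ℚₚ.+-identityʳ 1ℚ)

residue-unique : ∀ q {r t} → r ℕ.< q → t ℕ.< q → + q ∣ (+ t ℤ.- + r) → t ≡ r
residue-unique q {r} {t} r<q t<q d = ℤₚ.+-injective (ℤₚ.i-j≡0⇒i≡j (+ t) (+ r) (ℤₚ.∣i∣≡0⇒i≡0 (lemma (∣⇒∣ᵤ d))))
  where
  bound : ℤ.∣ + t ℤ.- + r ∣ ℕ.< q
  bound = subst (λ z → ℤ.∣ z ∣ ℕ.< q) (sym (ℤₚ.m-n≡m⊖n t r))
    (ℕₚ.≤-<-trans (ℤₚ.∣m⊝n∣≤m⊔n t r) (ℕₚ.⊔-lub t<q r<q))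
  lemma : q ℕ∣.∣ ℤ.∣ + t ℤ.- + r ∣ → ℤ.∣ + t ℤ.- + r ∣ ≡ 0
  lemma d with ℤ.∣ + t ℤ.- + r ∣ | bound
  ... | zero  | _ = refl
  ... | suc k | b = ⊥-elim (ℕₚ.<⇒≱ b (ℕ∣.∣⇒≤ d))

sum-cls-period : ∀ q .{{_ : NonZero q}} x → sumTo q (cls q x) ≡ 1ℚ
sum-cls-period q x = trans (sumTo-cong q (λ t t<q →
    trans (cls-shift q x (+ r) (divides (x /ℕ q) eq) t)
          (ind-cong (+ q ∣? (+ t ℤ.- + r)) (t ℕₚ.≟ r) (residue-unique q r<q t<q) λ { refl → divides (+ 0) (ℤₚ.+-inverseʳ (+ t)) })))
  (sum-≟ q r r<q)
  where
  r = x %ℕ q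
  r<q = n%ℕd<d x q
  eq′ : ∀ r a q → (r ℤ.+ a ℤ.* q) ℤ.- r ≡ a ℤ.* q
  eq′ = ℤS.solve-∀
  eq : x ℤ.- + r ≡ (x /ℕ q) ℤ.* + q
  eq = trans (cong (ℤ._- + r) (a≡a%ℕn+[a/ℕn]*n x q)) (eq′ (+ r) (x /ℕ q) (+ q))

Near : ℚ → ℚ → ℚ → Set
Near a b c = a ≼ b ⊕ c × b ≼ a ⊕ c

-- N splits into full periods, each with exactly one hit, and a remainder shorter than D with at
-- most one. Multiplying the count by D avoids the quotient N / D.
count-cls : ∀ N D .{{_ : NonZero D}} x → Near (ι D ⊗ sumTo N (cls D x)) (ι N) (ι D)
count-cls N D x = subst₂ (λ a b → Near a b (ι D)) (sym eqS) (sym eqN) (upper , lower)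
  where
  s = N DM.% D
  k = N DM./ D
  c = sumTo s (cls D x)
  c≥0 : 0ℚ ≼ c
  c≥0 = sumTo-nonneg s (λ t → proj₁ (ind-unit (+ D ∣? (+ t ℤ.- x))))
  c≤1 : c ≼ 1ℚ
  c≤1 = subst (c ≼_) (sum-cls-period D x) (sumTo-mono (cls D x) (λ t → proj₁ (ind-unit (+ D ∣? (+ t ℤ.- x)))) (ℕₚ.<⇒≤ (DM.m%n<n N D)))
  s≤D : ι s ≼ ι D
  s≤D = ι-mono (ℕₚ.<⇒≤ (DM.m%n<n N D))
  eqN : ι N ≡ ι s ⊕ ι k ⊗ ι D
  eqN = trans (cong ι (DM.m≡m%n+[m/n]*n N D)) (trans (ι-+ s (k ℕ.* D)) (cong (ι s ⊕_) (ι-* k D)))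
  eqS : ι D ⊗ sumTo N (cls D x) ≡ ι D ⊗ (c ⊕ ι k ⊗ 1ℚ)
  eqS = cong (ι D ⊗_) (trans (cong (λ n → sumTo n (cls D x)) (DM.m≡m%n+[m/n]*n N D))
          (trans (sumTo-shifts D (cls D x) (cls-period D x) s k) (cong (λ z → c ⊕ ι k ⊗ z) (sum-cls-period D x))))
  upper : ι D ⊗ (c ⊕ ι k ⊗ 1ℚ) ≼ (ι s ⊕ ι k ⊗ ι D) ⊕ ι D
  upper = ≼-diff (0≼⊕ (0≼ι s) (0≼⊗ (0≼ι D) (0≼⊖ c≤1))) (eq (ι D) c (ι k) (ι s))
    where
    eq : ∀ d c k s → (s ⊕ k ⊗ d) ⊕ d ≡ d ⊗ (c ⊕ k ⊗ 1ℚ) ⊕ (s ⊕ d ⊗ (1ℚ ⊖ c))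
    eq = solve-∀ ℚ-ring
  lower : ι s ⊕ ι k ⊗ ι D ≼ ι D ⊗ (c ⊕ ι k ⊗ 1ℚ) ⊕ ι D
  lower = ≼-diff (0≼⊕ (0≼⊖ s≤D) (0≼⊗ (0≼ι D) c≥0)) (eq (ι D) c (ι k) (ι s))
    where
    eq : ∀ d c k s → d ⊗ (c ⊕ k ⊗ 1ℚ) ⊕ d ≡ (s ⊕ k ⊗ d) ⊕ ((d ⊖ s) ⊕ d ⊗ c)
    eq = solve-∀ ℚ-ring

coprime-*-∣ : ∀ {m n k} → Coprime m n → m ℕ∣.∣ k → n ℕ∣.∣ k → m ℕ.* n ℕ∣.∣ k
coprime-*-∣ {m} {n} {k} c (ℕ∣.divides-refl j) n∣k =
  subst (m ℕ.* n ℕ∣.∣_) (ℕₚ.*-comm m j) (ℕ∣.*-monoʳ-∣ m (coprime-divisor (λ (a , b) → c (b , a)) (subst (n ℕ∣.∣_) (ℕₚ.*-comm j m) n∣k)))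

inverse-mod : ∀ {D q} → Coprime D q → ∃[ u ] (+ q ∣ (+ D ℤ.* u ℤ.- + 1))
inverse-mod {D} {q} c with coprime-Bézout c
... | Bézout.+- x y eq = + x , divides (+ y) (lemma (+ D) (+ x) (+ y) (+ q)
        (trans (cong (λ z → + 1 ℤ.+ z) (sym (ℤₚ.pos-* y q))) (trans (sym (ℤₚ.pos-+ 1 (y ℕ.* q))) (trans (cong (λ n → + n) eq) (ℤₚ.pos-* x D)))))
  where
  lem : ∀ D x y q → (+ 1 ℤ.+ y ℤ.* q) ℤ.- + 1 ≡ y ℤ.* q
  lem = ℤS.solve-∀
  lemma : ∀ D x y q → + 1 ℤ.+ y ℤ.* q ≡ x ℤ.* D → D ℤ.* x ℤ.- + 1 ≡ y ℤ.* q
  lemma D x y q h = trans (cong (ℤ._- + 1) (trans (ℤₚ.*-comm D x) (sym h))) (lem D x y q)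
... | Bézout.-+ x y eq = ℤ.- + x , divides (ℤ.- + y) (lemma (+ D) (+ x) (+ y) (+ q)
        (trans (cong (λ z → + 1 ℤ.+ z) (sym (ℤₚ.pos-* x D))) (trans (sym (ℤₚ.pos-+ 1 (x ℕ.* D))) (trans (cong (λ n → + n) eq) (ℤₚ.pos-* y q)))))
  where
  lem : ∀ D x → D ℤ.* (ℤ.- x) ℤ.- + 1 ≡ ℤ.- (+ 1 ℤ.+ x ℤ.* D)
  lem = ℤS.solve-∀
  lem₂ : ∀ y q → ℤ.- (y ℤ.* q) ≡ (ℤ.- y) ℤ.* q
  lem₂ = ℤS.solve-∀
  lemma : ∀ D x y q → + 1 ℤ.+ x ℤ.* D ≡ y ℤ.* q → D ℤ.* (ℤ.- x) ℤ.- + 1 ≡ (ℤ.- y) ℤ.* q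
  lemma D x y q h = trans (lem D x) (trans (cong ℤ.-_ h) (lem₂ y q))

cls-crt : ∀ {D q} → Coprime D q → ∀ x r → ∃[ y ] (∀ t → cls (D ℕ.* q) y t ≡ cls D x t ⊗ cls q r t)
cls-crt {D} {q} c x r with inverse-mod c
... | u , q∣Du-1 = y , λ t → ind-× (+ (D ℕ.* q) ∣? (+ t ℤ.- y)) (+ D ∣? (+ t ℤ.- x)) (+ q ∣? (+ t ℤ.- r)) (split t) (join t)
  where
  -- Since D u is 1 modulo q, this is x modulo D and r modulo q.
  y = x ℤ.+ + D ℤ.* (u ℤ.* (r ℤ.- x))
  D-part : + D ∣ + D ℤ.* (u ℤ.* (r ℤ.- x))
  D-part = ∣m⇒∣m*n (u ℤ.* (r ℤ.- x)) ∣-refl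
  q-part : + q ∣ (+ D ℤ.* u ℤ.- + 1) ℤ.* (r ℤ.- x)
  q-part = ∣m⇒∣m*n (r ℤ.- x) q∣Du-1
  eq₁ : ∀ t x d u r → (t ℤ.- (x ℤ.+ d ℤ.* (u ℤ.* (r ℤ.- x)))) ℤ.+ d ℤ.* (u ℤ.* (r ℤ.- x)) ≡ t ℤ.- x
  eq₁ = ℤS.solve-∀
  eq₂ : ∀ t x d u r → (t ℤ.- (x ℤ.+ d ℤ.* (u ℤ.* (r ℤ.- x)))) ℤ.+ (d ℤ.* u ℤ.- + 1) ℤ.* (r ℤ.- x) ≡ t ℤ.- r
  eq₂ = ℤS.solve-∀
  eq₃ : ∀ t x d u r → (t ℤ.- x) ℤ.- d ℤ.* (u ℤ.* (r ℤ.- x)) ≡ t ℤ.- (x ℤ.+ d ℤ.* (u ℤ.* (r ℤ.- x)))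
  eq₃ = ℤS.solve-∀
  eq₄ : ∀ t x d u r → (t ℤ.- r) ℤ.- (d ℤ.* u ℤ.- + 1) ℤ.* (r ℤ.- x) ≡ t ℤ.- (x ℤ.+ d ℤ.* (u ℤ.* (r ℤ.- x)))
  eq₄ = ℤS.solve-∀
  split : ∀ t → + (D ℕ.* q) ∣ (+ t ℤ.- y) → (+ D ∣ (+ t ℤ.- x)) × (+ q ∣ (+ t ℤ.- r))
  split t h =
    subst (+ D ∣_) (eq₁ (+ t) x (+ D) u r) (∣m∣n⇒∣m+n (∣-trans (divides (+ q) (trans (ℤₚ.pos-* D q) (ℤₚ.*-comm (+ D) (+ q)))) h) D-part) ,
    subst (+ q ∣_) (eq₂ (+ t) x (+ D) u r) (∣m∣n⇒∣m+n (∣-trans (divides (+ D) (ℤₚ.pos-* D q)) h) q-part)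
  join : ∀ t → + D ∣ (+ t ℤ.- x) → + q ∣ (+ t ℤ.- r) → + (D ℕ.* q) ∣ (+ t ℤ.- y)
  join t h₁ h₂ = ∣ᵤ⇒∣ (coprime-*-∣ c
    (∣⇒∣ᵤ (subst (+ D ∣_) (eq₃ (+ t) x (+ D) u r) (∣m∣n⇒∣m-n h₁ D-part)))
    (∣⇒∣ᵤ (subst (+ q ∣_) (eq₄ (+ t) x (+ D) u r) (∣m∣n⇒∣m-n h₂ q-part))))

-- Means over residue classes

-- On every class modulo D the sum of f is μ N / D up to ν. Here ν counts the residue classes of
-- which f is a combination, each causing an error of at most 1.
record Approx (N D : ℕ) (f : ℕ → ℚ) (μ : ℚ) (ν : ℕ) : Set where
  constructor approx
  field
    near : ∀ x → Near (ι D ⊗ sumTo N (λ t → cls D x t ⊗ f t)) (μ ⊗ ι N) (ι ν ⊗ ι D)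

open Approx

near-⊕ : ∀ {a b c a′ b′ c′} → Near a b c → Near a′ b′ c′ → Near (a ⊕ a′) (b ⊕ b′) (c ⊕ c′)
near-⊕ {a} {b} {c} {a′} {b′} {c′} (p , q) (p′ , q′) =
  ℚₚ.≤-trans (ℚₚ.+-mono-≤ p p′) (ℚₚ.≤-reflexive (⊕-interchange b c b′ c′)) ,
  ℚₚ.≤-trans (ℚₚ.+-mono-≤ q q′) (ℚₚ.≤-reflexive (⊕-interchange a c a′ c′))

near-⊗ : ∀ {a b c} k → 0ℚ ≼ k → Near a b c → Near (k ⊗ a) (k ⊗ b) (k ⊗ c)
near-⊗ {a} {b} {c} k h (p , q) =
  ℚₚ.≤-trans (⊗-monoʳ h p) (ℚₚ.≤-reflexive (ℚₚ.*-distribˡ-+ k b c)) ,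
  ℚₚ.≤-trans (⊗-monoʳ h q) (ℚₚ.≤-reflexive (ℚₚ.*-distribˡ-+ k a c))

near-⊝ : ∀ {a b c} → Near a b c → Near (⊝ a) (⊝ b) c
near-⊝ {a} {b} {c} (p , q) = ≼-diff (0≼⊖ q) (eq a b c) , ≼-diff (0≼⊖ p) (eq b a c)
  where
  eq : ∀ a b c → ⊝ b ⊕ c ≡ ⊝ a ⊕ (a ⊕ c ⊖ b)
  eq = solve-∀ ℚ-ring

near-≼ : ∀ {a b c d} → c ≼ d → Near a b c → Near a b d
near-≼ {a} {b} h (p , q) = ℚₚ.≤-trans p (ℚₚ.+-monoʳ-≤ b h) , ℚₚ.≤-trans q (ℚₚ.+-monoʳ-≤ a h)

near-≡ : ∀ {a b c a′ b′ c′} → a ≡ a′ → b ≡ b′ → c ≡ c′ → Near a b c → Near a′ b′ c′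
near-≡ refl refl refl n = n

approx-1 : ∀ N D .{{_ : NonZero D}} → Approx N D (λ _ → 1ℚ) 1ℚ 1
approx-1 N D = approx λ x → near-≡
  (cong (ι D ⊗_) (sumTo-cong N (λ t _ → sym (ℚₚ.*-identityʳ (cls D x t)))))
  (sym (ℚₚ.*-identityˡ (ι N)))
  (sym (trans (cong (_⊗ ι D) ι-1) (ℚₚ.*-identityˡ (ι D))))
  (count-cls N D x)

approx-ext : ∀ {N D f g μ ν} → (∀ t → f t ≡ g t) → Approx N D f μ ν → Approx N D g μ ν
approx-ext {N} {D} h a = approx λ x → near-≡ (cong (ι D ⊗_) (sumTo-cong N (λ t _ → cong (cls D x t ⊗_) (h t)))) refl refl (near a x)

approx-≡ : ∀ {N D f μ μ′ ν} → μ ≡ μ′ → Approx N D f μ ν → Approx N D f μ′ ν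
approx-≡ refl a = a

approx-≤ : ∀ {N D f μ ν ν′} → ν ℕ.≤ ν′ → Approx N D f μ ν → Approx N D f μ ν′
approx-≤ {N} {D} h a = approx λ x → near-≼ (⊗-monoˡ (0≼ι D) (ι-mono h)) (near a x)

approx-⊕ : ∀ {N D f g μ μ′ ν ν′} → Approx N D f μ ν → Approx N D g μ′ ν′ →
  Approx N D (λ t → f t ⊕ g t) (μ ⊕ μ′) (ν ℕ.+ ν′)
approx-⊕ {N} {D} {f} {g} {μ} {μ′} {ν} {ν′} a b = approx λ x → near-≡
  (trans (sym (ℚₚ.*-distribˡ-+ (ι D) _ _)) (cong (ι D ⊗_)
    (trans (sym (sumTo-⊕ N (λ t → cls D x t ⊗ f t) (λ t → cls D x t ⊗ g t)))
           (sumTo-cong N (λ t _ → sym (ℚₚ.*-distribˡ-+ (cls D x t) (f t) (g t)))))))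
  (sym (ℚₚ.*-distribʳ-+ (ι N) μ μ′))
  (trans (sym (ℚₚ.*-distribʳ-+ (ι D) (ι ν) (ι ν′))) (cong (_⊗ ι D) (sym (ι-+ ν ν′))))
  (near-⊕ (near a x) (near b x))

approx-⊝ : ∀ {N D f μ ν} → Approx N D f μ ν → Approx N D (λ t → ⊝ f t) (⊝ μ) ν
approx-⊝ {N} {D} {f} {μ} a = approx λ x → near-≡
  (trans (eq (ι D) (sumTo N (λ t → cls D x t ⊗ f t)))
    (cong (ι D ⊗_) (trans (sym (sumTo-⊗ N (⊝ 1ℚ) (λ t → cls D x t ⊗ f t)))
           (sumTo-cong N (λ t _ → eq₂ (cls D x t) (f t))))))
  (ℚₚ.neg-distribˡ-* μ (ι N))
  refl
  (near-⊝ (near a x))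
  where
  eq : ∀ a b → ⊝ (a ⊗ b) ≡ a ⊗ ((⊝ 1ℚ) ⊗ b)
  eq = solve-∀ ℚ-ring
  eq₂ : ∀ a b → (⊝ 1ℚ) ⊗ (a ⊗ b) ≡ a ⊗ (⊝ b)
  eq₂ = solve-∀ ℚ-ring

approx-⊗ : ∀ {N D f μ ν} c → Approx N D f μ ν → Approx N D (λ t → ι c ⊗ f t) (ι c ⊗ μ) (c ℕ.* ν)
approx-⊗ {N} {D} {f} {μ} {ν} c a = approx λ x → near-≡
  (trans (swap (ι c) (ι D) _)
    (cong (ι D ⊗_) (trans (sym (sumTo-⊗ N (ι c) (λ t → cls D x t ⊗ f t)))
           (sumTo-cong N (λ t _ → swap (ι c) (cls D x t) (f t))))))
  (sym (ℚₚ.*-assoc (ι c) μ (ι N)))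
  (trans (sym (ℚₚ.*-assoc (ι c) (ι ν) (ι D))) (cong (_⊗ ι D) (sym (ι-* c ν))))
  (near-⊗ (ι c) (0≼ι c) (near a x))
  where
  swap : ∀ a b c → a ⊗ (b ⊗ c) ≡ b ⊗ (a ⊗ c)
  swap = solve-∀ ℚ-ring

-- A class modulo D and one modulo q form a single class modulo D q. Dividing the estimate for D q
-- by q turns its error ν D q into ν D, so ν is unchanged and only the mean acquires the factor 1 /
-- q.
approx-cls : ∀ {N D q f μ ν} .{{_ : NonZero q}} → Coprime D q → ∀ r →
  Approx N (D ℕ.* q) f μ ν → Approx N D (λ t → cls q r t ⊗ f t) (inv q ⊗ μ) ν
approx-cls {N} {D} {q} {f} {μ} {ν} c r a = approx λ x → let y , h = cls-crt c x r ; S = sumTo N (λ t → cls (D ℕ.* q) y t ⊗ f t) in near-≡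
  (trans (cong (λ z → inv q ⊗ (z ⊗ S)) (ι-* D q)) (trans (eq (inv q) (ι D) (ι q) S)
    (trans (cong (_⊗ (ι D ⊗ S)) (ι⊗inv q)) (trans (ℚₚ.*-identityˡ (ι D ⊗ S))
      (cong (ι D ⊗_) (sumTo-cong N (λ t _ → trans (cong (_⊗ f t) (h t)) (ℚₚ.*-assoc (cls D x t) (cls q r t) (f t)))))))))
  (sym (ℚₚ.*-assoc (inv q) μ (ι N)))
  (trans (cong (λ z → inv q ⊗ (ι ν ⊗ z)) (ι-* D q)) (trans (eq′ (inv q) (ι D) (ι q) (ι ν))
    (trans (cong (_⊗ (ι ν ⊗ ι D)) (ι⊗inv q)) (ℚₚ.*-identityˡ (ι ν ⊗ ι D)))))
  (near-⊗ (inv q) (0≼inv q) (near a y))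
  where
  eq : ∀ i d q s → i ⊗ ((d ⊗ q) ⊗ s) ≡ (q ⊗ i) ⊗ (d ⊗ s)
  eq = solve-∀ ℚ-ring
  eq′ : ∀ i d q s → i ⊗ (s ⊗ (d ⊗ q)) ≡ (q ⊗ i) ⊗ (s ⊗ d)
  eq′ = solve-∀ ℚ-ring

-- Admissible moduli and the events to be sieved

prime-coprime : ∀ {p D} → Prime p → ¬ (p ℕ∣.∣ D) → Coprime D p
prime-coprime pr ¬d (i∣D , i∣p) with prime⇒irreducible pr i∣p
... | inj₁ eq   = eq
... | inj₂ refl = ⊥-elim (¬d i∣D)

prime∣prime : ∀ {p q} → Prime p → Prime q → q ℕ∣.∣ p → q ≡ p
prime∣prime pp pq d with prime⇒irreducible pp d
... | inj₁ refl = ⊥-elim (¬prime[1] pq)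
... | inj₂ eq   = eq

-- The prime 2 may divide D: the class of t modulo 2 or 4 is prescribed through D instead of being
-- sieved.
Allowed : ℕ → ℕ → Set
Allowed z D = NonZero D × (∀ q → Prime q → 3 ℕ.≤ q → q ℕ.≤ z → ¬ (q ℕ∣.∣ D))

allowed-mono : ∀ {x y D} → x ℕ.≤ y → Allowed y D → Allowed x D
allowed-mono le (nz , h) = nz , λ q pq 3≤q q≤x → h q pq 3≤q (ℕₚ.≤-trans q≤x le)

allowed-* : ∀ {z p D} → Prime p → z ℕ.< p → Allowed z D → Allowed z (D ℕ.* p)
allowed-* {z} {p} {D} pp z<p (nz , h) = ℕₚ.m*n≢0 D p {{nz}} {{prime⇒nonZero pp}} , λ q pq 3≤q q≤z d →
  [ h q pq 3≤q q≤z , (λ q∣p → ℕₚ.<⇒≢ (ℕₚ.≤-<-trans q≤z z<p) (prime∣prime pp pq q∣p)) ]′ (euclidsLemma D p pq d)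

-- With f built from odd primes up to z, the quantification over D leaves room for all larger primes
-- to be adjoined to the modulus later.
Good : ℕ → ℕ → (ℕ → ℚ) → ℚ → ℕ → Set
Good N z f μ ν = ∀ D → Allowed z D → Approx N D f μ ν

good-mono : ∀ {N x y f μ ν} → x ℕ.≤ y → Good N x f μ ν → Good N y f μ ν
good-mono le h D a = h D (allowed-mono le a)

-- E N p is the indicator of p ∣ t (N - t); for p ∣ N its two residue classes coincide.
E : ℕ → ℕ → ℕ → ℚ
E N p t = cls p (+ 0) t ⊕ (1ℚ ⊖ ind (p ℕ∣.∣? N)) ⊗ cls p (+ N) t

g : ℕ → ℕ → ℚ
g N p = inv p ⊕ (1ℚ ⊖ ind (p ℕ∣.∣? N)) ⊗ inv p

Es : ℕ → List ℕ → ℕ → List ℚ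
Es N ps t = map (λ p → E N p t) ps

gs : ℕ → List ℕ → List ℚ
gs N ps = map (g N) ps

private
  drop-class : ∀ a b → a ⊕ (1ℚ ⊖ 1ℚ) ⊗ b ≡ a
  drop-class = solve-∀ ℚ-ring
  keep-class : ∀ a b → a ⊕ (1ℚ ⊖ 0ℚ) ⊗ b ≡ a ⊕ b
  keep-class = solve-∀ ℚ-ring

E-yes : ∀ {N p} t → p ℕ∣.∣ N → E N p t ≡ cls p (+ 0) t
E-yes {N} {p} t d = trans (cong (λ z → cls p (+ 0) t ⊕ (1ℚ ⊖ z) ⊗ cls p (+ N) t) (ind-yes (p ℕ∣.∣? N) d)) (drop-class (cls p (+ 0) t) (cls p (+ N) t))

E-no : ∀ {N p} t → ¬ (p ℕ∣.∣ N) → E N p t ≡ cls p (+ 0) t ⊕ cls p (+ N) t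
E-no {N} {p} t d = trans (cong (λ z → cls p (+ 0) t ⊕ (1ℚ ⊖ z) ⊗ cls p (+ N) t) (ind-no (p ℕ∣.∣? N) d)) (keep-class (cls p (+ 0) t) (cls p (+ N) t))

g-yes : ∀ {N p} → p ℕ∣.∣ N → g N p ≡ inv p
g-yes {N} {p} d = trans (cong (λ z → inv p ⊕ (1ℚ ⊖ z) ⊗ inv p) (ind-yes (p ℕ∣.∣? N) d)) (drop-class (inv p) (inv p))

g-no : ∀ {N p} → ¬ (p ℕ∣.∣ N) → g N p ≡ inv p ⊕ inv p
g-no {N} {p} d = trans (cong (λ z → inv p ⊕ (1ℚ ⊖ z) ⊗ inv p) (ind-no (p ℕ∣.∣? N) d)) (keep-class (inv p) (inv p))

g-bounds : ∀ N p → 0ℚ ≼ g N p × g N p ≼ inv p ⊕ inv p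
g-bounds N p = by-cases (p ℕ∣.∣? N)
  where
  by-cases : Dec (p ℕ∣.∣ N) → 0ℚ ≼ g N p × g N p ≼ inv p ⊕ inv p
  by-cases (yes d) = subst (λ z → 0ℚ ≼ z × z ≼ inv p ⊕ inv p) (sym (g-yes d)) (0≼inv p , ≼-diff (0≼inv p) refl)
  by-cases (no ¬d) = subst (λ z → 0ℚ ≼ z × z ≼ inv p ⊕ inv p) (sym (g-no ¬d)) (0≼⊕ (0≼inv p) (0≼inv p) , ℚₚ.≤-refl)

g-unit : ∀ N p → 3 ℕ.≤ p → Unit (g N p)
g-unit N p 3≤p = proj₁ (g-bounds N p) , ℚₚ.≤-trans (proj₂ (g-bounds N p))
  (⊗-cancel (ι p) (0≺ι p {{nz}}) (subst₂ _≼_ eq (sym (ℚₚ.*-identityʳ (ι p))) (ι-mono (ℕₚ.≤-trans (ℕₚ.n≤1+n 2) 3≤p))))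
  where
  nz : NonZero p
  nz = ℕ.>-nonZero (ℕₚ.<-≤-trans (ℕ.s≤s ℕ.z≤n) 3≤p)
  eq : ι 2 ≡ ι p ⊗ (inv p ⊕ inv p)
  eq = trans (ι-+ 1 1) (trans (cong₂ _⊕_ ι-1 ι-1) (sym (trans (ℚₚ.*-distribˡ-+ (ι p) (inv p) (inv p)) (cong₂ _⊕_ (ι⊗inv p {{nz}}) (ι⊗inv p {{nz}})))))

cls-unit : ∀ q x t → Unit (cls q x t)
cls-unit q x t = ind-unit (+ q ∣? (+ t ℤ.- x))

ind-⊕-unit : ∀ {P Q : Set} (d₁ : Dec P) (d₂ : Dec Q) → ¬ (P × Q) → Unit (ind d₁ ⊕ ind d₂)
ind-⊕-unit (yes p) (yes q) ¬pq = ⊥-elim (¬pq (p , q))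
ind-⊕-unit (yes _) (no _)  _   = 0≼1 , ℚₚ.≤-refl
ind-⊕-unit (no _)  (yes _) _   = 0≼1 , ℚₚ.≤-refl
ind-⊕-unit (no _)  (no _)  _   = ℚₚ.≤-refl , 0≼1

E-unit : ∀ N p t → Unit (E N p t)
E-unit N p t = by-cases (p ℕ∣.∣? N)
  where
  eq : ∀ t n → (t ℤ.- + 0) ℤ.- (t ℤ.- n) ≡ n
  eq = ℤS.solve-∀
  by-cases : Dec (p ℕ∣.∣ N) → Unit (E N p t)
  by-cases (yes d) = subst Unit (sym (E-yes t d)) (cls-unit p (+ 0) t)
  by-cases (no ¬d) = subst Unit (sym (E-no t ¬d)) (ind-⊕-unit (+ p ∣? (+ t ℤ.- + 0)) (+ p ∣? (+ t ℤ.- + N))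
    (λ (a , b) → ¬d (∣⇒∣ᵤ (subst (+ p ∣_) (eq (+ t) (+ N)) (∣m∣n⇒∣m-n a b)))))

cls-0 : ∀ {p t} → p ℕ∣.∣ t → cls p (+ 0) t ≡ 1ℚ
cls-0 {p} {t} d = ind-yes (+ p ∣? (+ t ℤ.- + 0)) (subst (+ p ∣_) (sym (ℤₚ.+-identityʳ (+ t))) (∣ᵤ⇒∣ d))

cls-N : ∀ {p t N} → t ℕ.≤ N → p ℕ∣.∣ N ℕ.∸ t → cls p (+ N) t ≡ 1ℚ
cls-N {p} {t} {N} t≤N d = ind-yes (+ p ∣? (+ t ℤ.- + N)) (∣ᵤ⇒∣ (subst (p ℕ∣.∣_) (sym (trans (cong ℤ.∣_∣ (ℤₚ.m-n≡m⊖n t N)) (ℤₚ.∣⊖∣-≤ t≤N))) d))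

E-hit : ∀ {N p t} → t ℕ.≤ N → p ℕ∣.∣ t ⊎ p ℕ∣.∣ N ℕ.∸ t → E N p t ≡ 1ℚ
E-hit {N} {p} {t} t≤N h = ℚₚ.≤-antisym (proj₂ (E-unit N p t)) (by-cases h (p ℕ∣.∣? N))
  where
  by-cases : p ℕ∣.∣ t ⊎ p ℕ∣.∣ N ℕ.∸ t → Dec (p ℕ∣.∣ N) → 1ℚ ≼ E N p t
  by-cases (inj₁ d) (yes e) = ℚₚ.≤-reflexive (sym (trans (E-yes t e) (cls-0 d)))
  by-cases (inj₁ d) (no ¬e) = ≼-diff (proj₁ (cls-unit p (+ N) t)) (trans (E-no t ¬e) (cong (_⊕ cls p (+ N) t) (cls-0 d)))
  by-cases (inj₂ d) (yes e) = ℚₚ.≤-reflexive (sym (trans (E-yes t e) (cls-0 (ℕ∣.∣m+n∣m⇒∣n (subst (p ℕ∣.∣_) (sym (ℕₚ.m∸n+n≡m t≤N)) e) d))))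
  by-cases (inj₂ d) (no ¬e) = ≼-diff (proj₁ (cls-unit p (+ 0) t))
    (trans (E-no t ¬e) (trans (cong (cls p (+ 0) t ⊕_) (cls-N t≤N d)) (ℚₚ.+-comm (cls p (+ 0) t) 1ℚ)))

-- A modulus D allowed at p is prime to p, while D p is still allowed at the lower level x. The two
-- classes of p double the error.
good-E : ∀ {N x p f μ ν} → Prime p → 3 ℕ.≤ p → x ℕ.< p → Good N x f μ ν →
  Good N p (λ t → E N p t ⊗ f t) (g N p ⊗ μ) (ν ℕ.+ ν)
good-E {N} {x} {p} {f} {μ} {ν} pp 3≤p x<p h D a = by-cases (p ℕ∣.∣? N)
  where
  class : ∀ r → Approx N D (λ t → cls p r t ⊗ f t) (inv p ⊗ μ) ν
  class r = approx-cls {{prime⇒nonZero pp}} (prime-coprime pp (proj₂ a p pp 3≤p ℕₚ.≤-refl)) r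
    (h (D ℕ.* p) (allowed-* pp x<p (allowed-mono (ℕₚ.<⇒≤ x<p) a)))
  by-cases : Dec (p ℕ∣.∣ N) → Approx N D (λ t → E N p t ⊗ f t) (g N p ⊗ μ) (ν ℕ.+ ν)
  by-cases (yes d) = approx-≤ (ℕₚ.m≤m+n ν ν)
    (approx-ext (λ t → cong (_⊗ f t) (sym (E-yes t d))) (approx-≡ (cong (_⊗ μ) (sym (g-yes d))) (class (+ 0))))
  by-cases (no ¬d) = approx-ext
    (λ t → trans (sym (ℚₚ.*-distribʳ-+ (f t) (cls p (+ 0) t) (cls p (+ N) t))) (cong (_⊗ f t) (sym (E-no t ¬d))))
    (approx-≡ (trans (sym (ℚₚ.*-distribʳ-+ μ (inv p) (inv p))) (cong (_⊗ μ) (sym (g-no ¬d))))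
      (approx-⊕ (class (+ 0)) (class (+ N))))

-- Chain z y ps: the list ps is decreasing and consists of odd primes in (z , y].
data Chain (z : ℕ) : ℕ → List ℕ → Set where
  done : ∀ {y} → z ℕ.≤ y → Chain z y []
  cons : ∀ {p x y ps} → Prime p → 3 ℕ.≤ p → x ℕ.< p → p ℕ.≤ y → Chain z x ps → Chain z y (p ∷ ps)

good-⊕ : ∀ {N z f h μ μ′ ν ν′} → Good N z f μ ν → Good N z h μ′ ν′ → Good N z (λ t → f t ⊕ h t) (μ ⊕ μ′) (ν ℕ.+ ν′)
good-⊕ a b D d = approx-⊕ (a D d) (b D d)

good-⊖ : ∀ {N z f h μ μ′ ν ν′} → Good N z f μ ν → Good N z h μ′ ν′ → Good N z (λ t → f t ⊖ h t) (μ ⊖ μ′) (ν ℕ.+ ν′)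
good-⊖ {h = h} a b D d = approx-⊕ (a D d) (approx-⊝ {f = h} (b D d))

good-ext : ∀ {N z f h μ μ′ ν ν′} → (∀ t → f t ≡ h t) → μ ≡ μ′ → ν ℕ.≤ ν′ → Good N z f μ ν → Good N z h μ′ ν′
good-ext eq refl le a D d = approx-ext eq (approx-≤ le (a D d))

chain-≤ : ∀ {z y ps} → Chain z y ps → z ℕ.≤ y
chain-≤ (done le)          = le
chain-≤ (cons _ _ x<p p≤y c) = ℕₚ.≤-trans (chain-≤ c) (ℕₚ.≤-trans (ℕₚ.<⇒≤ x<p) p≤y)

gs-unit : ∀ {N z y ps} → Chain z y ps → All Unit (gs N ps)
gs-unit (done _)             = []
gs-unit (cons _ 3≤p _ _ c) = g-unit _ _ 3≤p ∷ gs-unit c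

Es-unit : ∀ N ps t → All Unit (Es N ps t)
Es-unit N []       t = []
Es-unit N (p ∷ ps) t = E-unit N p t ∷ Es-unit N ps t

private
  expand-⊖ : ∀ a b c f → a ⊗ f ⊖ c ⊗ (b ⊗ f) ≡ (a ⊖ c ⊗ b) ⊗ f
  expand-⊖ = solve-∀ ℚ-ring

  expand-⊕ : ∀ a b c f → a ⊗ f ⊕ c ⊗ (b ⊗ f) ≡ (a ⊕ c ⊗ b) ⊗ f
  expand-⊕ = solve-∀ ℚ-ring

  1⊗ : ∀ f → f ≡ 1ℚ ⊗ f
  1⊗ f = sym (ℚₚ.*-identityˡ f)

-- Each of the r factors of a term of `T r` or `e r` over l primes is 1 or one of 2 l residue
-- classes, whence the bound (1 + 2 l) ^ r for the number of terms; this is its recursion.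
norm-step : ∀ l r ν → (1 ℕ.+ 2 ℕ.* l) ℕ.^ suc r ℕ.* ν ℕ.+ ((1 ℕ.+ 2 ℕ.* l) ℕ.^ r ℕ.* ν ℕ.+ (1 ℕ.+ 2 ℕ.* l) ℕ.^ r ℕ.* ν)
  ℕ.≤ (1 ℕ.+ 2 ℕ.* suc l) ℕ.^ suc r ℕ.* ν
norm-step l r ν = begin
  n ℕ.^ suc r ℕ.* ν ℕ.+ (n ℕ.^ r ℕ.* ν ℕ.+ n ℕ.^ r ℕ.* ν)   ≡⟨ eq l (n ℕ.^ r) ν ⟩
  n′ ℕ.* n ℕ.^ r ℕ.* ν                        ≤⟨ ℕₚ.*-monoˡ-≤ ν (ℕₚ.*-monoʳ-≤ n′ (ℕₚ.^-monoˡ-≤ r (ℕₚ.+-monoʳ-≤ 1 (ℕₚ.*-monoʳ-≤ 2 (ℕₚ.n≤1+n l))))) ⟩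
  n′ ℕ.^ suc r ℕ.* ν                        ∎
  where
  open ℕₚ.≤-Reasoning
  n = 1 ℕ.+ 2 ℕ.* l
  n′ = 1 ℕ.+ 2 ℕ.* suc l
  eq : ∀ l m v → (1 ℕ.+ 2 ℕ.* l) ℕ.* m ℕ.* v ℕ.+ (m ℕ.* v ℕ.+ m ℕ.* v) ≡ (1 ℕ.+ 2 ℕ.* suc l) ℕ.* m ℕ.* v
  eq = ℕS.solve-∀

norm-one : ∀ l r ν → ν ℕ.≤ (1 ℕ.+ 2 ℕ.* l) ℕ.^ r ℕ.* ν
norm-one l r ν = subst (ℕ._≤ (1 ℕ.+ 2 ℕ.* l) ℕ.^ r ℕ.* ν) (ℕₚ.*-identityˡ ν) (ℕₚ.*-monoˡ-≤ ν (ℕₚ.m^n>0 (1 ℕ.+ 2 ℕ.* l) r))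

good-T : ∀ {N z y ps f μ ν} r → Chain z y ps → Good N z f μ ν →
  Good N y (λ t → T r (Es N ps t) ⊗ f t) (T r (gs N ps) ⊗ μ) ((1 ℕ.+ 2 ℕ.* length ps) ℕ.^ r ℕ.* ν)
good-T {ps = ps} {f} {μ} {ν} zero c h = good-mono (chain-≤ c) (good-ext (λ t → 1⊗ (f t)) (1⊗ μ) (norm-one (length ps) 0 ν) h)
good-T {f = f} {μ} {ν} (suc r) (done le) h = good-mono le (good-ext (λ t → 1⊗ (f t)) (1⊗ μ) (norm-one 0 (suc r) ν) h)
good-T {N} {f = f} {μ} {ν} (suc r) (cons {p} {x} {y} {ps} pp 3≤p x<p p≤y c) h =
  good-mono p≤y (good-ext
    (λ t → expand-⊖ (T (suc r) (Es N ps t)) (T r (Es N ps t)) (E N p t) (f t))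
    (expand-⊖ (T (suc r) (gs N ps)) (T r (gs N ps)) (g N p) μ)
    (norm-step (length ps) r ν)
    (good-⊖ (good-mono (ℕₚ.<⇒≤ x<p) (good-T (suc r) c h))
            (good-E {f = λ t → T r (Es N ps t) ⊗ f t} pp 3≤p x<p (good-T r c h))))

good-e : ∀ {N z y ps f μ ν} r → Chain z y ps → Good N z f μ ν →
  Good N y (λ t → e r (Es N ps t) ⊗ f t) (e r (gs N ps) ⊗ μ) ((1 ℕ.+ 2 ℕ.* length ps) ℕ.^ r ℕ.* ν)
good-e {ps = ps} {f} {μ} {ν} zero c h = good-mono (chain-≤ c) (good-ext (λ t → 1⊗ (f t)) (1⊗ μ) (norm-one (length ps) 0 ν) h)
good-e {N} {f = f} {μ} {ν} (suc r) (done le) h = good-mono le (good-ext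
  (λ t → cong (_⊗ f t) ι-0) (cong (_⊗ μ) ι-0) ℕ.z≤n (λ D a → approx-⊗ {f = f} 0 (h D a)))
good-e {N} {f = f} {μ} {ν} (suc r) (cons {p} {x} {y} {ps} pp 3≤p x<p p≤y c) h =
  good-mono p≤y (good-ext
    (λ t → expand-⊕ (e (suc r) (Es N ps t)) (e r (Es N ps t)) (E N p t) (f t))
    (expand-⊕ (e (suc r) (gs N ps)) (e r (gs N ps)) (g N p) μ)
    (norm-step (length ps) r ν)
    (good-⊕ (good-mono (ℕₚ.<⇒≤ x<p) (good-e (suc r) c h))
            (good-E {f = λ t → e r (Es N ps t) ⊗ f t} pp 3≤p x<p (good-e r c h))))

good-V : ∀ {N z y ps f μ ν} → Chain z y ps → Good N z f μ ν →
  Good N y (λ t → V (Es N ps t) ⊗ f t) (V (gs N ps) ⊗ μ) (3 ℕ.^ length ps ℕ.* ν)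
good-V {f = f} {μ} {ν} (done le) h = good-mono le (good-ext (λ t → 1⊗ (f t)) (1⊗ μ) (ℕₚ.≤-reflexive (sym (ℕₚ.*-identityˡ ν))) h)
good-V {N} {f = f} {μ} {ν} (cons {p} {x} {y} {ps} pp 3≤p x<p p≤y c) h =
  good-mono p≤y (good-ext
    (λ t → expand-⊖ (V (Es N ps t)) (V (Es N ps t)) (E N p t) (f t))
    (expand-⊖ (V (gs N ps)) (V (gs N ps)) (g N p) μ)
    (ℕₚ.≤-reflexive (eq (3 ℕ.^ length ps) ν))
    (good-⊖ (good-mono (ℕₚ.<⇒≤ x<p) (good-V c h))
            (good-E {f = λ t → V (Es N ps t) ⊗ f t} pp 3≤p x<p (good-V c h))))
  where
  eq : ∀ m v → m ℕ.* v ℕ.+ (m ℕ.* v ℕ.+ m ℕ.* v) ≡ 3 ℕ.* m ℕ.* v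
  eq = ℕS.solve-∀

-- Chebyshev bounds on dyadic intervals

-- Only the boolean of the decision is matched, so that evaluating `primesIn` on literals does not
-- force any primality proof.
consIf : ∀ {p} → Dec (Prime p) → List ℕ → List ℕ
consIf {p} (true because _)  ps = p ∷ ps
consIf     (false because _) ps = ps

primesIn : ℕ → ℕ → List ℕ
primesIn x zero    = []
primesIn x (suc d) = consIf (prime? (x + suc d)) (primesIn x d)

chain-mono : ∀ {z y y′ ps} → y ≤ y′ → Chain z y ps → Chain z y′ ps
chain-mono le (done z≤y)          = done (ℕₚ.≤-trans z≤y le)
chain-mono le (cons pp 3≤p lt p≤y c) = cons pp 3≤p lt (ℕₚ.≤-trans p≤y le) c

chain-++ : ∀ {x y z ps qs} → Chain x y ps → Chain y z qs → Chain x z (qs ++ ps)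
chain-++ c (done y≤z)            = chain-mono y≤z c
chain-++ c (cons pp 3≤p lt p≤z d) = cons pp 3≤p lt p≤z (chain-++ c d)

chain-primesIn : ∀ x d → 2 ≤ x → Chain x (x + d) (primesIn x d)
chain-primesIn x zero    2≤x = done (ℕₚ.≤-reflexive (sym (ℕₚ.+-identityʳ x)))
chain-primesIn x (suc d) 2≤x = add (prime? (x + suc d))
  where
  le : x + d < x + suc d
  le = ℕₚ.≤-reflexive (sym (ℕₚ.+-suc x d))
  add : (pr : Dec (Prime (x + suc d))) → Chain x (x + suc d) (consIf pr (primesIn x d))
  add (yes pp) = cons pp (ℕₚ.≤-trans (ℕ.s≤s (ℕₚ.≤-trans 2≤x (ℕₚ.m≤m+n x d))) le) le ℕₚ.≤-refl (chain-primesIn x d 2≤x)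
  add (no _)   = chain-mono (ℕₚ.<⇒≤ le) (chain-primesIn x d 2≤x)

∈-primesIn : ∀ x d {q} → Prime q → x < q → q ≤ x + d → q ∈ primesIn x d
∈-primesIn x zero    pq x<q q≤ = ⊥-elim (ℕₚ.<⇒≱ x<q (ℕₚ.≤-trans q≤ (ℕₚ.≤-reflexive (ℕₚ.+-identityʳ x))))
∈-primesIn x (suc d) {q} pq x<q q≤ = find (prime? (x + suc d)) (ℕₚ.m≤n⇒m<n∨m≡n q≤)
  where
  find : (pr : Dec (Prime (x + suc d))) → q < x + suc d ⊎ q ≡ x + suc d → q ∈ consIf pr (primesIn x d)
  rest : q < x + suc d → q ∈ primesIn x d
  rest lt = ∈-primesIn x d pq x<q (ℕₚ.≤-pred (ℕₚ.≤-trans lt (ℕₚ.≤-reflexive (ℕₚ.+-suc x d))))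
  find (yes _)  (inj₁ lt)   = there (rest lt)
  find (no _)   (inj₁ lt)   = rest lt
  find (yes _)  (inj₂ refl) = here refl
  find (no ¬pr) (inj₂ refl) = ⊥-elim (¬pr pq)

chain-prime : ∀ {z y ps} → Chain z y ps → All Prime ps
chain-prime (done _)          = []
chain-prime (cons pp _ _ _ c) = pp ∷ chain-prime c

chain-> : ∀ {z y ps} → Chain z y ps → All (z <_) ps
chain-> (done _)              = []
chain-> (cons pp _ x<p _ c) = ℕₚ.≤-<-trans (chain-≤ c) x<p ∷ chain-> c

chain-≤y : ∀ {z y ps} → Chain z y ps → All (_≤ y) ps
chain-≤y (done _)               = []
chain-≤y (cons pp _ x<p p≤y c) = p≤y ∷ All.map (λ q≤x → ℕₚ.≤-trans q≤x (ℕₚ.≤-trans (ℕₚ.<⇒≤ x<p) p≤y)) (chain-≤y c)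

-- The chain is decreasing, so its head does not divide the product of the smaller primes and is
-- coprime to it.
chain-product-∣ : ∀ {z y ps M} → Chain z y ps → (∀ p → Prime p → z < p → p ≤ y → p ℕ∣.∣ M) → product ps ℕ∣.∣ M
chain-product-∣ (done _) h = ℕ∣.1∣ _
chain-product-∣ {z} {y} {p ∷ ps} {M} (cons pp _ x<p p≤y c) h =
  subst (ℕ∣._∣ M) (ℕₚ.*-comm (product ps) p)
    (coprime-*-∣ (prime-coprime pp λ p∣ → ℕₚ.<⇒≱ x<p (All.lookup (chain-≤y c) (factorisationHasAllPrimeFactors pp p∣ (chain-prime c))))
      (chain-product-∣ c (λ q pq z<q q≤x → h q pq z<q (ℕₚ.≤-trans q≤x (ℕₚ.≤-trans (ℕₚ.<⇒≤ x<p) p≤y))))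
      (h p pp (ℕₚ.≤-<-trans (chain-≤ c) x<p) p≤y))

^-length≤product : ∀ {z ps} → All (z <_) ps → z ℕ.^ length ps ≤ product ps
^-length≤product []         = ℕₚ.≤-refl
^-length≤product (z<p ∷ as) = ℕₚ.*-mono-≤ (ℕₚ.<⇒≤ z<p) (^-length≤product as)

C≤2^ : ∀ n k → n C k ≤ 2 ℕ.^ n
C≤2^ n       zero    = ℕₚ.≤-trans (ℕₚ.≤-reflexive (trans (nCk≡nC[n∸k] {0} {n} ℕ.z≤n) (nCn≡1 n))) (ℕₚ.m^n>0 2 n)
C≤2^ zero    (suc k) = ℕ.z≤n
C≤2^ (suc n) (suc k) = begin
  suc n C suc k        ≡⟨ nCk+nC[k+1]≡[n+1]C[k+1] n k ⟨
  n C k + n C suc k    ≤⟨ ℕₚ.+-mono-≤ (C≤2^ n k) (C≤2^ n (suc k)) ⟩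
  2 ℕ.^ n + 2 ℕ.^ n        ≡⟨ cong (λ z → 2 ℕ.^ n + z) (sym (ℕₚ.+-identityʳ (2 ℕ.^ n))) ⟩
  2 ℕ.^ suc n            ∎
  where open ℕₚ.≤-Reasoning

prime∣!⇒≤ : ∀ {p} n → Prime p → p ℕ∣.∣ n ! → p ≤ n
prime∣!⇒≤ zero    pp d = ⊥-elim (¬prime[1] (subst Prime (ℕ∣.∣1⇒≡1 d) pp))
prime∣!⇒≤ (suc n) pp d = [ ℕ∣.∣⇒≤ , (λ d′ → ℕₚ.m≤n⇒m≤1+n (prime∣!⇒≤ n pp d′)) ]′ (euclidsLemma (suc n) (n !) pp d)

m∣n! : ∀ {m n} .{{_ : NonZero m}} → m ≤ n → m ℕ∣.∣ n !
m∣n! {suc m} le = ℕ∣.∣-trans (ℕ∣.m∣m*n (m !)) (ℕ∣.m≤n⇒m!∣n! le)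

-- Such a p divides (2n)! but, being larger than n, divides neither factor n! of the denominator.
prime∣centralBinomial : ∀ n p → Prime p → n < p → p ≤ n + n → p ℕ∣.∣ (n + n) C n
prime∣centralBinomial n p pp n<p p≤2n =
  [ (λ d → d) , (λ d → ⊥-elim ([ small , small ]′ (euclidsLemma (n !) (n !) pp d))) ]′
    (euclidsLemma ((n + n) C n) (n ! * n !) pp (subst (p ℕ∣.∣_) eq (m∣n! {{prime⇒nonZero pp}} p≤2n)))
  where
  small : ∀ {A : Set} → p ℕ∣.∣ n ! → A
  small d = ⊥-elim (ℕₚ.<⇒≱ n<p (prime∣!⇒≤ n pp d))
  eq : (n + n) ! ≡ ((n + n) C n) * (n ! * n !)
  eq = begin
    (n + n) !                                       ≡⟨ DM.m/n*n≡m {{n ℕₚ.!* (n + n ℕ.∸ n) !≢0}} (k![n∸k]!∣n! (ℕₚ.m≤m+n n n)) ⟨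
    ((n + n) ! DM./ (n ! * (n + n ℕ.∸ n) !)) {{n ℕₚ.!* (n + n ℕ.∸ n) !≢0}} * (n ! * (n + n ℕ.∸ n) !)
      ≡⟨ cong (_* (n ! * (n + n ℕ.∸ n) !)) (sym (nCk≡n!/k![n-k]! (ℕₚ.m≤m+n n n))) ⟩
    ((n + n) C n) * (n ! * (n + n ℕ.∸ n) !)             ≡⟨ cong (λ j → ((n + n) C n) * (n ! * j !)) (ℕₚ.m+n∸n≡m n n) ⟩
    ((n + n) C n) * (n ! * n !)                       ∎
    where open ≡-Reasoning

-- Chebyshev's argument: the primes of (n , 2n] divide the central binomial coefficient.
chebyshev : ∀ n {ps} .{{_ : NonZero n}} → Chain n (n + n) ps → n ℕ.^ length ps ≤ 2 ℕ.^ (n + n)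
chebyshev n {ps} c = ℕₚ.≤-trans (^-length≤product (chain-> c))
  (ℕₚ.≤-trans (ℕ∣.∣⇒≤ {{nz}} (chain-product-∣ c (prime∣centralBinomial n))) (C≤2^ (n + n) n))
  where
  nz : NonZero ((n + n) C n)
  nz = ℕ.≢-nonZero λ eq → 0≢ (trans (sym (DM.m/n*n≡m {{n ℕₚ.!* (n + n ℕ.∸ n) !≢0}} (k![n∸k]!∣n! (ℕₚ.m≤m+n n n))))
         (cong (_* (n ! * (n + n ℕ.∸ n) !)) (trans (sym (nCk≡n!/k![n-k]! (ℕₚ.m≤m+n n n))) eq)))
    where
    0≢ : ¬ ((n + n) ! ≡ 0)
    0≢ = ℕ.≢-nonZero⁻¹ ((n + n) !) {{(n + n) ℕₚ.!≢0}}

block : ℕ → List ℕ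
block i = primesIn (2 ℕ.^ i) (2 ℕ.^ i)

2^-double : ∀ i → 2 ℕ.^ i + 2 ℕ.^ i ≡ 2 ℕ.^ suc i
2^-double i = cong (λ z → 2 ℕ.^ i + z) (sym (ℕₚ.+-identityʳ (2 ℕ.^ i)))

2≤2^ : ∀ i → 1 ≤ i → 2 ≤ 2 ℕ.^ i
2≤2^ i 1≤i = ℕₚ.^-monoʳ-≤ 2 1≤i

chain-block : ∀ i → 1 ≤ i → Chain (2 ℕ.^ i) (2 ℕ.^ suc i) (block i)
chain-block i 1≤i = subst (λ y → Chain (2 ℕ.^ i) y (block i)) (2^-double i) (chain-primesIn (2 ℕ.^ i) (2 ℕ.^ i) (2≤2^ i 1≤i))

^-cancel-≤ : ∀ m n → 2 ℕ.^ m ≤ 2 ℕ.^ n → m ≤ n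
^-cancel-≤ m n le = ℕₚ.≮⇒≥ λ n<m → ℕₚ.<⇒≱ (ℕₚ.^-monoʳ-< 2 (ℕ.s≤s (ℕ.s≤s ℕ.z≤n)) n<m) le

length-block : ∀ i → 1 ≤ i → i * length (block i) ≤ 2 ℕ.^ suc i
length-block i 1≤i = ^-cancel-≤ (i * length (block i)) (2 ℕ.^ suc i) (begin
  2 ℕ.^ (i * length (block i))   ≡⟨ ℕₚ.^-*-assoc 2 i (length (block i)) ⟨
  (2 ℕ.^ i) ℕ.^ length (block i)   ≤⟨ chebyshev (2 ℕ.^ i) {{ℕₚ.m^n≢0 2 i}} (chain-primesIn (2 ℕ.^ i) (2 ℕ.^ i) (2≤2^ i 1≤i)) ⟩
  2 ℕ.^ (2 ℕ.^ i + 2 ℕ.^ i)          ≡⟨ cong (2 ℕ.^_) (2^-double i) ⟩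
  2 ℕ.^ (2 ℕ.^ suc i)              ∎)
  where open ℕₚ.≤-Reasoning

-- The primes of (2 ^ k , 2 ^ (k + d)].
dyadic : ℕ → ℕ → List ℕ
dyadic k zero    = []
dyadic k (suc d) = block (k + d) ++ dyadic k d

chain-dyadic : ∀ k d → 1 ≤ k → Chain (2 ℕ.^ k) (2 ℕ.^ (k + d)) (dyadic k d)
chain-dyadic k zero    1≤k = done (ℕₚ.≤-reflexive (cong (2 ℕ.^_) (sym (ℕₚ.+-identityʳ k))))
chain-dyadic k (suc d) 1≤k = subst (λ j → Chain (2 ℕ.^ k) (2 ℕ.^ j) (dyadic k (suc d))) (sym (ℕₚ.+-suc k d))
  (chain-++ (chain-dyadic k d 1≤k) (chain-block (k + d) (ℕₚ.≤-trans 1≤k (ℕₚ.m≤m+n k d))))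

∈-dyadic : ∀ k d {q} → Prime q → 2 ℕ.^ k < q → q ≤ 2 ℕ.^ (k + d) → q ∈ dyadic k d
∈-dyadic k zero    pq lt le = ⊥-elim (ℕₚ.<⇒≱ lt (ℕₚ.≤-trans le (ℕₚ.≤-reflexive (cong (2 ℕ.^_) (ℕₚ.+-identityʳ k)))))
∈-dyadic k (suc d) {q} pq lt le = [ low , high ]′ (ℕₚ.≤-<-connex q (2 ℕ.^ (k + d)))
  where
  low : q ≤ 2 ℕ.^ (k + d) → q ∈ dyadic k (suc d)
  low le′ = ∈-++⁺ʳ (block (k + d)) (∈-dyadic k d pq lt le′)
  high : 2 ℕ.^ (k + d) < q → q ∈ dyadic k (suc d)
  high lt′ = ∈-++⁺ˡ (∈-primesIn (2 ℕ.^ (k + d)) (2 ℕ.^ (k + d)) pq lt′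
    (ℕₚ.≤-trans le (ℕₚ.≤-reflexive (trans (cong (2 ℕ.^_) (ℕₚ.+-suc k d)) (sym (2^-double (k + d)))))))

-- For i ≥ 4 the block at 2 ^ i has at most 2 ^ (i + 1) / i ≤ 2 ^ (i - 1) primes. The summand 2 ^ k
-- makes the induction telescope.
length-dyadic : ∀ k d → 4 ≤ k → 2 * length (dyadic k d) + 2 ℕ.^ k ≤ 2 ℕ.^ (k + d)
length-dyadic k zero    4≤k = ℕₚ.≤-reflexive (cong (2 ℕ.^_) (sym (ℕₚ.+-identityʳ k)))
length-dyadic k (suc d) 4≤k = begin
  2 * length (block (k + d) ++ dyadic k d) + 2 ℕ.^ k         ≡⟨ cong (λ l → 2 * l + 2 ℕ.^ k) (length-++ (block (k + d))) ⟩
  2 * (length (block (k + d)) + length (dyadic k d)) + 2 ℕ.^ k ≡⟨ eq (length (block (k + d))) (length (dyadic k d)) (2 ℕ.^ k) ⟩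
  2 * length (block (k + d)) + (2 * length (dyadic k d) + 2 ℕ.^ k) ≤⟨ ℕₚ.+-mono-≤ bl (length-dyadic k d 4≤k) ⟩
  2 ℕ.^ (k + d) + 2 ℕ.^ (k + d)                                ≡⟨ 2^-double (k + d) ⟩
  2 ℕ.^ suc (k + d)                                          ≡⟨ cong (2 ℕ.^_) (ℕₚ.+-suc k d) ⟨
  2 ℕ.^ (k + suc d)                                          ∎
  where
  open ℕₚ.≤-Reasoning
  eq : ∀ a b c → 2 * (a + b) + c ≡ 2 * a + (2 * b + c)
  eq = ℕS.solve-∀
  bl : 2 * length (block (k + d)) ≤ 2 ℕ.^ (k + d)
  bl = ℕₚ.*-cancelˡ-≤ 2 (begin
    2 * (2 * length (block (k + d)))   ≡⟨ ℕₚ.*-assoc 2 2 (length (block (k + d))) ⟨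
    4 * length (block (k + d))         ≤⟨ ℕₚ.*-monoˡ-≤ (length (block (k + d))) (ℕₚ.≤-trans 4≤k (ℕₚ.m≤m+n k d)) ⟩
    (k + d) * length (block (k + d))   ≤⟨ length-block (k + d) (ℕₚ.≤-trans (ℕ.s≤s ℕ.z≤n) (ℕₚ.≤-trans 4≤k (ℕₚ.m≤m+n k d))) ⟩
    2 ℕ.^ suc (k + d)                    ∎)

-- Sums and products over dyadic intervals

ι-2 : ∀ a → ι 2 ⊗ a ≡ a ⊕ a
ι-2 a = trans (cong (_⊗ a) (trans (ι-+ 1 1) (cong₂ _⊕_ ι-1 ι-1))) (eq a)
  where
  eq : ∀ a → (1ℚ ⊕ 1ℚ) ⊗ a ≡ a ⊕ a
  eq = solve-∀ ℚ-ring

ι-cancel : ∀ n .{{_ : NonZero n}} a → ι n ⊗ (inv n ⊗ a) ≡ a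
ι-cancel n a = trans (sym (ℚₚ.*-assoc (ι n) (inv n) a)) (trans (cong (_⊗ a) (ι⊗inv n)) (ℚₚ.*-identityˡ a))

inv-* : ∀ m n .{{_ : NonZero m}} .{{_ : NonZero n}} → inv (m ℕ.* n) ≡ inv m ⊗ inv n
inv-* m n = begin
  inv (m ℕ.* n)                                                       ≡⟨ ι-cancel m (inv (m ℕ.* n)) ⟨
  ι m ⊗ (inv m ⊗ inv (m ℕ.* n))                                       ≡⟨ ι-cancel n (ι m ⊗ (inv m ⊗ inv (m ℕ.* n))) ⟨
  ι n ⊗ (inv n ⊗ (ι m ⊗ (inv m ⊗ inv (m ℕ.* n))))                     ≡⟨ eq (ι n) (inv n) (ι m) (inv m) (inv (m ℕ.* n)) ⟩
  ((ι m ⊗ ι n) ⊗ inv (m ℕ.* n)) ⊗ (inv m ⊗ inv n)                     ≡⟨ cong (λ z → (z ⊗ inv (m ℕ.* n)) ⊗ (inv m ⊗ inv n)) (ι-* m n) ⟨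
  (ι (m ℕ.* n) ⊗ inv (m ℕ.* n)) ⊗ (inv m ⊗ inv n)                     ≡⟨ cong (_⊗ (inv m ⊗ inv n)) (ι⊗inv (m ℕ.* n) {{ℕₚ.m*n≢0 m n}}) ⟩
  1ℚ ⊗ (inv m ⊗ inv n)                                                ≡⟨ ℚₚ.*-identityˡ (inv m ⊗ inv n) ⟩
  inv m ⊗ inv n                                                       ∎
  where
  open ≡-Reasoning
  eq : ∀ n n′ m m′ x → n ⊗ (n′ ⊗ (m ⊗ (m′ ⊗ x))) ≡ ((m ⊗ n) ⊗ x) ⊗ (m′ ⊗ n′)
  eq = solve-∀ ℚ-ring

sumOver : (ℕ → ℚ) → List ℕ → ℚ
sumOver h ps = sumℚ (map h ps)

sumOver-++ : ∀ h ps qs → sumOver h (ps ++ qs) ≡ sumOver h ps ⊕ sumOver h qs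
sumOver-++ h ps qs = trans (cong sumℚ (map-++ h ps qs)) (sumℚ-++ (map h ps) (map h qs))

sumOver-const : ∀ {h c ps} → All (λ p → h p ≼ c) ps → sumOver h ps ≼ ι (length ps) ⊗ c
sumOver-const {c = c} [] = ℚₚ.≤-reflexive (sym (trans (cong (_⊗ c) ι-0) (ℚₚ.*-zeroˡ c)))
sumOver-const {h} {c} {p ∷ ps} (le ∷ as) = ℚₚ.≤-trans (ℚₚ.+-mono-≤ le (sumOver-const as))
  (ℚₚ.≤-reflexive (trans (eq (ι (length ps)) c) (cong (_⊗ c) (sym (ι-suc (length ps))))))
  where
  eq : ∀ n c → c ⊕ n ⊗ c ≡ (1ℚ ⊕ n) ⊗ c
  eq = solve-∀ ℚ-ring

sum-gs≼ : ∀ N ps → sumℚ (gs N ps) ≼ sumOver (λ p → inv p ⊕ inv p) ps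
sum-gs≼ N []       = ℚₚ.≤-refl
sum-gs≼ N (p ∷ ps) = ℚₚ.+-mono-≤ (proj₂ (g-bounds N p)) (sum-gs≼ N ps)

private
  block-const : ∀ i .{{_ : NonZero i}} → ι (length (block i)) ⊗ (inv (2 ℕ.^ i) ⊕ inv (2 ℕ.^ i)) ≼ ι 4 ⊗ inv i
  block-const i = ⊗-cancel (ι i) (0≺ι i) (⊗-cancel (ι (2 ℕ.^ i)) (0≺ι (2 ℕ.^ i) {{ℕₚ.m^n≢0 2 i}}) (subst₂ _≼_ eqL eqR (ι-mono nat)))
    where
    l = length (block i)
    1≤i : 1 ℕ.≤ i
    1≤i = ℕ.>-nonZero⁻¹ i
    nat : i ℕ.* l ℕ.* 2 ℕ.≤ 4 ℕ.* 2 ℕ.^ i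
    nat = ℕₚ.≤-trans (ℕₚ.*-monoˡ-≤ 2 (length-block i 1≤i)) (ℕₚ.≤-reflexive (ℕeq (2 ℕ.^ i)))
      where
      ℕeq : ∀ a → 2 ℕ.* a ℕ.* 2 ≡ 4 ℕ.* a
      ℕeq = ℕS.solve-∀
    A = ι (2 ℕ.^ i)
    A′ = inv (2 ℕ.^ i)
    eqL : ι (i ℕ.* l ℕ.* 2) ≡ A ⊗ (ι i ⊗ (ι l ⊗ (A′ ⊕ A′)))
    eqL = trans (trans (ι-* (i ℕ.* l) 2) (cong (_⊗ ι 2) (ι-* i l)))
      (trans (sym (ι-cancel (2 ℕ.^ i) {{ℕₚ.m^n≢0 2 i}} ((ι i ⊗ ι l) ⊗ ι 2)))
        (trans (eq A A′ (ι i) (ι l) (ι 2)) (cong (λ z → A ⊗ (ι i ⊗ (ι l ⊗ z))) (ι-2 A′))))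
      where
      eq : ∀ a b i l t → a ⊗ (b ⊗ ((i ⊗ l) ⊗ t)) ≡ a ⊗ (i ⊗ (l ⊗ (t ⊗ b)))
      eq = solve-∀ ℚ-ring
    eqR : ι (4 ℕ.* 2 ℕ.^ i) ≡ A ⊗ (ι i ⊗ (ι 4 ⊗ inv i))
    eqR = trans (ι-* 4 (2 ℕ.^ i)) (trans (sym (ι-cancel i (ι 4 ⊗ A))) (eq A (ι i) (inv i) (ι 4)))
      where
      eq : ∀ a i i′ f → i ⊗ (i′ ⊗ (f ⊗ a)) ≡ a ⊗ (i ⊗ (f ⊗ i′))
      eq = solve-∀ ℚ-ring

sum-block : ∀ i .{{_ : NonZero i}} → sumOver (λ p → inv p ⊕ inv p) (block i) ≼ ι 4 ⊗ inv i
sum-block i = ℚₚ.≤-trans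
  (sumOver-const (All.map (λ lt → let le = inv-anti {{ℕₚ.m^n≢0 2 i}} (ℕₚ.<⇒≤ lt) in ℚₚ.+-mono-≤ le le)
    (chain-> (chain-block i (ℕ.>-nonZero⁻¹ i)))))
  (block-const i)

-- 4 / i bounds the sum of 2 / p over the primes of (2 ^ i , 2 ^ (i + 1)].
H : ℕ → ℕ → ℚ
H k zero    = 0ℚ
H k (suc d) = ι 4 ⊗ inv (k ℕ.+ d) ⊕ H k d

0≼H : ∀ k d → 0ℚ ≼ H k d
0≼H k zero    = ℚₚ.≤-refl
0≼H k (suc d) = 0≼⊕ (0≼⊗ (0≼ι 4) (0≼inv (k ℕ.+ d))) (0≼H k d)

H-+ : ∀ k d d′ → H k (d ℕ.+ d′) ≡ H k d ⊕ H (k ℕ.+ d) d′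
H-+ k d zero     = trans (cong (H k) (ℕₚ.+-identityʳ d)) (sym (ℚₚ.+-identityʳ (H k d)))
H-+ k d (suc d′) = begin
  H k (d ℕ.+ suc d′)                                         ≡⟨ cong (H k) (ℕₚ.+-suc d d′) ⟩
  ι 4 ⊗ inv (k ℕ.+ (d ℕ.+ d′)) ⊕ H k (d ℕ.+ d′)              ≡⟨ cong₂ (λ x y → ι 4 ⊗ inv x ⊕ y) (sym (ℕₚ.+-assoc k d d′)) (H-+ k d d′) ⟩
  ι 4 ⊗ inv (k ℕ.+ d ℕ.+ d′) ⊕ (H k d ⊕ H (k ℕ.+ d) d′)      ≡⟨ eq (ι 4 ⊗ inv (k ℕ.+ d ℕ.+ d′)) (H k d) (H (k ℕ.+ d) d′) ⟩
  H k d ⊕ (ι 4 ⊗ inv (k ℕ.+ d ℕ.+ d′) ⊕ H (k ℕ.+ d) d′)      ∎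
  where
  open ≡-Reasoning
  eq : ∀ a b c → a ⊕ (b ⊕ c) ≡ b ⊕ (a ⊕ c)
  eq = solve-∀ ℚ-ring

H-mono : ∀ k {d d′} → d ℕ.≤ d′ → H k d ≼ H k d′
H-mono k {d} {d′} le = ≼-diff (0≼H (k ℕ.+ d) (d′ ℕ.∸ d)) (trans (cong (H k) (sym (ℕₚ.m+[n∸m]≡n le))) (H-+ k d (d′ ℕ.∸ d)))

-- 4/(2i) + 4/(2i+1) ≤ 4/i, so a doubled range has no larger sum.
H-double : ∀ k d .{{_ : NonZero k}} → H (k ℕ.+ k) (d ℕ.+ d) ≼ H k d
H-double k zero    = ℚₚ.≤-refl
H-double k (suc d) = subst (_≼ H k (suc d)) (sym (cong (H (k ℕ.+ k)) (cong suc (ℕₚ.+-suc d d))))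
  (ℚₚ.≤-trans (ℚₚ.≤-reflexive (sym (ℚₚ.+-assoc a b (H (k ℕ.+ k) (d ℕ.+ d))))) (ℚₚ.+-mono-≤ pair (H-double k d)))
  where
  i = k ℕ.+ d
  nz : NonZero i
  nz = ℕ.>-nonZero (ℕₚ.<-≤-trans (ℕ.>-nonZero⁻¹ k) (ℕₚ.m≤m+n k d))
  nz2 : NonZero (i ℕ.+ i)
  nz2 = ℕ.>-nonZero (ℕₚ.<-≤-trans (ℕ.>-nonZero⁻¹ i {{nz}}) (ℕₚ.m≤m+n i i))
  eqi : k ℕ.+ k ℕ.+ (d ℕ.+ d) ≡ i ℕ.+ i
  eqi = lem k d
    where
    lem : ∀ k d → k ℕ.+ k ℕ.+ (d ℕ.+ d) ≡ (k ℕ.+ d) ℕ.+ (k ℕ.+ d)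
    lem = ℕS.solve-∀
  a = ι 4 ⊗ inv (k ℕ.+ k ℕ.+ suc (d ℕ.+ d))
  b = ι 4 ⊗ inv (k ℕ.+ k ℕ.+ (d ℕ.+ d))
  inv-le : ∀ {j} → i ℕ.+ i ℕ.≤ j → inv j ≼ inv (i ℕ.+ i)
  inv-le le = inv-anti {{nz2}} le
  half : inv (i ℕ.+ i) ⊕ inv (i ℕ.+ i) ≡ inv i
  half = begin
    x ⊕ x                               ≡⟨ ι-cancel i {{nz}} (x ⊕ x) ⟨
    ι i ⊗ (inv i ⊗ (x ⊕ x))             ≡⟨ eq (ι i) (inv i) x ⟩
    inv i ⊗ ((ι i ⊕ ι i) ⊗ x)           ≡⟨ cong (λ z → inv i ⊗ (z ⊗ x)) (ι-+ i i) ⟨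
    inv i ⊗ (ι (i ℕ.+ i) ⊗ x)           ≡⟨ cong (inv i ⊗_) (ι⊗inv (i ℕ.+ i) {{nz2}}) ⟩
    inv i ⊗ 1ℚ                          ≡⟨ ℚₚ.*-identityʳ (inv i) ⟩
    inv i                               ∎
    where
    open ≡-Reasoning
    x = inv (i ℕ.+ i)
    eq : ∀ a b x → a ⊗ (b ⊗ (x ⊕ x)) ≡ b ⊗ ((a ⊕ a) ⊗ x)
    eq = solve-∀ ℚ-ring
  pair : a ⊕ b ≼ ι 4 ⊗ inv i
  pair = ℚₚ.≤-trans (ℚₚ.+-mono-≤
    (⊗-monoʳ (0≼ι 4) (inv-le (ℕₚ.≤-trans (ℕₚ.n≤1+n (i ℕ.+ i)) (ℕₚ.≤-reflexive (sym (trans (ℕₚ.+-suc (k ℕ.+ k) (d ℕ.+ d)) (cong suc eqi)))))))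
    (⊗-monoʳ (0≼ι 4) (inv-le (ℕₚ.≤-reflexive (sym eqi)))))
    (ℚₚ.≤-reflexive (trans (sym (ℚₚ.*-distribˡ-+ (ι 4) (inv (i ℕ.+ i)) (inv (i ℕ.+ i)))) (cong (ι 4 ⊗_) half)))

H-double^ : ∀ k .{{_ : NonZero k}} a → H (k ℕ.* 2 ℕ.^ a) (k ℕ.* 2 ℕ.^ a) ≼ H k k
H-double^ k zero    = ℚₚ.≤-reflexive (cong₂ H (ℕₚ.*-identityʳ k) (ℕₚ.*-identityʳ k))
H-double^ k {{nz}} (suc a) = ℚₚ.≤-trans
  (ℚₚ.≤-trans (ℚₚ.≤-reflexive (cong₂ H eq eq)) (H-double (k ℕ.* 2 ℕ.^ a) (k ℕ.* 2 ℕ.^ a) {{ℕₚ.m*n≢0 k (2 ℕ.^ a) {{nz}} {{ℕₚ.m^n≢0 2 a}}}}))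
  (H-double^ k a)
  where
  lem : ∀ k x → k ℕ.* (2 ℕ.* x) ≡ k ℕ.* x ℕ.+ k ℕ.* x
  lem = ℕS.solve-∀
  eq : k ℕ.* 2 ℕ.^ suc a ≡ k ℕ.* 2 ℕ.^ a ℕ.+ k ℕ.* 2 ℕ.^ a
  eq = lem k (2 ℕ.^ a)

-- The exponents from k to k · 2 ^ a fall into a doublings, none with a larger sum than the first.
H-ratio : ∀ k .{{_ : NonZero k}} a {d} → k ℕ.+ d ℕ.≤ k ℕ.* 2 ℕ.^ a → H k d ≼ ι a ⊗ H k k
H-ratio k zero {d} le = ℚₚ.≤-trans (H-mono k (ℕₚ.+-cancelˡ-≤ k d 0 (ℕₚ.≤-trans le (ℕₚ.≤-reflexive (trans (ℕₚ.*-identityʳ k) (sym (ℕₚ.+-identityʳ k)))))))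
  (ℚₚ.≤-reflexive (sym (trans (cong (_⊗ H k k) ι-0) (ℚₚ.*-zeroˡ (H k k)))))
H-ratio k (suc a) {d} le = ℚₚ.≤-trans (H-mono k d≤) (ℚₚ.≤-trans (ℚₚ.≤-reflexive (trans (H-+ k d₀ M) (cong (λ x → H k d₀ ⊕ H x M) k+d₀)))
  (ℚₚ.≤-trans (ℚₚ.+-mono-≤ (H-ratio k a (ℕₚ.≤-reflexive k+d₀)) (H-double^ k a))
    (ℚₚ.≤-reflexive (trans (eq (ι a) (H k k)) (cong (_⊗ H k k) (sym (ι-suc a)))))))
  where
  M = k ℕ.* 2 ℕ.^ a
  d₀ = M ℕ.∸ k
  k≤M : k ℕ.≤ M
  k≤M = ℕₚ.≤-trans (ℕₚ.≤-reflexive (sym (ℕₚ.*-identityʳ k))) (ℕₚ.*-monoʳ-≤ k (ℕₚ.m^n>0 2 a))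
  k+d₀ : k ℕ.+ d₀ ≡ M
  k+d₀ = ℕₚ.m+[n∸m]≡n k≤M
  lem : ∀ k x → k ℕ.* (2 ℕ.* x) ≡ k ℕ.* x ℕ.+ k ℕ.* x
  lem = ℕS.solve-∀
  d≤ : d ℕ.≤ d₀ ℕ.+ M
  d≤ = ℕₚ.+-cancelˡ-≤ k d (d₀ ℕ.+ M) (ℕₚ.≤-trans le (ℕₚ.≤-reflexive
    (trans (lem k (2 ℕ.^ a)) (trans (cong (ℕ._+ M) (sym k+d₀)) (ℕₚ.+-assoc k d₀ M)))))
  eq : ∀ a h → a ⊗ h ⊕ h ≡ (1ℚ ⊕ a) ⊗ h
  eq = solve-∀ ℚ-ring

sum-dyadic : ∀ k d .{{_ : NonZero k}} → sumOver (λ p → inv p ⊕ inv p) (dyadic k d) ≼ H k d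
sum-dyadic k zero    = ℚₚ.≤-refl
sum-dyadic k (suc d) = ℚₚ.≤-trans
  (ℚₚ.≤-reflexive (sumOver-++ (λ p → inv p ⊕ inv p) (block (k ℕ.+ d)) (dyadic k d)))
  (ℚₚ.+-mono-≤ (sum-block (k ℕ.+ d) {{nz}}) (sum-dyadic k d))
  where
  nz : NonZero (k ℕ.+ d)
  nz = ℕ.>-nonZero (ℕₚ.<-≤-trans (ℕ.>-nonZero⁻¹ k) (ℕₚ.m≤m+n k d))

-- The weight of a prime in the final count: 2/p for p itself, and 19 · 2/p² to exclude its square.
weight : ℕ → ℚ
weight p = (inv p ⊕ inv p) ⊕ ι 19 ⊗ (inv (p ℕ.* p) ⊕ inv (p ℕ.* p))

sumOver-⊕⊗ : ∀ h c ps → sumOver (λ p → h p ⊕ c ⊗ h p) ps ≡ sumOver h ps ⊕ c ⊗ sumOver h ps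
sumOver-⊕⊗ h c [] = sym (trans (ℚₚ.+-identityˡ (c ⊗ 0ℚ)) (ℚₚ.*-zeroʳ c))
sumOver-⊕⊗ h c (p ∷ ps) = trans (cong ((h p ⊕ c ⊗ h p) ⊕_) (sumOver-⊕⊗ h c ps)) (eq (h p) c (sumOver h ps))
  where
  eq : ∀ x c s → (x ⊕ c ⊗ x) ⊕ (s ⊕ c ⊗ s) ≡ (x ⊕ s) ⊕ c ⊗ (x ⊕ s)
  eq = solve-∀ ℚ-ring

sumOver-mono : ∀ {h h′ ps} → All (λ p → h p ≼ h′ p) ps → sumOver h ps ≼ sumOver h′ ps
sumOver-mono []        = ℚₚ.≤-refl
sumOver-mono (le ∷ as) = ℚₚ.+-mono-≤ le (sumOver-mono as)

-- For p > 2 ^ i the square term is at most 19 / 2 ^ i times 2 / p, and the sum of 2 / p over the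
-- block is at most 4 / i ≤ 1.
weight-block : ∀ i → 4 ℕ.≤ i → sumOver weight (block i) ≼ ι 4 ⊗ inv i ⊕ ι 19 ⊗ inv (2 ℕ.^ i)
weight-block i 4≤i = ℚₚ.≤-trans (sumOver-mono (All.map bound (chain-> (chain-block i 1≤i))))
  (ℚₚ.≤-trans (ℚₚ.≤-reflexive (sumOver-⊕⊗ (λ p → inv p ⊕ inv p) c (block i)))
    (ℚₚ.≤-trans (ℚₚ.+-mono-≤ (sum-block i) (⊗-monoʳ 0≼c (ℚₚ.≤-trans (sum-block i) 4/i≼1)))
      (ℚₚ.≤-reflexive (cong (ι 4 ⊗ inv i ⊕_) (ℚₚ.*-identityʳ c)))))
  where
  1≤i : 1 ℕ.≤ i
  1≤i = ℕₚ.≤-trans (ℕ.s≤s ℕ.z≤n) 4≤i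
  instance
    nz : NonZero i
    nz = ℕ.>-nonZero 1≤i
  c = ι 19 ⊗ inv (2 ℕ.^ i)
  0≼c : 0ℚ ≼ c
  0≼c = 0≼⊗ (0≼ι 19) (0≼inv (2 ℕ.^ i))
  4/i≼1 : ι 4 ⊗ inv i ≼ 1ℚ
  4/i≼1 = ℚₚ.≤-trans (⊗-monoˡ (0≼inv i) (ι-mono 4≤i)) (ℚₚ.≤-reflexive (ι⊗inv i))
  bound : ∀ {p} → 2 ℕ.^ i ℕ.< p → weight p ≼ (inv p ⊕ inv p) ⊕ c ⊗ (inv p ⊕ inv p)
  bound {p} lt = ℚₚ.+-monoʳ-≤ (inv p ⊕ inv p) (ℚₚ.≤-trans
    (⊗-monoʳ (0≼ι 19) (ℚₚ.+-mono-≤ sq sq)) (ℚₚ.≤-reflexive (eq (ι 19) (inv (2 ℕ.^ i)) (inv p))))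
    where
    instance
      p≢0 : NonZero p
      p≢0 = ℕ.>-nonZero (ℕₚ.≤-<-trans ℕ.z≤n lt)
    sq : inv (p ℕ.* p) ≼ inv (2 ℕ.^ i) ⊗ inv p
    sq = ℚₚ.≤-trans (ℚₚ.≤-reflexive (inv-* p p)) (⊗-monoˡ (0≼inv p) (inv-anti {{ℕₚ.m^n≢0 2 i}} (ℕₚ.<⇒≤ lt)))
    eq : ∀ n a b → n ⊗ (a ⊗ b ⊕ a ⊗ b) ≡ (n ⊗ a) ⊗ (b ⊕ b)
    eq = solve-∀ ℚ-ring

inv-2^ : ∀ i → inv (2 ℕ.^ i) ≡ ι 2 ⊗ inv (2 ℕ.^ suc i)
inv-2^ i = sym (trans (cong (ι 2 ⊗_) (inv-* 2 (2 ℕ.^ i) {{_}} {{ℕₚ.m^n≢0 2 i}})) (ι-cancel 2 (inv (2 ℕ.^ i))))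

-- The square terms of the blocks form a geometric series; the tail 2 · 19 / 2 ^ (k + d) on the left
-- makes it telescope.
weight-dyadic-tail : ∀ k d → 4 ℕ.≤ k → sumOver weight (dyadic k d) ⊕ ι 19 ⊗ (ι 2 ⊗ inv (2 ℕ.^ (k ℕ.+ d))) ≼ H k d ⊕ ι 19 ⊗ (ι 2 ⊗ inv (2 ℕ.^ k))
weight-dyadic-tail k zero    4≤k = ℚₚ.≤-reflexive (cong (λ j → 0ℚ ⊕ ι 19 ⊗ (ι 2 ⊗ inv (2 ℕ.^ j))) (ℕₚ.+-identityʳ k))
weight-dyadic-tail k (suc d) 4≤k = begin
  sumOver weight (dyadic k (suc d)) ⊕ ι 19 ⊗ (ι 2 ⊗ inv (2 ℕ.^ (k ℕ.+ suc d)))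
    ≡⟨ cong₂ (λ x j → x ⊕ ι 19 ⊗ (ι 2 ⊗ inv (2 ℕ.^ j))) (sumOver-++ weight (block (k ℕ.+ d)) (dyadic k d)) (ℕₚ.+-suc k d) ⟩
  (B ⊕ S) ⊕ ι 19 ⊗ (ι 2 ⊗ inv (2 ℕ.^ suc (k ℕ.+ d)))
    ≡⟨ cong (λ z → (B ⊕ S) ⊕ ι 19 ⊗ z) (inv-2^ (k ℕ.+ d)) ⟨
  (B ⊕ S) ⊕ ι 19 ⊗ t
    ≤⟨ ℚₚ.+-monoˡ-≤ (ι 19 ⊗ t) (ℚₚ.+-monoˡ-≤ S (weight-block (k ℕ.+ d) (ℕₚ.≤-trans 4≤k (ℕₚ.m≤m+n k d)))) ⟩
  ((ι 4 ⊗ inv (k ℕ.+ d) ⊕ ι 19 ⊗ t) ⊕ S) ⊕ ι 19 ⊗ t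
    ≡⟨ eq (ι 4 ⊗ inv (k ℕ.+ d)) (ι 19) t S ⟩
  ι 4 ⊗ inv (k ℕ.+ d) ⊕ (S ⊕ ι 19 ⊗ (t ⊕ t))
    ≡⟨ cong (λ z → ι 4 ⊗ inv (k ℕ.+ d) ⊕ (S ⊕ ι 19 ⊗ z)) (ι-2 t) ⟨
  ι 4 ⊗ inv (k ℕ.+ d) ⊕ (S ⊕ ι 19 ⊗ (ι 2 ⊗ t))
    ≤⟨ ℚₚ.+-monoʳ-≤ (ι 4 ⊗ inv (k ℕ.+ d)) (weight-dyadic-tail k d 4≤k) ⟩
  ι 4 ⊗ inv (k ℕ.+ d) ⊕ (H k d ⊕ ι 19 ⊗ (ι 2 ⊗ inv (2 ℕ.^ k)))
    ≡⟨ ℚₚ.+-assoc (ι 4 ⊗ inv (k ℕ.+ d)) (H k d) (ι 19 ⊗ (ι 2 ⊗ inv (2 ℕ.^ k))) ⟨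
  H k (suc d) ⊕ ι 19 ⊗ (ι 2 ⊗ inv (2 ℕ.^ k)) ∎
  where
  open ℚₚ.≤-Reasoning
  B = sumOver weight (block (k ℕ.+ d))
  S = sumOver weight (dyadic k d)
  t = inv (2 ℕ.^ (k ℕ.+ d))
  eq : ∀ h n t s → ((h ⊕ n ⊗ t) ⊕ s) ⊕ n ⊗ t ≡ h ⊕ (s ⊕ n ⊗ (t ⊕ t))
  eq = solve-∀ ℚ-ring

weight-dyadic : ∀ k d → 4 ℕ.≤ k → sumOver weight (dyadic k d) ≼ H k d ⊕ ι 19 ⊗ (ι 2 ⊗ inv (2 ℕ.^ k))
weight-dyadic k d 4≤k = ℚₚ.≤-trans
  (≼-diff (0≼⊗ (0≼ι 19) (0≼⊗ (0≼ι 2) (0≼inv (2 ℕ.^ (k ℕ.+ d))))) refl) (weight-dyadic-tail k d 4≤k)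

-- Since 1 - 4/i = falling i / falling (i+1) with falling (4+j) = (j+3)(j+2)(j+1)j, the product telescopes.
falling : ℕ → ℕ
falling j = (3 ℕ.+ j) ℕ.* ((2 ℕ.+ j) ℕ.* ((1 ℕ.+ j) ℕ.* j))

V-block : ∀ N i → 1 ℕ.≤ i → 1ℚ ⊖ ι 4 ⊗ inv i ≼ V (gs N (block i))
V-block N i 1≤i = ℚₚ.≤-trans
  (≼-diff (0≼⊖ (ℚₚ.≤-trans (sum-gs≼ N (block i)) (sum-block i {{ℕ.>-nonZero 1≤i}}))) (eq (ι 4 ⊗ inv i) (sumℚ (gs N (block i)))))
  (1⊖sum≼V (gs-unit (chain-block i 1≤i)))
  where
  eq : ∀ a s → 1ℚ ⊖ s ≡ (1ℚ ⊖ a) ⊕ (a ⊖ s)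
  eq = solve-∀ ℚ-ring

V-dyadic : ∀ N j d → ι (falling j) ≼ V (gs N (dyadic (4 ℕ.+ j) d)) ⊗ ι (falling (j ℕ.+ d))
V-dyadic N j zero    = ℚₚ.≤-reflexive (sym (trans (ℚₚ.*-identityˡ _) (cong (λ x → ι (falling x)) (ℕₚ.+-identityʳ j))))
V-dyadic N j (suc d) = ℚₚ.≤-trans (V-dyadic N j d) (ℚₚ.≤-trans (⊗-monoʳ 0≼v step)
  (ℚₚ.≤-reflexive (trans (eq v b (ι (falling (suc (j ℕ.+ d))))) (cong₂ (λ x y → x ⊗ ι (falling y)) (sym v-eq) (sym (ℕₚ.+-suc j d))))))
  where
  i = 4 ℕ.+ (j ℕ.+ d)
  v = V (gs N (dyadic (4 ℕ.+ j) d))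
  b = V (gs N (block i))
  0≼v : 0ℚ ≼ v
  0≼v = 0≼V (gs-unit (chain-dyadic (4 ℕ.+ j) d (ℕ.s≤s ℕ.z≤n)))
  v-eq : V (gs N (dyadic (4 ℕ.+ j) (suc d))) ≡ b ⊗ v
  v-eq = trans (cong V (map-++ (g N) (block i) (dyadic (4 ℕ.+ j) d))) (V-++ (gs N (block i)) (gs N (dyadic (4 ℕ.+ j) d)))
  eq : ∀ v b q → v ⊗ (b ⊗ q) ≡ (b ⊗ v) ⊗ q
  eq = solve-∀ ℚ-ring
  x = j ℕ.+ d
  telescope : ι (falling x) ≡ (1ℚ ⊖ ι 4 ⊗ inv i) ⊗ ι (falling (suc x))
  telescope = begin
    ι (falling x)                             ≡⟨ cong ι (lem₁ x) ⟩
    ι (c ℕ.* x)                               ≡⟨ ι-* c x ⟩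
    ι c ⊗ ι x                                 ≡⟨ eq₁ (ι c) (ι x) (ι 4) ⟩
    ((ι 4 ⊕ ι x) ⊖ ι 4 ⊗ 1ℚ) ⊗ ι c            ≡⟨ cong₂ (λ y z → (y ⊖ ι 4 ⊗ z) ⊗ ι c) (sym (ι-+ 4 x)) (sym (ι⊗inv i)) ⟩
    (ι i ⊖ ι 4 ⊗ (ι i ⊗ inv i)) ⊗ ι c         ≡⟨ eq₂ (ι i) (ι 4) (inv i) (ι c) ⟩
    (1ℚ ⊖ ι 4 ⊗ inv i) ⊗ (ι i ⊗ ι c)          ≡⟨ cong ((1ℚ ⊖ ι 4 ⊗ inv i) ⊗_) (trans (sym (ι-* i c)) (cong ι (lem₂ x))) ⟩
    (1ℚ ⊖ ι 4 ⊗ inv i) ⊗ ι (falling (suc x))  ∎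
    where
    open ≡-Reasoning
    c = (3 ℕ.+ x) ℕ.* ((2 ℕ.+ x) ℕ.* (1 ℕ.+ x))
    lem₁ : ∀ x → (3 ℕ.+ x) ℕ.* ((2 ℕ.+ x) ℕ.* ((1 ℕ.+ x) ℕ.* x)) ≡ (3 ℕ.+ x) ℕ.* ((2 ℕ.+ x) ℕ.* (1 ℕ.+ x)) ℕ.* x
    lem₁ = ℕS.solve-∀
    lem₂ : ∀ x → (4 ℕ.+ x) ℕ.* ((3 ℕ.+ x) ℕ.* ((2 ℕ.+ x) ℕ.* (1 ℕ.+ x))) ≡ (3 ℕ.+ suc x) ℕ.* ((2 ℕ.+ suc x) ℕ.* ((1 ℕ.+ suc x) ℕ.* suc x))
    lem₂ = ℕS.solve-∀
    eq₁ : ∀ c x f → c ⊗ x ≡ ((f ⊕ x) ⊖ f ⊗ 1ℚ) ⊗ c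
    eq₁ = solve-∀ ℚ-ring
    eq₂ : ∀ i f i′ c → (i ⊖ f ⊗ (i ⊗ i′)) ⊗ c ≡ (1ℚ ⊖ f ⊗ i′) ⊗ (i ⊗ c)
    eq₂ = solve-∀ ℚ-ring
  step : ι (falling x) ≼ b ⊗ ι (falling (suc x))
  step = ℚₚ.≤-trans (ℚₚ.≤-reflexive telescope) (⊗-monoˡ (0≼ι (falling (suc x))) (V-block N i (ℕ.s≤s ℕ.z≤n)))

-- At x = 0 the ratio is exactly 39 = 32760 / 840, and it tends to 16. The difference of the two
-- sides is the polynomial inserted below, with nonnegative coefficients and no constant term.
falling-ratio : ∀ x → falling ((4 ℕ.+ x) ℕ.+ (8 ℕ.+ x)) ℕ.≤ 39 ℕ.* falling (4 ℕ.+ x)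
falling-ratio x = ℕₚ.≤-trans (ℕₚ.m≤m+n (falling ((4 ℕ.+ x) ℕ.+ (8 ℕ.+ x))) (((23 ℕ.* x ℕ.+ 426) ℕ.* x ℕ.+ 2617) ℕ.* x ℕ.* x ℕ.+ 5334 ℕ.* x)) (ℕₚ.≤-reflexive (eq x))
  where
  eq : ∀ x → (3 ℕ.+ ((4 ℕ.+ x) ℕ.+ (8 ℕ.+ x))) ℕ.* ((2 ℕ.+ ((4 ℕ.+ x) ℕ.+ (8 ℕ.+ x))) ℕ.* ((1 ℕ.+ ((4 ℕ.+ x) ℕ.+ (8 ℕ.+ x))) ℕ.* ((4 ℕ.+ x) ℕ.+ (8 ℕ.+ x)))) ℕ.+ (((23 ℕ.* x ℕ.+ 426) ℕ.* x ℕ.+ 2617) ℕ.* x ℕ.* x ℕ.+ 5334 ℕ.* x)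
    ≡ 39 ℕ.* ((3 ℕ.+ (4 ℕ.+ x)) ℕ.* ((2 ℕ.+ (4 ℕ.+ x)) ℕ.* ((1 ℕ.+ (4 ℕ.+ x)) ℕ.* (4 ℕ.+ x))))
  eq = ℕS.solve-∀

1≼39V : ∀ N x → 1ℚ ≼ ι 39 ⊗ V (gs N (dyadic (8 ℕ.+ x) (8 ℕ.+ x)))
1≼39V N x = ⊗-cancel q (0≺ι (falling (4 ℕ.+ x))) (ℚₚ.≤-trans (ℚₚ.≤-reflexive (ℚₚ.*-identityʳ q))
  (ℚₚ.≤-trans (V-dyadic N (4 ℕ.+ x) (8 ℕ.+ x)) (ℚₚ.≤-trans
    (⊗-monoʳ (0≼V (gs-unit (chain-dyadic (8 ℕ.+ x) (8 ℕ.+ x) (ℕ.s≤s ℕ.z≤n)))) (ι-mono (falling-ratio x)))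
    (ℚₚ.≤-reflexive (trans (cong (v ⊗_) (ι-* 39 (falling (4 ℕ.+ x)))) (eq v (ι 39) q))))))
  where
  q = ι (falling (4 ℕ.+ x))
  v = V (gs N (dyadic (8 ℕ.+ x) (8 ℕ.+ x)))
  eq : ∀ v n q → v ⊗ (n ⊗ q) ≡ q ⊗ (n ⊗ v)
  eq = solve-∀ ℚ-ring

-- The Brun–Hooley sieve

-- X is the indicator of the t for which no odd prime ≤ z divides t (N - t); L and W bound it from
-- below and above, and have means l and w up to errors νL and νW.
record Sieve (N z : ℕ) : Set where
  field
    L W X  : ℕ → ℚ
    l w    : ℚ
    νL νW  : ℕ
    good-L : Good N z L l νL
    good-W : Good N z W w νW
    L≼X    : ∀ t → L t ≼ X t
    0≼X    : ∀ t → 0ℚ ≼ X t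
    X≼W    : ∀ t → X t ≼ W t
    sifted : ∀ {t} → t ℕ.≤ N → ¬ (X t ≡ 0ℚ) → ∀ p → Prime p → 3 ℕ.≤ p → p ℕ.≤ z →
             ¬ (p ℕ∣.∣ t ⊎ p ℕ∣.∣ N ℕ.∸ t)

V-zero : ∀ {N t p ps} → p ∈ ps → E N p t ≡ 1ℚ → V (Es N ps t) ≡ 0ℚ
V-zero {N} {t} {ps = p ∷ ps} (here refl) eq = trans (cong (λ x → V (Es N ps t) ⊖ x ⊗ V (Es N ps t)) eq) (lem (V (Es N ps t)))
  where
  lem : ∀ v → v ⊖ 1ℚ ⊗ v ≡ 0ℚ
  lem = solve-∀ ℚ-ring
V-zero {N} {t} {ps = q ∷ ps} (there i) eq = trans (cong (λ x → x ⊖ E N q t ⊗ x) (V-zero {N} {t} i eq)) (lem (E N q t))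
  where
  lem : ∀ v → 0ℚ ⊖ v ⊗ 0ℚ ≡ 0ℚ
  lem = solve-∀ ℚ-ring

good-1 : ∀ {N z} → Good N z (λ _ → 1ℚ) 1ℚ 1
good-1 {N} D (nz , _) = approx-1 N D {{nz}}

exactSieve : ∀ N d → Sieve N (2 ℕ.+ d)
exactSieve N d = record
  { L = λ t → V (Es N ps t) ⊗ 1ℚ ; W = λ t → V (Es N ps t) ⊗ 1ℚ ; X = λ t → V (Es N ps t) ⊗ 1ℚ
  ; l = V (gs N ps) ⊗ 1ℚ ; w = V (gs N ps) ⊗ 1ℚ
  ; νL = 3 ℕ.^ length ps ℕ.* 1 ; νW = 3 ℕ.^ length ps ℕ.* 1
  ; good-L = good-V c good-1 ; good-W = good-V c good-1
  ; L≼X = λ t → ℚₚ.≤-refl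
  ; 0≼X = λ t → 0≼⊗ (0≼V (Es-unit N ps t)) 0≼1
  ; X≼W = λ t → ℚₚ.≤-refl
  ; sifted = λ {t} t≤N X≢0 p pp 3≤p p≤z h → X≢0 (trans (cong (_⊗ 1ℚ)
      (V-zero {N} {t} (∈-primesIn 2 d pp 3≤p p≤z) (E-hit t≤N h))) (ℚₚ.*-zeroˡ 1ℚ))
  }
  where
  ps = primesIn 2 d
  c : Chain 2 (2 ℕ.+ d) ps
  c = chain-primesIn 2 d ℕₚ.≤-refl

-- The Brun–Hooley step: if L ≤ X ≤ W and v ≤ u ≤ v + y, with v the indicator of the new layer,
-- then u L - y W ≤ v X ≤ u W.
layer : ∀ {N} k b → 1 ℕ.≤ k → Sieve N (2 ℕ.^ k) → Sieve N (2 ℕ.^ (k ℕ.+ k))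
layer {N} k b 1≤k S = record
  { L = λ t → u t ⊗ L t ⊖ y t ⊗ W t ; W = λ t → u t ⊗ W t ; X = λ t → v t ⊗ X t
  ; l = T (dbl b) (gs N ps) ⊗ l ⊖ e (suc (dbl b)) (gs N ps) ⊗ w ; w = T (dbl b) (gs N ps) ⊗ w
  ; νL = (1 ℕ.+ 2 ℕ.* length ps) ℕ.^ dbl b ℕ.* νL ℕ.+ (1 ℕ.+ 2 ℕ.* length ps) ℕ.^ suc (dbl b) ℕ.* νW
  ; νW = (1 ℕ.+ 2 ℕ.* length ps) ℕ.^ dbl b ℕ.* νW
  ; good-L = good-⊖ (good-T (dbl b) c good-L) (good-e (suc (dbl b)) c good-W)
  ; good-W = good-T (dbl b) c good-W
  ; L≼X = λ t → ≼-diff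
      (0≼⊕ (0≼⊗ (0≼u t) (0≼⊖ (L≼X t))) (0≼⊕ (0≼⊗ (0≼⊖ (u≼v⊕y t)) (0≼X t)) (0≼⊗ (0≼y t) (0≼⊖ (X≼W t)))))
      (eq (u t) (v t) (y t) (L t) (X t) (W t))
  ; 0≼X = λ t → 0≼⊗ (0≼v t) (0≼X t)
  ; X≼W = λ t → ⊗-mono (0≼X t) (0≼u t) (v≼u t) (X≼W t)
  ; sifted = λ {t} t≤N vX≢0 p pp 3≤p p≤z → [
      (λ p≤ → sifted t≤N (λ X≡0 → vX≢0 (trans (cong (v t ⊗_) X≡0) (ℚₚ.*-zeroʳ (v t)))) p pp 3≤p p≤) ,
      (λ p> h → vX≢0 (trans (cong (_⊗ X t) (V-zero {N} {t} (∈-dyadic k k pp p> p≤z) (E-hit t≤N h))) (ℚₚ.*-zeroˡ (X t))))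
      ]′ (ℕₚ.≤-<-connex p (2 ℕ.^ k))
  }
  where
  open Sieve S
  ps = dyadic k k
  c : Chain (2 ℕ.^ k) (2 ℕ.^ (k ℕ.+ k)) ps
  c = chain-dyadic k k 1≤k
  u v y : ℕ → ℚ
  u t = T (dbl b) (Es N ps t)
  v t = V (Es N ps t)
  y t = e (suc (dbl b)) (Es N ps t)
  0≼v : ∀ t → 0ℚ ≼ v t
  0≼v t = 0≼V (Es-unit N ps t)
  v≼u : ∀ t → v t ≼ u t
  v≼u t = V≼T b (Es-unit N ps t)
  0≼u : ∀ t → 0ℚ ≼ u t
  0≼u t = ℚₚ.≤-trans (0≼v t) (v≼u t)
  0≼y : ∀ t → 0ℚ ≼ y t
  0≼y t = 0≼e (suc (dbl b)) (Es-unit N ps t)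
  u≼v⊕y : ∀ t → u t ≼ v t ⊕ y t
  u≼v⊕y t = T≼V⊕e b (Es-unit N ps t)
  eq : ∀ u v y L X W → v ⊗ X ≡ (u ⊗ L ⊖ y ⊗ W) ⊕ (u ⊗ (X ⊖ L) ⊕ (((v ⊕ y) ⊖ u) ⊗ X ⊕ y ⊗ (W ⊖ X)))
  eq = solve-∀ ℚ-ring

-- The tower of sieve layers

K : ℕ → ℕ
K zero    = 8
K (suc J) = K J ℕ.+ K J

8≤K : ∀ J → 8 ℕ.≤ K J
8≤K zero    = ℕₚ.≤-refl
8≤K (suc J) = ℕₚ.≤-trans (8≤K J) (ℕₚ.m≤m+n (K J) (K J))

K≡8*2^ : ∀ J → K J ≡ 8 ℕ.* 2 ℕ.^ J
K≡8*2^ zero    = refl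
K≡8*2^ (suc J) = trans (cong₂ ℕ._+_ (K≡8*2^ J) (K≡8*2^ J)) (eq (2 ℕ.^ J))
  where
  eq : ∀ x → 8 ℕ.* x ℕ.+ 8 ℕ.* x ≡ 8 ℕ.* (2 ℕ.* x)
  eq = ℕS.solve-∀

-- The index i grows downwards, so lower layers are cut later: their primes are few enough for the
-- extra degrees to be cheap. The tower stands on 2 ^ 8 because the block bound 1 - 4/i is weak for
-- small i and void for i ≤ 4.
tower : ∀ {N} → Sieve N (2 ℕ.^ 8) → ∀ J i → Sieve N (2 ℕ.^ K J)
tower S zero    i = S
tower S (suc J) i = layer (K J) (6 ℕ.+ i) (ℕₚ.≤-trans (ℕ.s≤s ℕ.z≤n) (8≤K J)) (tower S J (suc i))

layer-ps : ∀ J → List ℕ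
layer-ps J = dyadic (K J) (K J)

1≤K : ∀ J → 1 ℕ.≤ K J
1≤K J = ℕₚ.≤-trans (ℕ.s≤s ℕ.z≤n) (8≤K J)

layer-unit : ∀ N J → All Unit (gs N (layer-ps J))
layer-unit N J = gs-unit (chain-dyadic (K J) (K J) (1≤K J))

-- 360360 is a common multiple of 8, …, 15.
inv-frac : ∀ n q .{{_ : NonZero n}} → n ℕ.* q ≡ 360360 → inv n ≡ ι q ⊗ inv 360360
inv-frac n q eq = begin
  inv n                                    ≡⟨ ι-cancel 360360 (inv n) ⟨
  ι 360360 ⊗ (inv 360360 ⊗ inv n)          ≡⟨ cong (λ z → z ⊗ (inv 360360 ⊗ inv n)) (trans (cong ι (sym eq)) (ι-* n q)) ⟩
  (ι n ⊗ ι q) ⊗ (inv 360360 ⊗ inv n)       ≡⟨ lem (ι n) (ι q) (inv 360360) (inv n) ⟩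
  (ι n ⊗ inv n) ⊗ (ι q ⊗ inv 360360)       ≡⟨ cong (_⊗ (ι q ⊗ inv 360360)) (ι⊗inv n) ⟩
  1ℚ ⊗ (ι q ⊗ inv 360360)                  ≡⟨ ℚₚ.*-identityˡ (ι q ⊗ inv 360360) ⟩
  ι q ⊗ inv 360360                         ∎
  where
  open ≡-Reasoning
  lem : ∀ n q m n′ → (n ⊗ q) ⊗ (m ⊗ n′) ≡ (n ⊗ n′) ⊗ (q ⊗ m)
  lem = solve-∀ ℚ-ring

-- Partial sums are carried as natural numerators over one denominator, so that the numerical bounds
-- are checked by evaluation in ℕ.
H-step : ∀ k d n q {s} .{{_ : NonZero (k ℕ.+ d)}} → (k ℕ.+ d) ℕ.* q ≡ 360360 → H k d ≡ ι s ⊗ inv 360360 → n ≡ 4 ℕ.* q ℕ.+ s →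
  H k (suc d) ≡ ι n ⊗ inv 360360
H-step k d n q {s} eq h refl = begin
  ι 4 ⊗ inv (k ℕ.+ d) ⊕ H k d                                  ≡⟨ cong₂ (λ x y → ι 4 ⊗ x ⊕ y) (inv-frac (k ℕ.+ d) q eq) h ⟩
  ι 4 ⊗ (ι q ⊗ inv 360360) ⊕ ι s ⊗ inv 360360                  ≡⟨ lem (ι 4) (ι q) (ι s) (inv 360360) ⟩
  (ι 4 ⊗ ι q ⊕ ι s) ⊗ inv 360360                               ≡⟨ cong (_⊗ inv 360360) (trans (cong (_⊕ ι s) (sym (ι-* 4 q))) (sym (ι-+ (4 ℕ.* q) s))) ⟩
  ι (4 ℕ.* q ℕ.+ s) ⊗ inv 360360                               ∎
  where
  open ≡-Reasoning
  lem : ∀ f q s m → f ⊗ (q ⊗ m) ⊕ s ⊗ m ≡ (f ⊗ q ⊕ s) ⊗ m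
  lem = solve-∀ ℚ-ring

H-zero : ∀ k → H k 0 ≡ ι 0 ⊗ inv 360360
H-zero k = sym (trans (cong (_⊗ inv 360360) ι-0) (ℚₚ.*-zeroˡ (inv 360360)))

H-bound : ∀ k d n a b → H k d ≡ ι n ⊗ inv 360360 → a ℕ.* n ℕ.≤ b ℕ.* 360360 → ι a ⊗ H k d ≼ ι b
H-bound k d n a b h le = begin
  ι a ⊗ H k d                          ≡⟨ cong (ι a ⊗_) h ⟩
  ι a ⊗ (ι n ⊗ inv 360360)             ≡⟨ ℚₚ.*-assoc (ι a) (ι n) (inv 360360) ⟨
  (ι a ⊗ ι n) ⊗ inv 360360             ≡⟨ cong (_⊗ inv 360360) (ι-* a n) ⟨
  ι (a ℕ.* n) ⊗ inv 360360             ≤⟨ ⊗-monoˡ (0≼inv 360360) (ι-mono le) ⟩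
  ι (b ℕ.* 360360) ⊗ inv 360360        ≡⟨ cong (_⊗ inv 360360) (ι-* b 360360) ⟩
  (ι b ⊗ ι 360360) ⊗ inv 360360        ≡⟨ ℚₚ.*-assoc (ι b) (ι 360360) (inv 360360) ⟩
  ι b ⊗ (ι 360360 ⊗ inv 360360)        ≡⟨ cong (ι b ⊗_) (ι⊗inv 360360) ⟩
  ι b ⊗ 1ℚ                             ≡⟨ ℚₚ.*-identityʳ (ι b) ⟩
  ι b                                  ∎
  where open ℚₚ.≤-Reasoning

H-8 : ι 1 ⊗ H 8 8 ≼ ι 3
H-8 = H-bound 8 8 1045580 1 3
  (H-step 8 7 1045580 24024 refl (H-step 8 6 949484 25740 refl (H-step 8 5 846524 27720 refl (H-step 8 4 735644 30030 refl (H-step 8 3 615524 32760 refl (H-step 8 2 484484 36036 refl (H-step 8 1 340340 40040 refl (H-step 8 0 180180 45045 refl (H-zero 8) refl) refl) refl) refl) refl) refl) refl) refl)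
  (ℕₚ.≤ᵇ⇒≤ 1045580 (3 ℕ.* 360360) _)

H-4 : ι 10 ⊗ H 4 4 ≼ ι 31
H-4 = H-bound 4 4 1094808 10 31
  -- The denominator 360360 also serves 4, ..., 7. The sum is about 3.04, hence 31/10 here instead
  -- of 3.
  (H-step 4 3 1094808 51480 refl (H-step 4 2 888888 60060 refl (H-step 4 1 648648 72072 refl (H-step 4 0 360360 90090 refl (H-zero 4) refl) refl) refl) refl)
  (ℕₚ.≤ᵇ⇒≤ (10 ℕ.* 1094808) (31 ℕ.* 360360) _)

H-K : ∀ J → H (K J) (K J) ≼ ι 3
H-K J = ℚₚ.≤-trans (ℚₚ.≤-reflexive (cong₂ H (K≡8*2^ J) (K≡8*2^ J))) (ℚₚ.≤-trans (H-double^ 8 J)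
  (ℚₚ.≤-trans (ℚₚ.≤-reflexive (sym (trans (cong (_⊗ H 8 8) ι-1) (ℚₚ.*-identityˡ (H 8 8))))) H-8))

factorial-step : ∀ r {A} → 4 ℕ.≤ r → A ℕ.* 3 ℕ.^ r ℕ.≤ r ! → 2 ℕ.* A ℕ.* 3 ℕ.^ suc (suc r) ℕ.≤ suc (suc r) !
factorial-step r {A} 4≤r h = begin
  2 ℕ.* A ℕ.* (3 ℕ.* (3 ℕ.* 3 ℕ.^ r))      ≡⟨ eq A (3 ℕ.^ r) ⟩
  6 ℕ.* (3 ℕ.* (A ℕ.* 3 ℕ.^ r))            ≤⟨ ℕₚ.*-mono-≤ (ℕ.s≤s (ℕ.s≤s 4≤r)) (ℕₚ.*-mono-≤ (ℕₚ.≤-trans (ℕₚ.n≤1+n 3) (ℕₚ.m≤n⇒m≤1+n 4≤r)) h) ⟩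
  suc (suc r) ℕ.* (suc r ℕ.* r !)          ∎
  where
  open ℕₚ.≤-Reasoning
  eq : ∀ A t → 2 ℕ.* A ℕ.* (3 ℕ.* (3 ℕ.* t)) ≡ 6 ℕ.* (3 ℕ.* (A ℕ.* t))
  eq = ℕS.solve-∀

-- This fixes the lowest cut at 6: 3900 · 3 ^ 13 lies just below 13!. Two further degrees gain at
-- least 18 = 2 · 3², which pays for the doubling of 2 ^ i.
factorial-bound : ∀ i → 39 ℕ.* (100 ℕ.* 2 ℕ.^ i) ℕ.* 3 ℕ.^ (13 ℕ.+ dbl i) ℕ.≤ (13 ℕ.+ dbl i) !
factorial-bound zero    = ℕₚ.≤ᵇ⇒≤ (3900 ℕ.* 3 ℕ.^ 13) (13 !) _
factorial-bound (suc i) = subst (λ A → A ℕ.* 3 ℕ.^ suc (suc (13 ℕ.+ dbl i)) ℕ.≤ suc (suc (13 ℕ.+ dbl i)) !) (eq (2 ℕ.^ i))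
  (factorial-step (13 ℕ.+ dbl i) {39 ℕ.* (100 ℕ.* 2 ℕ.^ i)} (ℕₚ.m≤m+n 4 (9 ℕ.+ dbl i)) (factorial-bound i))
  where
  eq : ∀ x → 2 ℕ.* (39 ℕ.* (100 ℕ.* x)) ≡ 39 ℕ.* (100 ℕ.* (2 ℕ.* x))
  eq = ℕS.solve-∀

V-layer : ∀ N J → 1ℚ ≼ ι 39 ⊗ V (gs N (layer-ps J))
V-layer N J = subst (λ k → 1ℚ ≼ ι 39 ⊗ V (gs N (dyadic k k))) (ℕₚ.m+[n∸m]≡n (8≤K J)) (1≼39V N (K J ℕ.∸ 8))

e-small : ∀ r c {hs} → All Unit hs → sumℚ hs ≼ ι 3 → c ℕ.* 3 ℕ.^ r ℕ.≤ r ! → ι c ⊗ e r hs ≼ 1ℚ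
e-small r c {hs} us s≼3 le = ⊗-cancel (ι (3 ℕ.^ r)) (0≺ι (3 ℕ.^ r) {{ℕₚ.m^n≢0 3 r}}) (begin
  ι (3 ℕ.^ r) ⊗ (ι c ⊗ e r hs)    ≡⟨ ℚₚ.*-assoc (ι (3 ℕ.^ r)) (ι c) (e r hs) ⟨
  (ι (3 ℕ.^ r) ⊗ ι c) ⊗ e r hs    ≡⟨ cong (_⊗ e r hs) (trans (sym (ι-* (3 ℕ.^ r) c)) (cong ι (ℕₚ.*-comm (3 ℕ.^ r) c))) ⟩
  ι (c ℕ.* 3 ℕ.^ r) ⊗ e r hs      ≤⟨ ⊗-monoˡ (0≼e r us) (ι-mono le) ⟩
  ι (r !) ⊗ e r hs                ≤⟨ e-bound r us ⟩
  sumℚ hs ^ℚ r                    ≤⟨ ^ℚ-mono r (0≼sumℚ us) s≼3 ⟩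
  ι 3 ^ℚ r                        ≡⟨ ι-^ 3 r ⟨
  ι (3 ℕ.^ r)                     ≡⟨ ℚₚ.*-identityʳ (ι (3 ℕ.^ r)) ⟨
  ι (3 ℕ.^ r) ⊗ 1ℚ                ∎)
  where open ℚₚ.≤-Reasoning

sum-layer : ∀ N J → sumℚ (gs N (layer-ps J)) ≼ ι 3
sum-layer N J = ℚₚ.≤-trans (sum-gs≼ N (layer-ps J))
  (ℚₚ.≤-trans (sum-dyadic (K J) (K J) {{ℕ.>-nonZero (1≤K J)}}) (H-K J))

-- The omitted term is at most 3 ^ r / r!, and V ≥ 1/39 makes this absolute bound relative to `T`.
e-layer : ∀ N J i → ι (100 ℕ.* 2 ℕ.^ i) ⊗ e (suc (dbl (6 ℕ.+ i))) (gs N (layer-ps J)) ≼ T (dbl (6 ℕ.+ i)) (gs N (layer-ps J))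
e-layer N J i = ℚₚ.≤-trans (⊗-cancel (ι 39) (0≺ι 39) (begin
  ι 39 ⊗ (ι c ⊗ y)         ≡⟨ ℚₚ.*-assoc (ι 39) (ι c) y ⟨
  (ι 39 ⊗ ι c) ⊗ y         ≡⟨ cong (_⊗ y) (ι-* 39 c) ⟨
  ι (39 ℕ.* c) ⊗ y         ≤⟨ e-small (13 ℕ.+ dbl i) (39 ℕ.* c) (layer-unit N J) (sum-layer N J) (factorial-bound i) ⟩
  1ℚ                       ≤⟨ V-layer N J ⟩
  ι 39 ⊗ V (gs N (layer-ps J)) ∎)) (V≼T (6 ℕ.+ i) (layer-unit N J))
  where
  open ℚₚ.≤-Reasoning
  c = 100 ℕ.* 2 ℕ.^ i
  y = e (suc (dbl (6 ℕ.+ i))) (gs N (layer-ps J))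

0≼T-layer : ∀ N J b → 0ℚ ≼ T (dbl b) (gs N (layer-ps J))
0≼T-layer N J b = ℚₚ.≤-trans (0≼V (layer-unit N J)) (V≼T b (layer-unit N J))

-- The error term of the tower is 2 ^ level, up to a constant and the factor 2 ^ K of L.
level : ℕ → ℕ → ℕ
level zero    i = 0
level (suc J) i = K (suc J) ℕ.* dbl (6 ℕ.+ i) ℕ.+ level J (suc i)

-- Per unit of `K J` the cost c satisfies c(i) = 2 (6 + i) + c(i + 1) / 2, solved by 28 + 4 i. The
-- other summand on the left is the slack that later absorbs the constants.
level-closed : ∀ J i → level J i ℕ.+ (28 ℕ.+ 4 ℕ.* i ℕ.+ 4 ℕ.* J) ℕ.* 8 ≡ (28 ℕ.+ 4 ℕ.* i) ℕ.* K J
level-closed zero    i = eq i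
  where
  eq : ∀ i → (28 ℕ.+ 4 ℕ.* i ℕ.+ 0) ℕ.* 8 ≡ (28 ℕ.+ 4 ℕ.* i) ℕ.* 8
  eq = ℕS.solve-∀
level-closed (suc J) i = begin
  (k ℕ.+ k) ℕ.* dbl (6 ℕ.+ i) ℕ.+ level J (suc i) ℕ.+ (28 ℕ.+ 4 ℕ.* i ℕ.+ 4 ℕ.* suc J) ℕ.* 8
    ≡⟨ cong (λ x → (k ℕ.+ k) ℕ.* x ℕ.+ level J (suc i) ℕ.+ (28 ℕ.+ 4 ℕ.* i ℕ.+ 4 ℕ.* suc J) ℕ.* 8) (dbl≡ (6 ℕ.+ i)) ⟩
  (k ℕ.+ k) ℕ.* (2 ℕ.* (6 ℕ.+ i)) ℕ.+ level J (suc i) ℕ.+ (28 ℕ.+ 4 ℕ.* i ℕ.+ 4 ℕ.* suc J) ℕ.* 8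
    ≡⟨ eq k i (level J (suc i)) J ⟩
  (k ℕ.+ k) ℕ.* (2 ℕ.* (6 ℕ.+ i)) ℕ.+ (level J (suc i) ℕ.+ (28 ℕ.+ 4 ℕ.* suc i ℕ.+ 4 ℕ.* J) ℕ.* 8)
    ≡⟨ cong ((k ℕ.+ k) ℕ.* (2 ℕ.* (6 ℕ.+ i)) ℕ.+_) (level-closed J (suc i)) ⟩
  (k ℕ.+ k) ℕ.* (2 ℕ.* (6 ℕ.+ i)) ℕ.+ (28 ℕ.+ 4 ℕ.* suc i) ℕ.* k
    ≡⟨ eq₂ k i ⟩
  (28 ℕ.+ 4 ℕ.* i) ℕ.* (k ℕ.+ k) ∎
  where
  open ≡-Reasoning
  k = K J
  dbl≡ : ∀ b → dbl b ≡ 2 ℕ.* b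
  dbl≡ zero    = refl
  dbl≡ (suc b) = trans (cong (λ x → suc (suc x)) (dbl≡ b)) (lem b)
    where
    lem : ∀ b → suc (suc (2 ℕ.* b)) ≡ 2 ℕ.* suc b
    lem = ℕS.solve-∀
  eq : ∀ k i v J → (k ℕ.+ k) ℕ.* (2 ℕ.* (6 ℕ.+ i)) ℕ.+ v ℕ.+ (28 ℕ.+ 4 ℕ.* i ℕ.+ 4 ℕ.* suc J) ℕ.* 8
     ≡ (k ℕ.+ k) ℕ.* (2 ℕ.* (6 ℕ.+ i)) ℕ.+ (v ℕ.+ (28 ℕ.+ 4 ℕ.* suc i ℕ.+ 4 ℕ.* J) ℕ.* 8)
  eq = ℕS.solve-∀
  eq₂ : ∀ k i → (k ℕ.+ k) ℕ.* (2 ℕ.* (6 ℕ.+ i)) ℕ.+ (28 ℕ.+ 4 ℕ.* suc i) ℕ.* k ≡ (28 ℕ.+ 4 ℕ.* i) ℕ.* (k ℕ.+ k)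
  eq₂ = ℕS.solve-∀

module Tower {N : ℕ} (S : Sieve N (2 ℕ.^ 8)) (0≼w₀ : 0ℚ ≼ Sieve.w S) (l₀≡w₀ : Sieve.l S ≡ Sieve.w S)
  (νL₀≤νW₀ : Sieve.νL S ℕ.≤ Sieve.νW S) where
  open Sieve

  0≼w : ∀ J i → 0ℚ ≼ w (tower S J i)
  0≼w zero    i = 0≼w₀
  0≼w (suc J) i = 0≼⊗ (0≼T-layer N J (6 ℕ.+ i)) (0≼w J (suc i))

  -- Each layer reduces the mean by a factor of at most 39. As J is the logarithm of `K J` / 8, the
  -- total loss is polynomial in `K J`.
  w-lower : ∀ J i → w S ≼ ι (39 ℕ.^ J) ⊗ w (tower S J i)
  w-lower zero    i = ℚₚ.≤-reflexive (sym (trans (cong (_⊗ w S) ι-1) (ℚₚ.*-identityˡ (w S))))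
  w-lower (suc J) i = begin
    w S                                          ≤⟨ w-lower J (suc i) ⟩
    ι (39 ℕ.^ J) ⊗ w′                             ≡⟨ ℚₚ.*-identityˡ (ι (39 ℕ.^ J) ⊗ w′) ⟨
    1ℚ ⊗ (ι (39 ℕ.^ J) ⊗ w′)                      ≤⟨ ⊗-monoˡ (0≼⊗ (0≼ι (39 ℕ.^ J)) (0≼w J (suc i)))
                                                     (ℚₚ.≤-trans (V-layer N J) (⊗-monoʳ (0≼ι 39) (V≼T (6 ℕ.+ i) (layer-unit N J)))) ⟩
    (ι 39 ⊗ u) ⊗ (ι (39 ℕ.^ J) ⊗ w′)              ≡⟨ eq (ι 39) u (ι (39 ℕ.^ J)) w′ ⟩
    (ι 39 ⊗ ι (39 ℕ.^ J)) ⊗ (u ⊗ w′)              ≡⟨ cong (_⊗ (u ⊗ w′)) (ι-* 39 (39 ℕ.^ J)) ⟨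
    ι (39 ℕ.^ suc J) ⊗ (u ⊗ w′)                   ∎
    where
    open ℚₚ.≤-Reasoning
    w′ = w (tower S J (suc i))
    u = T (dbl (6 ℕ.+ i)) (gs N (layer-ps J))
    eq : ∀ a u b w → (a ⊗ u) ⊗ (b ⊗ w) ≡ (a ⊗ b) ⊗ (u ⊗ w)
    eq = solve-∀ ℚ-ring

  -- The relative loss is at most 2 / (100 · 2^i); a further layer costs half of that, and the
  -- layers below it, whose index is one larger, the other half.
  l-lower : ∀ J i → ι (100 ℕ.* 2 ℕ.^ i) ⊗ (w (tower S J i) ⊖ l (tower S J i)) ≼ ι 2 ⊗ w (tower S J i)
  l-lower zero    i = ℚₚ.≤-trans (ℚₚ.≤-reflexive (trans (cong (λ z → ι (100 ℕ.* 2 ℕ.^ i) ⊗ (w S ⊖ z)) l₀≡w₀) (eq (ι (100 ℕ.* 2 ℕ.^ i)) (w S)))) (0≼⊗ (0≼ι 2) (0≼w zero i))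
    where
    eq : ∀ a b → a ⊗ (b ⊖ b) ≡ 0ℚ
    eq = solve-∀ ℚ-ring
  l-lower (suc J) i = ⊗-cancel (ι 2) (0≺ι 2) (begin
    ι 2 ⊗ (c ⊗ (u ⊗ w′ ⊖ (u ⊗ l′ ⊖ y ⊗ w′)))              ≡⟨ eq (ι 2) c u w′ l′ y ⟩
    u ⊗ ((ι 2 ⊗ c) ⊗ (w′ ⊖ l′)) ⊕ (ι 2 ⊗ w′) ⊗ (c ⊗ y)     ≡⟨ cong (λ z → u ⊗ (z ⊗ (w′ ⊖ l′)) ⊕ (ι 2 ⊗ w′) ⊗ (c ⊗ y)) (trans (sym (ι-* 2 (100 ℕ.* 2 ℕ.^ i))) (cong ι (ℕeq (2 ℕ.^ i)))) ⟩
    u ⊗ (ι (100 ℕ.* 2 ℕ.^ suc i) ⊗ (w′ ⊖ l′)) ⊕ (ι 2 ⊗ w′) ⊗ (c ⊗ y)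
      ≤⟨ ℚₚ.+-mono-≤ (⊗-monoʳ (0≼T-layer N J (6 ℕ.+ i)) (l-lower J (suc i))) (⊗-monoʳ (0≼⊗ (0≼ι 2) (0≼w J (suc i))) (e-layer N J i)) ⟩
    u ⊗ (ι 2 ⊗ w′) ⊕ (ι 2 ⊗ w′) ⊗ u                        ≡⟨ eq₂ u (ι 2) w′ ⟩
    ι 2 ⊗ (u ⊗ w′) ⊕ ι 2 ⊗ (u ⊗ w′)                        ≡⟨ ι-2 (ι 2 ⊗ (u ⊗ w′)) ⟨
    ι 2 ⊗ (ι 2 ⊗ (u ⊗ w′))                                 ∎)
    where
    open ℚₚ.≤-Reasoning
    c = ι (100 ℕ.* 2 ℕ.^ i)
    w′ = w (tower S J (suc i))
    l′ = l (tower S J (suc i))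
    u = T (dbl (6 ℕ.+ i)) (gs N (layer-ps J))
    y = e (suc (dbl (6 ℕ.+ i))) (gs N (layer-ps J))
    eq : ∀ t c u w l y → t ⊗ (c ⊗ (u ⊗ w ⊖ (u ⊗ l ⊖ y ⊗ w))) ≡ u ⊗ ((t ⊗ c) ⊗ (w ⊖ l)) ⊕ (t ⊗ w) ⊗ (c ⊗ y)
    eq = solve-∀ ℚ-ring
    eq₂ : ∀ u t w → u ⊗ (t ⊗ w) ⊕ (t ⊗ w) ⊗ u ≡ t ⊗ (u ⊗ w) ⊕ t ⊗ (u ⊗ w)
    eq₂ = solve-∀ ℚ-ring
    ℕeq : ∀ x → 2 ℕ.* (100 ℕ.* x) ≡ 100 ℕ.* (2 ℕ.* x)
    ℕeq = ℕS.solve-∀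

  ν₀ : ℕ
  ν₀ = νW S

  2len : ∀ J → 1 ℕ.+ 2 ℕ.* length (layer-ps J) ℕ.≤ 2 ℕ.^ K (suc J)
  2len J = ℕₚ.≤-trans (ℕₚ.≤-reflexive (ℕₚ.+-comm 1 (2 ℕ.* length (layer-ps J))))
    (ℕₚ.≤-trans (ℕₚ.+-monoʳ-≤ (2 ℕ.* length (layer-ps J)) (ℕₚ.m^n>0 2 (K J)))
      (length-dyadic (K J) (K J) (ℕₚ.≤-trans (ℕₚ.≤ᵇ⇒≤ 4 8 _) (8≤K J))))

  power : ∀ J r → (1 ℕ.+ 2 ℕ.* length (layer-ps J)) ℕ.^ r ℕ.≤ 2 ℕ.^ (K (suc J) ℕ.* r)
  power J r = ℕₚ.≤-trans (ℕₚ.^-monoˡ-≤ r (2len J)) (ℕₚ.≤-reflexive (ℕₚ.^-*-assoc 2 (K (suc J)) r))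

  νW-upper : ∀ J i → νW (tower S J i) ℕ.≤ 2 ℕ.^ level J i ℕ.* ν₀
  νW-upper zero    i = ℕₚ.≤-reflexive (sym (ℕₚ.*-identityˡ ν₀))
  νW-upper (suc J) i = begin
    (1 ℕ.+ 2 ℕ.* length (layer-ps J)) ℕ.^ r ℕ.* νW (tower S J (suc i))
      ≤⟨ ℕₚ.*-mono-≤ (power J r) (νW-upper J (suc i)) ⟩
    2 ℕ.^ (K (suc J) ℕ.* r) ℕ.* (2 ℕ.^ level J (suc i) ℕ.* ν₀)
      ≡⟨ trans (sym (ℕₚ.*-assoc (2 ℕ.^ (K (suc J) ℕ.* r)) (2 ℕ.^ level J (suc i)) ν₀))
               (cong (ℕ._* ν₀) (sym (ℕₚ.^-distribˡ-+-* 2 (K (suc J) ℕ.* r) (level J (suc i))))) ⟩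
    2 ℕ.^ level (suc J) i ℕ.* ν₀ ∎
    where
    open ℕₚ.≤-Reasoning
    r = dbl (6 ℕ.+ i)

  -- The correction subtracted in `L` has one degree more than `W`, which costs a factor 2 ^ K of
  -- its own layer. The contributions of lower layers to this factor are dominated, since 2 · 2 ^ K
  -- ≤ 2 ^ (2 K).
  νL-upper : ∀ J i → νL (tower S J i) ℕ.≤ 2 ℕ.* 2 ℕ.^ K J ℕ.* (2 ℕ.^ level J i ℕ.* ν₀)
  νL-upper zero    i = ℕₚ.≤-trans (ℕₚ.≤-trans νL₀≤νW₀ (ℕₚ.≤-reflexive (sym (ℕₚ.*-identityˡ ν₀))))
    (ℕₚ.*-mono-≤ (ℕₚ.≤ᵇ⇒≤ 1 512 _) (ℕₚ.≤-reflexive (sym (ℕₚ.*-identityˡ ν₀))))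
  νL-upper (suc J) i = begin
    M ℕ.^ r ℕ.* νL (tower S J (suc i)) ℕ.+ M ℕ.* M ℕ.^ r ℕ.* νW (tower S J (suc i))
      ≤⟨ ℕₚ.+-mono-≤ (ℕₚ.*-mono-≤ (power J r) (νL-upper J (suc i)))
                     (ℕₚ.*-mono-≤ (ℕₚ.*-mono-≤ (2len J) (power J r)) (νW-upper J (suc i))) ⟩
    P ℕ.* (2 ℕ.* A ℕ.* (Q ℕ.* ν₀)) ℕ.+ 2 ℕ.^ K (suc J) ℕ.* P ℕ.* (Q ℕ.* ν₀)
      ≡⟨ eq P A Q ν₀ (2 ℕ.^ K (suc J)) ⟩
    (2 ℕ.* A ℕ.+ 2 ℕ.^ K (suc J)) ℕ.* ((P ℕ.* Q) ℕ.* ν₀)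
      ≤⟨ ℕₚ.*-monoˡ-≤ ((P ℕ.* Q) ℕ.* ν₀) (ℕₚ.+-monoˡ-≤ (2 ℕ.^ K (suc J)) 2A≤) ⟩
    (2 ℕ.^ K (suc J) ℕ.+ 2 ℕ.^ K (suc J)) ℕ.* ((P ℕ.* Q) ℕ.* ν₀)
      ≡⟨ cong₂ (λ x y → x ℕ.* (y ℕ.* ν₀)) (cong (2 ℕ.^ K (suc J) ℕ.+_) (sym (ℕₚ.+-identityʳ (2 ℕ.^ K (suc J)))))
               (sym (ℕₚ.^-distribˡ-+-* 2 (K (suc J) ℕ.* r) (level J (suc i)))) ⟩
    2 ℕ.* 2 ℕ.^ K (suc J) ℕ.* (2 ℕ.^ level (suc J) i ℕ.* ν₀) ∎
    where
    open ℕₚ.≤-Reasoning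
    r = dbl (6 ℕ.+ i)
    M = 1 ℕ.+ 2 ℕ.* length (layer-ps J)
    A = 2 ℕ.^ K J
    P = 2 ℕ.^ (K (suc J) ℕ.* r)
    Q = 2 ℕ.^ level J (suc i)
    eq : ∀ P A Q v B → P ℕ.* (2 ℕ.* A ℕ.* (Q ℕ.* v)) ℕ.+ B ℕ.* P ℕ.* (Q ℕ.* v) ≡ (2 ℕ.* A ℕ.+ B) ℕ.* ((P ℕ.* Q) ℕ.* v)
    eq = ℕS.solve-∀
    2A≤ : 2 ℕ.* A ℕ.≤ 2 ℕ.^ K (suc J)
    2A≤ = ℕₚ.^-monoʳ-≤ 2 (ℕₚ.+-monoˡ-≤ (K J) (1≤K J))

-- Counting prime factors

Ω-unique : ∀ {n fs} → n ≡ product fs → All Prime fs → Ω n ≡ length fs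
Ω-unique {zero}  {fs} eq ps = ⊥-elim (ℕ.≢-nonZero⁻¹ (product fs) {{productOfPrimes≢0 ps}} (sym eq))
Ω-unique {suc n} {fs} eq ps = ↭-length (factorisationUnique (factorise (suc n))
  (record { factors = fs ; isFactorisation = eq ; factorsPrime = ps }))

Ω-* : ∀ m n .{{_ : NonZero m}} .{{_ : NonZero n}} → Ω (m * n) ≡ Ω m + Ω n
Ω-* (suc m) (suc n) = trans
  (Ω-unique (trans (cong₂ _*_ (isFactorisation f) (isFactorisation f′)) (sym (product-++ (factors f) (factors f′))))
            (++⁺ (factorsPrime f) (factorsPrime f′)))
  (length-++ (factors f))
  where
  f = factorise (suc m)
  f′ = factorise (suc n)

Ω-prime : ∀ {p} → Prime p → Ω p ≡ 1
Ω-prime {p} pp = Ω-unique {fs = p ∷ []} (sym (ℕₚ.*-identityʳ p)) (pp ∷ [])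

factors-∣ : ∀ {fs a} → product fs ℕ∣.∣ a → All Prime fs → All (λ q → Prime q × q ℕ∣.∣ a) fs
factors-∣ d []       = []
factors-∣ {q ∷ fs} d (pp ∷ ps) = (pp , ℕ∣.∣-trans (ℕ∣.m∣m*n (product fs)) d) ∷ factors-∣ (ℕ∣.∣-trans (ℕ∣.n∣m*n q) d) ps

^-length≤ : ∀ {q fs} → All (q ≤_) fs → q ℕ.^ length fs ≤ product fs
^-length≤ []       = ℕₚ.≤-refl
^-length≤ (le ∷ as) = ℕₚ.*-mono-≤ le (^-length≤ as)

^-Ω≤ : ∀ q a .{{_ : NonZero a}} → (∀ p → Prime p → p ℕ∣.∣ a → q ≤ p) → q ℕ.^ Ω a ≤ a
^-Ω≤ q (suc a) h = ℕₚ.≤-trans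
  (^-length≤ (All.map (λ {p} (pp , d) → h p pp d) (factors-∣ (ℕ∣.∣-reflexive (sym (isFactorisation f))) (factorsPrime f))))
  (ℕₚ.≤-reflexive (sym (isFactorisation f)))
  where f = factorise (suc a)

Ω≤ : ∀ {q a} k .{{_ : NonZero a}} .{{_ : NonZero q}} → (∀ p → Prime p → p ℕ∣.∣ a → q ≤ p) → a < q ℕ.^ suc k → Ω a ≤ k
Ω≤ {q} {a} k h lt = ℕₚ.≮⇒≥ λ k<Ω → ℕₚ.<⇒≱ lt (ℕₚ.≤-trans (ℕₚ.^-monoʳ-≤ q k<Ω) (^-Ω≤ q a h))

odd-prime≥3 : ∀ {q a} → Prime q → q ℕ∣.∣ a → ¬ (2 ℕ∣.∣ a) → 3 ≤ q
odd-prime≥3 pq d odd = ℕₚ.≤∧≢⇒< (ℕ.nonTrivial⇒n>1 _ {{prime⇒nonTrivial pq}}) λ { refl → odd d }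

divisors : ℕ → List ℕ → ℕ
divisors a []       = 0
divisors a (p ∷ ps) = (if does (p ℕ∣.∣? a) then 1 else 0) + divisors a ps

divisors-yes : ∀ {a p} ps → p ℕ∣.∣ a → divisors a (p ∷ ps) ≡ suc (divisors a ps)
divisors-yes {a} {p} ps d = hit (p ℕ∣.∣? a)
  where
  hit : (e : Dec (p ℕ∣.∣ a)) → (if does e then 1 else 0) + divisors a ps ≡ suc (divisors a ps)
  hit (yes _) = refl
  hit (no ¬d) = ⊥-elim (¬d d)

divisors-∷ : ∀ a p ps → divisors a ps ≤ divisors a (p ∷ ps)
divisors-∷ a p ps = ℕₚ.m≤n+m (divisors a ps) (if does (p ℕ∣.∣? a) then 1 else 0)

divisors-mono : ∀ {a b} ps → a ℕ∣.∣ b → divisors a ps ≤ divisors b ps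
divisors-mono         []       d = ℕ.z≤n
divisors-mono {a} {b} (p ∷ ps) d = ℕₚ.+-mono-≤ (step (p ℕ∣.∣? a) (p ℕ∣.∣? b)) (divisors-mono ps d)
  where
  step : (x : Dec (p ℕ∣.∣ a)) (y : Dec (p ℕ∣.∣ b)) → (if does x then 1 else 0) ≤ (if does y then 1 else 0)
  step (yes p∣a) (yes _)  = ℕₚ.≤-refl
  step (yes p∣a) (no ¬d)  = ⊥-elim (¬d (ℕ∣.∣-trans p∣a d))
  step (no _)    y        = ℕ.z≤n

-- Strip the primes of ps, none of which divides a twice; what remains has only prime factors ≥ Y,
-- and at most one of them.
Ω≤divisors : ∀ {Y a} ps .{{_ : NonZero Y}} .{{_ : NonZero a}} → All Prime ps → a < Y ℕ.^ 2 → All (λ p → ¬ (p * p ℕ∣.∣ a)) ps →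
  (∀ q → Prime q → q ℕ∣.∣ a → q ∈ ps ⊎ Y ≤ q) → Ω a ≤ suc (divisors a ps)
Ω≤divisors {Y} [] [] lt [] h = Ω≤ 1 (λ q pq d → [ (λ ()) , (λ le → le) ]′ (h q pq d)) lt
Ω≤divisors {Y} {a} (p ∷ ps) {{y≢0}} {{a≢0}} (pp ∷ pps) lt (sq ∷ sqs) h = by-cases (p ℕ∣.∣? a)
  where
  by-cases : Dec (p ℕ∣.∣ a) → Ω a ≤ suc (divisors a (p ∷ ps))
  by-cases (no ¬d) = ℕₚ.≤-trans (Ω≤divisors ps pps lt sqs h′) (ℕ.s≤s (divisors-∷ a p ps))
    where
    h′ : ∀ q → Prime q → q ℕ∣.∣ a → q ∈ ps ⊎ Y ≤ q
    h′ q pq d with h q pq d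
    ... | inj₁ (here refl) = ⊥-elim (¬d d)
    ... | inj₁ (there i)   = inj₁ i
    ... | inj₂ le          = inj₂ le
  by-cases (yes p∣a@(ℕ∣.divides-refl b)) = begin
    Ω (b * p)                  ≡⟨ Ω-* b p {{b≢0}} {{prime⇒nonZero pp}} ⟩
    Ω b + Ω p                  ≡⟨ cong (λ z → Ω b + z) (Ω-prime pp) ⟩
    Ω b + 1                    ≡⟨ ℕₚ.+-comm (Ω b) 1 ⟩
    suc (Ω b)                  ≤⟨ ℕ.s≤s (Ω≤divisors ps {{y≢0}} {{b≢0}} pps (ℕₚ.≤-<-trans (ℕ∣.∣⇒≤ {{a≢0}} (ℕ∣.m∣m*n p)) lt)
                                    (All.map (λ ¬sq d → ¬sq (ℕ∣.∣-trans d (ℕ∣.m∣m*n p))) sqs) h′) ⟩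
    suc (suc (divisors b ps))  ≤⟨ ℕ.s≤s (ℕ.s≤s (divisors-mono ps (ℕ∣.m∣m*n p))) ⟩
    suc (suc (divisors (b * p) ps)) ≡⟨ cong suc (divisors-yes ps p∣a) ⟨
    suc (divisors (b * p) (p ∷ ps)) ∎
    where
    open ℕₚ.≤-Reasoning
    b≢0 : NonZero b
    b≢0 = ℕₚ.m*n≢0⇒m≢0 b {p} {{a≢0}}
    h′ : ∀ q → Prime q → q ℕ∣.∣ b → q ∈ ps ⊎ Y ≤ q
    h′ q pq d with h q pq (ℕ∣.∣-trans d (ℕ∣.m∣m*n p))
    ... | inj₁ (here refl) = ⊥-elim (sq (ℕ∣.*-monoˡ-∣ p d))
    ... | inj₁ (there i)   = inj₁ i
    ... | inj₂ le          = inj₂ le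

-- The weighted count

-- Unlike in `E`, both classes count even when they coincide: a prime dividing N and t contributes
-- to Ω of t and of N - t.
both : ℕ → ℕ → ℕ → ℚ
both N q t = cls q (+ 0) t ⊕ cls q (+ N) t

penalty : ℕ → ℕ → ℕ → ℚ
penalty N p t = both N p t ⊕ ι 19 ⊗ both N (p ℕ.* p) t

0≼both : ∀ N q t → 0ℚ ≼ both N q t
0≼both N q t = 0≼⊕ (proj₁ (cls-unit q (+ 0) t)) (proj₁ (cls-unit q (+ N) t))

0≼penalty : ∀ N p t → 0ℚ ≼ penalty N p t
0≼penalty N p t = 0≼⊕ (0≼both N p t) (0≼⊗ (0≼ι 19) (0≼both N (p ℕ.* p) t))

penalties : ℕ → List ℕ → ℕ → ℚ
penalties N ps t = sumOver (λ p → penalty N p t) ps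

0≼penalties : ∀ N ps t → 0ℚ ≼ penalties N ps t
0≼penalties N []       t = ℚₚ.≤-refl
0≼penalties N (p ∷ ps) t = 0≼⊕ (0≼penalty N p t) (0≼penalties N ps t)

penalty≼penalties : ∀ {N p ps} t → p ∈ ps → penalty N p t ≼ penalties N ps t
penalty≼penalties {N} {p} {ps = p ∷ ps} t (here refl) = ≼-diff (0≼penalties N ps t) refl
penalty≼penalties {N} {p} {ps = q ∷ ps} t (there i)   = ℚₚ.≤-trans (penalty≼penalties {N} {p} {ps} t i)
  (≼-diff (0≼penalty N q t) (ℚₚ.+-comm (penalty N q t) (penalties N ps t)))

square-penalty : ∀ {N p t} → t ℕ.≤ N → p ℕ.* p ℕ∣.∣ t ⊎ p ℕ.* p ℕ∣.∣ N ℕ.∸ t → ι 19 ≼ penalty N p t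
square-penalty {N} {p} {t} t≤N h = ℚₚ.≤-trans
  (ℚₚ.≤-trans (ℚₚ.≤-reflexive (sym (ℚₚ.*-identityʳ (ι 19)))) (⊗-monoʳ (0≼ι 19) (one h)))
  (≼-diff (0≼both N p t) (ℚₚ.+-comm (both N p t) (ι 19 ⊗ both N (p ℕ.* p) t)))
  where
  one : p ℕ.* p ℕ∣.∣ t ⊎ p ℕ.* p ℕ∣.∣ N ℕ.∸ t → 1ℚ ≼ both N (p ℕ.* p) t
  one (inj₁ d) = ≼-diff (proj₁ (cls-unit (p ℕ.* p) (+ N) t)) (cong (_⊕ cls (p ℕ.* p) (+ N) t) (cls-0 d))
  one (inj₂ d) = ≼-diff (proj₁ (cls-unit (p ℕ.* p) (+ 0) t))
    (trans (cong (cls (p ℕ.* p) (+ 0) t ⊕_) (cls-N t≤N d)) (ℚₚ.+-comm (cls (p ℕ.* p) (+ 0) t) 1ℚ))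

divisors≼penalties : ∀ {N t} ps → t ℕ.≤ N → ι (divisors t ps) ⊕ ι (divisors (N ℕ.∸ t) ps) ≼ penalties N ps t
divisors≼penalties []           t≤N = ℚₚ.≤-reflexive (cong₂ _⊕_ ι-0 ι-0)
divisors≼penalties {N} {t} (p ∷ ps) t≤N = begin
  ι (a ℕ.+ divisors t ps) ⊕ ι (b ℕ.+ divisors (N ℕ.∸ t) ps)
    ≡⟨ cong₂ _⊕_ (ι-+ a (divisors t ps)) (ι-+ b (divisors (N ℕ.∸ t) ps)) ⟩
  (ι a ⊕ ι (divisors t ps)) ⊕ (ι b ⊕ ι (divisors (N ℕ.∸ t) ps))
    ≡⟨ ⊕-interchange (ι a) (ι (divisors t ps)) (ι b) (ι (divisors (N ℕ.∸ t) ps)) ⟩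
  (ι a ⊕ ι b) ⊕ (ι (divisors t ps) ⊕ ι (divisors (N ℕ.∸ t) ps))
    ≤⟨ ℚₚ.+-mono-≤ (ℚₚ.+-mono-≤ (bound (p ℕ∣.∣? t) cls-0 (proj₁ (cls-unit p (+ 0) t))) (bound (p ℕ∣.∣? (N ℕ.∸ t)) (cls-N t≤N) (proj₁ (cls-unit p (+ N) t))))
                   (divisors≼penalties ps t≤N) ⟩
  both N p t ⊕ penalties N ps t
    ≤⟨ ℚₚ.+-monoˡ-≤ (penalties N ps t) (≼-diff {both N p t} {penalty N p t} (0≼⊗ (0≼ι 19) (0≼both N (p ℕ.* p) t)) refl) ⟩
  penalties N (p ∷ ps) t ∎
  where
  open ℚₚ.≤-Reasoning
  a = if does (p ℕ∣.∣? t) then 1 else 0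
  b = if does (p ℕ∣.∣? (N ℕ.∸ t)) then 1 else 0
  bound : ∀ {P : Set} {x} (d : Dec P) → (P → x ≡ 1ℚ) → 0ℚ ≼ x → ι (if does d then 1 else 0) ≼ x
  bound (yes d) h 0≼x = ℚₚ.≤-reflexive (trans ι-1 (sym (h d)))
  bound (no _)  h 0≼x = ℚₚ.≤-trans (ℚₚ.≤-reflexive ι-0) 0≼x

coprime-square : ∀ {D p} → Coprime D p → Coprime D (p ℕ.* p)
coprime-square {D} {p} c (d∣D , d∣pp) = c (d∣D , coprime-divisor (λ (a , b) → c (ℕ∣.∣-trans a d∣D , b)) d∣pp)

approx-both : ∀ {N D q f μ ν} .{{_ : NonZero q}} → Coprime D q → Approx N (D ℕ.* q) f μ ν →
  Approx N D (λ t → both N q t ⊗ f t) ((inv q ⊕ inv q) ⊗ μ) (ν ℕ.+ ν)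
approx-both {N} {D} {q} {f} {μ} c a = approx-ext
  (λ t → sym (ℚₚ.*-distribʳ-+ (f t) (cls q (+ 0) t) (cls q (+ N) t)))
  (approx-≡ (sym (ℚₚ.*-distribʳ-+ μ (inv q) (inv q))) (approx-⊕ (approx-cls c (+ 0) a) (approx-cls c (+ N) a)))

-- As p exceeds the level z of f, both D p and D p² are admissible for f. The two classes modulo p
-- and the 19 times two modulo p² give 2 + 38 = 40.
approx-penalty : ∀ {N z y D p f μ ν} → Allowed y D → Prime p → 3 ℕ.≤ p → z ℕ.< p → p ℕ.≤ y → Good N z f μ ν →
  Approx N D (λ t → penalty N p t ⊗ f t) (weight p ⊗ μ) (40 ℕ.* ν)
approx-penalty {N} {z} {y} {D} {p} {f} {μ} {ν} a pp 3≤p z<p p≤y good = approx-ext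
  (λ t → eq (both N p t) (ι 19) (both N (p ℕ.* p) t) (f t))
  (approx-≡ (eq (inv p ⊕ inv p) (ι 19) (inv (p ℕ.* p) ⊕ inv (p ℕ.* p)) μ)
    (approx-≤ (ℕₚ.≤-reflexive (ℕeq ν))
      (approx-⊕ (approx-both {{p≢0}} c (good (D ℕ.* p) al))
                (approx-⊗ 19 (approx-both {{ℕₚ.m*n≢0 p p {{p≢0}} {{p≢0}}}} (coprime-square c)
                  (subst (λ E → Approx N E f μ ν) (ℕₚ.*-assoc D p p) (good (D ℕ.* p ℕ.* p) (allowed-* pp z<p al))))))))
  where
  p≢0 = prime⇒nonZero pp
  c : Coprime D p
  c = prime-coprime pp (proj₂ a p pp 3≤p p≤y)
  al : Allowed z (D ℕ.* p)
  al = allowed-* pp z<p (allowed-mono (ℕₚ.≤-trans (ℕₚ.<⇒≤ z<p) p≤y) a)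
  eq : ∀ b n c f → b ⊗ f ⊕ n ⊗ (c ⊗ f) ≡ (b ⊕ n ⊗ c) ⊗ f
  eq = solve-∀ ℚ-ring
  ℕeq : ∀ v → v ℕ.+ v ℕ.+ 19 ℕ.* (v ℕ.+ v) ≡ 40 ℕ.* v
  ℕeq = ℕS.solve-∀

-- The penalties are added, not multiplied, so every prime is combined with the same f and the error
-- grows only linearly in their number.
approx-penalties : ∀ {N z x y D ps f μ ν} → Allowed y D → x ℕ.≤ y → Chain z x ps → Good N z f μ ν →
  Approx N D (λ t → penalties N ps t ⊗ f t) (sumOver weight ps ⊗ μ) (length ps ℕ.* (40 ℕ.* ν))
approx-penalties {D = D} {f = f} {μ} a x≤y (done z≤x) good = approx-ext (λ t → cong (_⊗ f t) ι-0)
  (approx-≡ (cong (_⊗ μ) ι-0) (approx-⊗ 0 (good D (allowed-mono (ℕₚ.≤-trans z≤x x≤y) a))))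
approx-penalties {N} {f = f} {μ} a x≤y (cons {p} {x′} {_} {ps} pp 3≤p x′<p p≤x c) good = approx-ext
  (λ t → sym (ℚₚ.*-distribʳ-+ (f t) (penalty N p t) (penalties N ps t)))
  (approx-≡ (sym (ℚₚ.*-distribʳ-+ μ (weight p) (sumOver weight ps)))
    (approx-⊕ (approx-penalty a pp 3≤p (ℕₚ.≤-<-trans (chain-≤ c) x′<p) (ℕₚ.≤-trans p≤x x≤y) good)
              (approx-penalties a (ℕₚ.≤-trans (ℕₚ.<⇒≤ x′<p) (ℕₚ.≤-trans p≤x x≤y)) c good)))

approx-positive : ∀ {N D f μ ν} .{{_ : NonZero D}} → Approx N D f μ ν → ι (ν ℕ.* D) ≺ μ ⊗ ι N →
  ∀ x → ∃[ t ] (t ℕ.< N × + D ∣ (+ t ℤ.- x) × 0ℚ ≺ f t)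
approx-positive {N} {D} {f} {μ} {ν} a lt x = let t , t<N , pos = ∃-positive N (λ t → cls D x t ⊗ f t) 0≺S in t , t<N , split (+ D ∣? (+ t ℤ.- x)) pos
  where
  S = sumTo N (λ t → cls D x t ⊗ f t)
  0≺DS : 0ℚ ≺ ι D ⊗ S
  0≺DS = subst₂ _≺_ (ℚₚ.+-inverseʳ c) (eq (ι D ⊗ S) c)
    (ℚₚ.+-monoˡ-< (⊝ c) (ℚₚ.<-≤-trans (subst (_≺ μ ⊗ ι N) (ι-* ν D) lt) (proj₂ (Approx.near a x))))
    where
    c = ι ν ⊗ ι D
    eq : ∀ a c → (a ⊕ c) ⊖ c ≡ a
    eq = solve-∀ ℚ-ring
  0≺S : 0ℚ ≺ S
  0≺S = ℚₚ.≰⇒> λ S≼0 → ℚₚ.<-irrefl refl (ℚₚ.<-≤-trans 0≺DS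
    (ℚₚ.≤-trans (⊗-monoʳ (0≼ι D) S≼0) (ℚₚ.≤-reflexive (ℚₚ.*-zeroʳ (ι D)))))
  split : ∀ {P : Set} {y} (d : Dec P) → 0ℚ ≺ ind d ⊗ y → P × 0ℚ ≺ y
  split {y = y} (yes p) pos = p , subst (0ℚ ≺_) (ℚₚ.*-identityˡ y) pos
  split {y = y} (no ¬p) pos = ⊥-elim (ℚₚ.<-irrefl (sym (ℚₚ.*-zeroˡ y)) pos)

-- What the sieve yields: a splitting N = t + (N - t) in a given residue class in which the only
-- odd prime factors are the primes of ps and larger ones, with ps contributing at most 18.
record Split (N z D : ℕ) (x : ℤ) (ps : List ℕ) : Set where
  field
    t          : ℕ
    t<N        : t ℕ.< N
    class      : + D ∣ (+ t ℤ.- x)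
    sifted     : ∀ p → Prime p → 3 ℕ.≤ p → p ℕ.≤ z → ¬ (p ℕ∣.∣ t ⊎ p ℕ∣.∣ N ℕ.∸ t)
    few        : divisors t ps ℕ.+ divisors (N ℕ.∸ t) ps ℕ.≤ 18
    squarefree : ∀ p → p ∈ ps → ¬ (p ℕ.* p ℕ∣.∣ t ⊎ p ℕ.* p ℕ∣.∣ N ℕ.∸ t)

-- For the total penalty M ≥ 0, (19 - M) X ≥ 19 L - M W > 0 at some t. As X ≥ 0, this gives both X ≠
-- 0 and M < 19; a single square divisor would already make M ≥ 19.
split : ∀ {N z y D ps} (S : Sieve N z) → Chain z y ps → (a : Allowed y D) →
  let open Sieve S in
  ι ((19 ℕ.* νL ℕ.+ length ps ℕ.* (40 ℕ.* νW)) ℕ.* D) ≺ (ι 19 ⊗ l ⊖ sumOver weight ps ⊗ w) ⊗ ι N →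
  ∀ x → Split N z D x ps
split {N} {z} {y} {D} {ps} S c a lt x = conclude
  (approx-positive {{proj₁ a}} (approx-⊕ (approx-⊗ 19 (good-L D (allowed-mono (chain-≤ c) a))) (approx-⊝ {f = λ t → penalties N ps t ⊗ W t} (approx-penalties a ℕₚ.≤-refl c good-W))) lt x)
  where
  open Sieve S
  conclude : ∃[ t ] (t ℕ.< N × + D ∣ (+ t ℤ.- x) × 0ℚ ≺ ι 19 ⊗ L t ⊖ penalties N ps t ⊗ W t) → Split N z D x ps
  conclude (t , t<N , class , pos) = record
    { t = t ; t<N = t<N ; class = class
    ; sifted = λ p pp 3≤p p≤z → Sieve.sifted S t≤N X≢0 p pp 3≤p p≤z
    ; few = ℕ.s≤s⁻¹ (ι-cancel-< (subst (_≺ ι 19) (sym (ι-+ (divisors t ps) (divisors (N ℕ.∸ t) ps))) (ℚₚ.≤-<-trans (divisors≼penalties ps t≤N) M<19)))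
    ; squarefree = λ p i sq → ℚₚ.<-irrefl refl (ℚₚ.≤-<-trans (ℚₚ.≤-trans (square-penalty {N} {p} {t} t≤N sq) (penalty≼penalties {N} {p} {ps} t i)) M<19)
    }
    where
    t≤N = ℕₚ.<⇒≤ t<N
    M = penalties N ps t
    posX : 0ℚ ≺ (ι 19 ⊖ M) ⊗ X t
    posX = ℚₚ.<-≤-trans pos (≼-diff
      (0≼⊕ (0≼⊗ (0≼ι 19) (0≼⊖ (L≼X t))) (0≼⊗ (0≼penalties N ps t) (0≼⊖ (X≼W t))))
      (eq (ι 19) M (L t) (X t) (W t)))
      where
      eq : ∀ n m l x w → (n ⊖ m) ⊗ x ≡ (n ⊗ l ⊖ m ⊗ w) ⊕ (n ⊗ (x ⊖ l) ⊕ m ⊗ (w ⊖ x))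
      eq = solve-∀ ℚ-ring
    X≢0 : ¬ (X t ≡ 0ℚ)
    X≢0 X≡0 = ℚₚ.<-irrefl (sym (trans (cong ((ι 19 ⊖ M) ⊗_) X≡0) (ℚₚ.*-zeroʳ (ι 19 ⊖ M)))) posX
    M<19 : M ≺ ι 19
    M<19 = ℚₚ.≰⇒> λ 19≼M → ℚₚ.<-irrefl refl (ℚₚ.<-≤-trans posX
      (≼-diff (0≼⊗ (0≼⊖ 19≼M) (0≼X t)) (eq (ι 19) M (X t))))
      where
      eq : ∀ n m x → 0ℚ ≡ (n ⊖ m) ⊗ x ⊕ (m ⊖ n) ⊗ x
      eq = solve-∀ ℚ-ring

-- Numerical verification

-- Each factor 1 - g is at least (p - 2) / p. Cleared of denominators, this turns the lower bound
-- for a base sieve into a comparison of natural numbers.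
V-product : ∀ N {z y ps} → Chain z y ps → ι (product (map (ℕ._∸ 2) ps)) ≼ V (gs N ps) ⊗ ι (product ps)
V-product N (done _) = ℚₚ.≤-reflexive (sym (ℚₚ.*-identityˡ (ι 1)))
V-product N {ps = p ∷ ps} (cons pp 3≤p _ _ c) = begin
  ι ((p ℕ.∸ 2) * Q)                          ≡⟨ ι-* (p ℕ.∸ 2) Q ⟩
  ι (p ℕ.∸ 2) ⊗ ι Q                          ≤⟨ ⊗-mono (0≼ι Q) 0≼rhs factor (V-product N c) ⟩
  ((1ℚ ⊖ g N p) ⊗ ι p) ⊗ (v ⊗ ι P)           ≡⟨ eq (g N p) (ι p) v (ι P) ⟩
  (v ⊖ g N p ⊗ v) ⊗ (ι p ⊗ ι P)              ≡⟨ cong ((v ⊖ g N p ⊗ v) ⊗_) (ι-* p P) ⟨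
  V (gs N (p ∷ ps)) ⊗ ι (p * P)              ∎
  where
  open ℚₚ.≤-Reasoning
  P = product ps
  Q = product (map (ℕ._∸ 2) ps)
  v = V (gs N ps)
  p≢0 : NonZero p
  p≢0 = ℕ.>-nonZero (ℕₚ.<-≤-trans (ℕ.s≤s ℕ.z≤n) 3≤p)
  0≼rhs : 0ℚ ≼ (1ℚ ⊖ g N p) ⊗ ι p
  0≼rhs = 0≼⊗ (0≼⊖ (proj₂ (g-unit N p 3≤p))) (0≼ι p)
  eq : ∀ g p v P → ((1ℚ ⊖ g) ⊗ p) ⊗ (v ⊗ P) ≡ (v ⊖ g ⊗ v) ⊗ (p ⊗ P)
  eq = solve-∀ ℚ-ring
  factor : ι (p ℕ.∸ 2) ≼ (1ℚ ⊖ g N p) ⊗ ι p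
  factor = ≼-diff (0≼⊗ (0≼⊖ (proj₂ (g-bounds N p))) (0≼ι p)) (begin-equality
    (1ℚ ⊖ g N p) ⊗ ι p
      ≡⟨ eq₁ (g N p) (inv p) (ι p) ⟩
    (ι p ⊖ (ι p ⊗ inv p ⊕ ι p ⊗ inv p)) ⊕ ((inv p ⊕ inv p) ⊖ g N p) ⊗ ι p
      ≡⟨ cong₂ (λ x y → (x ⊖ (y ⊕ y)) ⊕ ((inv p ⊕ inv p) ⊖ g N p) ⊗ ι p)
           (trans (cong ι (sym (ℕₚ.m∸n+n≡m (ℕₚ.≤-trans (ℕₚ.n≤1+n 2) 3≤p)))) (trans (ι-+ (p ℕ.∸ 2) 2) (cong (ι (p ℕ.∸ 2) ⊕_) (trans (ι-+ 1 1) (cong₂ _⊕_ ι-1 ι-1)))))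
           (ι⊗inv p {{p≢0}}) ⟩
    ((ι (p ℕ.∸ 2) ⊕ (1ℚ ⊕ 1ℚ)) ⊖ (1ℚ ⊕ 1ℚ)) ⊕ ((inv p ⊕ inv p) ⊖ g N p) ⊗ ι p
      ≡⟨ eq₂ (ι (p ℕ.∸ 2)) 1ℚ (((inv p ⊕ inv p) ⊖ g N p) ⊗ ι p) ⟩
    ι (p ℕ.∸ 2) ⊕ ((inv p ⊕ inv p) ⊖ g N p) ⊗ ι p ∎)
    where
    eq₁ : ∀ g i p → (1ℚ ⊖ g) ⊗ p ≡ (p ⊖ (p ⊗ i ⊕ p ⊗ i)) ⊕ ((i ⊕ i) ⊖ g) ⊗ p
    eq₁ = solve-∀ ℚ-ring
    eq₂ : ∀ a o b → ((a ⊕ (o ⊕ o)) ⊖ (o ⊕ o)) ⊕ b ≡ a ⊕ b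
    eq₂ = solve-∀ ℚ-ring

1≼V : ∀ N {z y ps} c → Chain z y ps → .{{_ : NonZero (product ps)}} → product ps ≤ c * product (map (ℕ._∸ 2) ps) → 1ℚ ≼ ι c ⊗ V (gs N ps)
1≼V N {ps = ps} c ch le = ⊗-cancel (ι P) (0≺ι P) (begin
  ι P ⊗ 1ℚ                   ≡⟨ ℚₚ.*-identityʳ (ι P) ⟩
  ι P                        ≤⟨ ι-mono le ⟩
  ι (c * Q)                  ≡⟨ ι-* c Q ⟩
  ι c ⊗ ι Q                  ≤⟨ ⊗-monoʳ (0≼ι c) (V-product N ch) ⟩
  ι c ⊗ (v ⊗ ι P)            ≡⟨ eq (ι c) v (ι P) ⟩
  ι P ⊗ (ι c ⊗ v)            ∎)
  where
  open ℚₚ.≤-Reasoning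
  P = product ps
  Q = product (map (ℕ._∸ 2) ps)
  v = V (gs N ps)
  eq : ∀ c v p → c ⊗ (v ⊗ p) ≡ p ⊗ (c ⊗ v)
  eq = solve-∀ ℚ-ring

-- Main term against error, and the choice of parameters

main-term-wins : ∀ {X N μ} c Q .{{_ : NonZero Q}} → ι c ≼ ι Q ⊗ μ → Q * X < c * N → ι X ≺ μ ⊗ ι N
main-term-wins {X} {N} {μ} c Q le lt = ℚₚ.≰⇒> λ μN≼X → ℚₚ.<-irrefl refl (ℚₚ.<-≤-trans (ι-mono-< lt) (begin
  ι (c * N)             ≡⟨ ι-* c N ⟩
  ι c ⊗ ι N             ≤⟨ ⊗-monoˡ (0≼ι N) le ⟩
  (ι Q ⊗ μ) ⊗ ι N       ≡⟨ ℚₚ.*-assoc (ι Q) μ (ι N) ⟩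
  ι Q ⊗ (μ ⊗ ι N)       ≤⟨ ⊗-monoʳ (0≼ι Q) μN≼X ⟩
  ι Q ⊗ ι X             ≡⟨ ι-* Q X ⟨
  ι (Q * X)             ∎))
  where open ℚₚ.≤-Reasoning

ι-inv≼ : ∀ a b n .{{_ : NonZero n}} → a ≤ b * n → ι a ⊗ inv n ≼ ι b
ι-inv≼ a b n le = begin
  ι a ⊗ inv n               ≤⟨ ⊗-monoˡ (0≼inv n) (ι-mono le) ⟩
  ι (b * n) ⊗ inv n         ≡⟨ cong (_⊗ inv n) (ι-* b n) ⟩
  (ι b ⊗ ι n) ⊗ inv n       ≡⟨ ℚₚ.*-assoc (ι b) (ι n) (inv n) ⟩
  ι b ⊗ (ι n ⊗ inv n)       ≡⟨ cong (ι b ⊗_) (ι⊗inv n) ⟩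
  ι b ⊗ 1ℚ                  ≡⟨ ℚₚ.*-identityʳ (ι b) ⟩
  ι b                       ∎
  where open ℚₚ.≤-Reasoning

4^≡ : ∀ k → 4 ℕ.^ k ≡ 2 ℕ.^ k * 2 ℕ.^ k
4^≡ k = trans (ℕₚ.^-*-assoc 2 2 k) (trans (cong (λ j → 2 ℕ.^ (k + j)) (ℕₚ.+-identityʳ k)) (ℕₚ.^-distribˡ-+-* 2 k k))

length≤2^ : ∀ K d m → 4 ≤ K → K + d ≡ suc m → length (dyadic K d) ≤ 2 ℕ.^ m
length≤2^ K d m 4≤K eq = ℕₚ.*-cancelˡ-≤ 2 (ℕₚ.≤-trans (ℕₚ.m≤m+n (2 * length (dyadic K d)) (2 ℕ.^ K))
  (ℕₚ.≤-trans (length-dyadic K d 4≤K) (ℕₚ.≤-reflexive (cong (2 ℕ.^_) eq))))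

Splits : ℕ → ℕ → ℕ → ℤ → Set
Splits N m D x = ∃[ K ] ∃[ d ] (1 ≤ K × K + d ≡ suc m × Split N (2 ℕ.^ K) D x (dyadic K d))

-- With M = 2 ^ m the worst case is 1760 ν M + 836 ν, where 1760 = 11 · 40 · 4 and 836 = 11 · 19 ·
-- 4. The lower-order part is absorbed by 4 M.
medium-error : ∀ {M len νL νW D N} ν c → ν * 836 < M * 4 → ν * 1760 + 4 ≤ c * M → len ≤ M → νL ≤ ν → νW ≤ ν → D ≤ 4 → M * M ≤ N →
  11 * ((19 * νL + len * (40 * νW)) * D) < c * N
medium-error {M} {len} {νL} {νW} {D} {N} ν c M-large c-large len≤ νL≤ νW≤ D≤4 M²≤N = begin-strict
  11 * ((19 * νL + len * (40 * νW)) * D)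
    ≤⟨ ℕₚ.*-monoʳ-≤ 11 (ℕₚ.*-mono-≤ (ℕₚ.+-mono-≤ (ℕₚ.*-monoʳ-≤ 19 νL≤) (ℕₚ.*-mono-≤ len≤ (ℕₚ.*-monoʳ-≤ 40 νW≤))) D≤4) ⟩
  11 * ((19 * ν + M * (40 * ν)) * 4)   ≡⟨ eq ν M ⟩
  M * (ν * 1760) + ν * 836             <⟨ ℕₚ.+-monoʳ-< (M * (ν * 1760)) M-large ⟩
  M * (ν * 1760) + M * 4               ≡⟨ ℕₚ.*-distribˡ-+ M (ν * 1760) 4 ⟨
  M * (ν * 1760 + 4)                   ≤⟨ ℕₚ.*-monoʳ-≤ M c-large ⟩
  M * (c * M)                          ≡⟨ eq₂ M c ⟩
  c * (M * M)                          ≤⟨ ℕₚ.*-monoʳ-≤ c M²≤N ⟩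
  c * N                                ∎
  where
  open ℕₚ.≤-Reasoning
  eq : ∀ v M → 11 * ((19 * v + M * (40 * v)) * 4) ≡ M * (v * 1760) + v * 836
  eq = ℕS.solve-∀
  eq₂ : ∀ M c → M * (c * M) ≡ c * (M * M)
  eq₂ = ℕS.solve-∀

-- The hypothesis on a and c is 80 (c + 31 a / 10 + 19 / 8) ≤ 80 · 19, where 31 a / 10 + 19 / 8 bounds the
-- sum of the weights over the primes of (2 ^ 4 , 2 ^ (4 · 2 ^ a)].
split-medium : ∀ {N m D} (S : Sieve N (2 ℕ.^ 4)) → Sieve.l S ≡ Sieve.w S → 1ℚ ≼ ι 11 ⊗ Sieve.w S → Sieve.νL S ≤ 243 → Sieve.νW S ≤ 243 →
  ∀ a c x → 16 ≤ m → 427684 ≤ c * 2 ℕ.^ m → suc m ≤ 4 * 2 ℕ.^ a →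
  80 * c + (a * 8 * 31 + 190) ≤ 80 * 19 →
  4 ℕ.^ m ≤ N → D ≤ 4 → Allowed (2 ℕ.^ suc m) D → Splits N m D x
split-medium {N} {m} {D} S l≡w 11v νL≤ νW≤ a c x 16≤m c-large m≤ numeric 4^m≤N D≤4 al =
  4 , d , ℕ.s≤s ℕ.z≤n , eqm , split S (subst (λ j → Chain (2 ℕ.^ 4) (2 ℕ.^ j) ps) eqm (chain-dyadic 4 d (ℕ.s≤s ℕ.z≤n))) al
    (main-term-wins c 11 (subst (λ z → ι c ≼ ι 11 ⊗ (ι 19 ⊗ z ⊖ wt ⊗ w)) (sym l≡w) main)
      -- Here 203149 = 243 · 836 + 1 and 262144 = 4 · 2 ^ 16; the bound in `c-large` is 427684 = 243
      -- · 1760 + 4.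
      (medium-error 243 c (ℕₚ.<-≤-trans (ℕₚ.≤ᵇ⇒≤ 203149 262144 _) (ℕₚ.*-monoˡ-≤ 4 (ℕₚ.^-monoʳ-≤ 2 16≤m))) c-large (length≤2^ 4 d m ℕₚ.≤-refl eqm) νL≤ νW≤ D≤4
        (ℕₚ.≤-trans (ℕₚ.≤-reflexive (sym (4^≡ m))) 4^m≤N))) x
  where
  d = m ℕ.∸ 3
  eqm : 4 + d ≡ suc m
  eqm = cong suc (ℕₚ.m+[n∸m]≡n (ℕₚ.≤-trans (ℕₚ.≤ᵇ⇒≤ 3 16 _) 16≤m))
  ps = dyadic 4 d
  open Sieve S
  wt = sumOver weight ps
  v = w
  80wt : ι 80 ⊗ wt ≼ ι (a * 8 * 31 + 190)
  80wt = begin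
    ι 80 ⊗ wt                                                           ≤⟨ ⊗-monoʳ (0≼ι 80) (ℚₚ.≤-trans (weight-dyadic 4 d ℕₚ.≤-refl) (ℚₚ.+-monoˡ-≤ κ (H-ratio 4 a (ℕₚ.≤-trans (ℕₚ.≤-reflexive eqm) m≤)))) ⟩
    ι 80 ⊗ (ι a ⊗ H 4 4 ⊕ ι 19 ⊗ (ι 2 ⊗ inv 16))                        ≡⟨ cong (λ z → z ⊗ (ι a ⊗ H 4 4 ⊕ ι 19 ⊗ (ι 2 ⊗ inv 16))) (ι-* 8 10) ⟩
    (ι 8 ⊗ ι 10) ⊗ (ι a ⊗ H 4 4 ⊕ ι 19 ⊗ (ι 2 ⊗ inv 16))                ≡⟨ eq (ι 8) (ι 10) (ι a) (H 4 4) (ι 19) (ι 2) (inv 16) ⟩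
    (ι a ⊗ ι 8) ⊗ (ι 10 ⊗ H 4 4) ⊕ (((ι 8 ⊗ ι 10) ⊗ ι 19) ⊗ ι 2) ⊗ inv 16
      ≡⟨ cong₂ (λ y z → y ⊗ (ι 10 ⊗ H 4 4) ⊕ z ⊗ inv 16) (ι-* a 8)
           (trans (ι-* 1520 2) (cong (_⊗ ι 2) (trans (ι-* 80 19) (cong (_⊗ ι 19) (ι-* 8 10))))) ⟨
    ι (a * 8) ⊗ (ι 10 ⊗ H 4 4) ⊕ ι 3040 ⊗ inv 16                        ≤⟨ ℚₚ.+-mono-≤ (⊗-monoʳ (0≼ι (a * 8)) H-4) (ι-inv≼ 3040 190 16 ℕₚ.≤-refl) ⟩
    ι (a * 8) ⊗ ι 31 ⊕ ι 190                                            ≡⟨ cong (_⊕ ι 190) (ι-* (a * 8) 31) ⟨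
    ι (a * 8 * 31) ⊕ ι 190                                              ≡⟨ ι-+ (a * 8 * 31) 190 ⟨
    ι (a * 8 * 31 + 190)                                                ∎
    where
    open ℚₚ.≤-Reasoning
    κ = ι 19 ⊗ (ι 2 ⊗ inv 16)
    eq : ∀ e t a h n s i → (e ⊗ t) ⊗ (a ⊗ h ⊕ n ⊗ (s ⊗ i)) ≡ (a ⊗ e) ⊗ (t ⊗ h) ⊕ (((e ⊗ t) ⊗ n) ⊗ s) ⊗ i
    eq = solve-∀ ℚ-ring
  c⊕wt : ι c ⊕ wt ≼ ι 19
  c⊕wt = ⊗-cancel (ι 80) (0≺ι 80) (begin
    ι 80 ⊗ (ι c ⊕ wt)                          ≡⟨ ℚₚ.*-distribˡ-+ (ι 80) (ι c) wt ⟩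
    ι 80 ⊗ ι c ⊕ ι 80 ⊗ wt                     ≤⟨ ℚₚ.+-monoʳ-≤ (ι 80 ⊗ ι c) 80wt ⟩
    ι 80 ⊗ ι c ⊕ ι (a * 8 * 31 + 190)          ≡⟨ cong (_⊕ ι (a * 8 * 31 + 190)) (ι-* 80 c) ⟨
    ι (80 * c) ⊕ ι (a * 8 * 31 + 190)          ≡⟨ ι-+ (80 * c) (a * 8 * 31 + 190) ⟨
    ι (80 * c + (a * 8 * 31 + 190))            ≤⟨ ι-mono numeric ⟩
    ι (80 * 19)                                ≡⟨ ι-* 80 19 ⟩
    ι 80 ⊗ ι 19                                ∎)
    where open ℚₚ.≤-Reasoning
  main : ι c ≼ ι 11 ⊗ (ι 19 ⊗ v ⊖ wt ⊗ v)
  main = ≼-diff (0≼⊕ (0≼⊗ (0≼ι c) (0≼⊖ 11v)) (0≼⊗ (0≼⊖ c⊕wt) (ℚₚ.≤-trans 0≼1 11v))) (eq (ι c) (ι 11) (ι 19) v wt)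
    where
    eq : ∀ c e n v w → e ⊗ (n ⊗ v ⊖ w ⊗ v) ≡ c ⊕ (c ⊗ (e ⊗ v ⊖ 1ℚ) ⊕ (n ⊖ (c ⊕ w)) ⊗ (e ⊗ v))
    eq = solve-∀ ℚ-ring

-- Bounding the extra factor A of `νL` by M makes both error terms multiples of M P; 312 = (19 · 2 +
-- 40) · 4.
large-error : ∀ {M A P len νL νW D N Q₀ Q} q → νL ≤ 2 * A * P → νW ≤ P → A ≤ M → len ≤ M → D ≤ 4 → Q ≡ Q₀ * q → Q₀ * P * (q * 312) < M → M * M ≤ N →
  Q * ((19 * νL + len * (40 * νW)) * D) < 1 * N
large-error {M} {A} {P} {len} {νL} {νW} {D} {N} {Q₀} {Q} q νL≤ νW≤ A≤ len≤ D≤4 refl small M²≤N = begin-strict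
  Q * ((19 * νL + len * (40 * νW)) * D)
    ≤⟨ ℕₚ.*-monoʳ-≤ Q (ℕₚ.*-mono-≤ (ℕₚ.+-mono-≤ (ℕₚ.*-monoʳ-≤ 19 (ℕₚ.≤-trans νL≤ (ℕₚ.*-monoˡ-≤ P (ℕₚ.*-monoʳ-≤ 2 A≤)))) (ℕₚ.*-mono-≤ len≤ (ℕₚ.*-monoʳ-≤ 40 νW≤))) D≤4) ⟩
  Q₀ * q * ((19 * (2 * M * P) + M * (40 * P)) * 4)   ≡⟨ eq Q₀ q M P ⟩
  Q₀ * P * (q * 312) * M                              <⟨ ℕₚ.*-monoˡ-< M {{ℕ.>-nonZero (ℕₚ.≤-<-trans ℕ.z≤n small)}} small ⟩
  M * M                                               ≤⟨ M²≤N ⟩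
  N                                                   ≡⟨ ℕₚ.*-identityˡ N ⟨
  1 * N                                               ∎
  where
  open ℕₚ.≤-Reasoning
  eq : ∀ a q M P → a * q * ((19 * (2 * M * P) + M * (40 * P)) * 4) ≡ a * P * (q * 312) * M
  eq = ℕS.solve-∀

-- Rounding every factor up to a power of two, 39 to 2 ^ 6, makes the condition linear in the
-- exponents. In use β = 85, since 3 ^ 53 ≤ 2 ^ 85, and γ = 21, since 6400 · 312 < 2 ^ 21.
large-bound : ∀ {J v ν₀ m} q β γ → q * 312 < 2 ℕ.^ γ → ν₀ ≤ 2 ℕ.^ β → v + 6 * J + (β + γ) ≤ m →
  39 ℕ.^ J * (2 ℕ.^ v * ν₀) * (q * 312) < 2 ℕ.^ m
large-bound {J} {v} {ν₀} {m} q β γ q< ν₀≤ le = begin-strict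
  39 ℕ.^ J * (2 ℕ.^ v * ν₀) * (q * 312)
    ≤⟨ ℕₚ.*-monoˡ-≤ (q * 312) (ℕₚ.*-mono-≤ {v = 2 ℕ.^ v * 2 ℕ.^ β} (ℕₚ.^-monoˡ-≤ J (ℕₚ.≤ᵇ⇒≤ 39 64 _)) (ℕₚ.*-monoʳ-≤ (2 ℕ.^ v) ν₀≤)) ⟩
  (2 ℕ.^ 6) ℕ.^ J * (2 ℕ.^ v * 2 ℕ.^ β) * (q * 312)
    <⟨ ℕₚ.*-monoʳ-< ((2 ℕ.^ 6) ℕ.^ J * (2 ℕ.^ v * 2 ℕ.^ β)) {{ℕₚ.m*n≢0 ((2 ℕ.^ 6) ℕ.^ J) (2 ℕ.^ v * 2 ℕ.^ β) {{ℕₚ.m^n≢0 64 J}} {{ℕₚ.m*n≢0 (2 ℕ.^ v) (2 ℕ.^ β) {{ℕₚ.m^n≢0 2 v}} {{ℕₚ.m^n≢0 2 β}}}}}} q< ⟩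
  (2 ℕ.^ 6) ℕ.^ J * (2 ℕ.^ v * 2 ℕ.^ β) * 2 ℕ.^ γ
    ≡⟨ cong₂ (λ x y → x * y * 2 ℕ.^ γ) (ℕₚ.^-*-assoc 2 6 J) (sym (ℕₚ.^-distribˡ-+-* 2 v β)) ⟩
  2 ℕ.^ (6 * J) * 2 ℕ.^ (v + β) * 2 ℕ.^ γ
    ≡⟨ cong (_* 2 ℕ.^ γ) (sym (ℕₚ.^-distribˡ-+-* 2 (6 * J) (v + β))) ⟩
  2 ℕ.^ (6 * J + (v + β)) * 2 ℕ.^ γ
    ≡⟨ sym (ℕₚ.^-distribˡ-+-* 2 (6 * J + (v + β)) γ) ⟩
  2 ℕ.^ (6 * J + (v + β) + γ)
    ≤⟨ ℕₚ.^-monoʳ-≤ 2 (ℕₚ.≤-trans (ℕₚ.≤-reflexive (eq J v β γ)) le) ⟩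
  2 ℕ.^ m ∎
  where
  open ℕₚ.≤-Reasoning
  eq : ∀ J v β γ → 6 * J + (v + β) + γ ≡ v + 6 * J + (β + γ)
  eq = ℕS.solve-∀


-- The weights over (2 ^ K , 2 ^ (64 K)] sum to at most 18 + 1/4 and the loss of L against W is at most
-- 1/50, so that the main term keeps 19 · 49/50 - 18 - 1/4 > 1/100 of the mean of W.
split-large : ∀ {N m D} (S₀ : Sieve N (2 ℕ.^ 8)) → Sieve.l S₀ ≡ Sieve.w S₀ → 1ℚ ≼ ι 64 ⊗ Sieve.w S₀ → 0ℚ ≼ Sieve.w S₀ →
  Sieve.νL S₀ ≤ Sieve.νW S₀ → Sieve.νW S₀ ≤ 2 ℕ.^ 85 →
  ∀ J x → K J ≤ m → suc m ≤ K J * 2 ℕ.^ 6 → level J 0 + 6 * J + (85 + 21) ≤ m →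
  4 ℕ.^ m ≤ N → D ≤ 4 → Allowed (2 ℕ.^ suc m) D → Splits N m D x
split-large {N} {m} {D} S₀ l₀≡w₀ 64w₀ 0≼w₀ νL₀≤ νW₀≤ J x K≤m m≤ level≤ 4^m≤N D≤4 al =
  K J , d , 1≤K J , eqm , split S (subst (λ j → Chain (2 ℕ.^ K J) (2 ℕ.^ j) ps) eqm (chain-dyadic (K J) d (1≤K J))) al
    (main-term-wins 1 Q {{ℕₚ.m*n≢0 (39 ℕ.^ J) 6400 {{ℕₚ.m^n≢0 39 J}}}} main
      (large-error {Q₀ = 39 ℕ.^ J} {Q} 6400 (νL-upper J 0) (νW-upper J 0) (ℕₚ.^-monoʳ-≤ 2 K≤m) (length≤2^ (K J) d m 4≤K eqm) D≤4 refl
        (large-bound {J} {level J 0} 6400 85 21 (ℕₚ.≤ᵇ⇒≤ 1996801 (2 ℕ.^ 21) _) νW₀≤ level≤) (ℕₚ.≤-trans (ℕₚ.≤-reflexive (sym (4^≡ m))) 4^m≤N))) x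
  where
  open Tower S₀ 0≼w₀ l₀≡w₀ νL₀≤
  S = tower S₀ J 0
  open Sieve S using (l; w)
  Q = 39 ℕ.^ J * 6400
  4≤K : 4 ≤ K J
  4≤K = ℕₚ.≤-trans (ℕₚ.≤ᵇ⇒≤ 4 8 _) (8≤K J)
  d = suc m ℕ.∸ K J
  eqm : K J + d ≡ suc m
  eqm = ℕₚ.m+[n∸m]≡n (ℕₚ.m≤n⇒m≤1+n K≤m)
  ps = dyadic (K J) d
  wt = sumOver weight ps
  κ = ι 19 ⊗ (ι 2 ⊗ inv (2 ℕ.^ K J))
  100κ : ι 100 ⊗ κ ≼ ι 25
  100κ = begin
    ι 100 ⊗ (ι 19 ⊗ (ι 2 ⊗ inv (2 ℕ.^ K J)))     ≡⟨ eq (ι 100) (ι 19) (ι 2) (inv (2 ℕ.^ K J)) ⟩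
    ((ι 100 ⊗ ι 19) ⊗ ι 2) ⊗ inv (2 ℕ.^ K J)     ≡⟨ cong (_⊗ inv (2 ℕ.^ K J)) (trans (ι-* 1900 2) (cong (_⊗ ι 2) (ι-* 100 19))) ⟨
    ι 3800 ⊗ inv (2 ℕ.^ K J)                     ≤⟨ ⊗-monoʳ (0≼ι 3800) (inv-anti (ℕₚ.^-monoʳ-≤ 2 (8≤K J))) ⟩
    ι 3800 ⊗ inv 256                             ≤⟨ ι-inv≼ 3800 25 256 (ℕₚ.≤ᵇ⇒≤ 3800 6400 _) ⟩
    ι 25                                         ∎
    where
    open ℚₚ.≤-Reasoning
    eq : ∀ a b c d → a ⊗ (b ⊗ (c ⊗ d)) ≡ ((a ⊗ b) ⊗ c) ⊗ d
    eq = solve-∀ ℚ-ring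
  wt≼ : wt ≼ ι 18 ⊕ κ
  wt≼ = ℚₚ.≤-trans (weight-dyadic (K J) d 4≤K) (ℚₚ.+-monoˡ-≤ κ (begin
    H (K J) d             ≤⟨ H-ratio (K J) {{ℕ.>-nonZero (1≤K J)}} 6 (ℕₚ.≤-trans (ℕₚ.≤-reflexive eqm) m≤) ⟩
    ι 6 ⊗ H (K J) (K J)   ≤⟨ ⊗-monoʳ (0≼ι 6) (H-K J) ⟩
    ι 6 ⊗ ι 3             ≡⟨ ι-* 6 3 ⟨
    ι 18                  ∎))
    where open ℚₚ.≤-Reasoning
  w≼ : w ≼ ι 100 ⊗ (ι 19 ⊗ l ⊖ wt ⊗ w)
  w≼ = subst (λ z → w ≼ ι 100 ⊗ (z ⊗ l ⊖ wt ⊗ w)) (sym (ι-suc 18)) (≼-diff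
    (0≼⊕ (0≼⊗ (0≼⊕ 0≼1 (0≼ι 18)) (0≼⊖ (l-lower J 0)))
      (0≼⊕ (0≼⊗ (0≼ι 100) (0≼⊗ (0≼⊖ wt≼) (0≼w J 0)))
        (0≼⊕ (0≼⊗ (0≼⊖ 100κ) (0≼w J 0)) (0≼⊗ (0≼⊖ spare) (0≼w J 0)))))
    (eq (ι 100) (ι 18) l wt w (ι 2) κ (ι 25)))
    where
    -- Of the margin 100 · (19 - 18), the loss of `L` takes 19 · 2, the squares take 25, and one `w`
    -- is left as the gain.
    spare : (1ℚ ⊕ ι 18) ⊗ ι 2 ⊕ ι 25 ⊕ 1ℚ ≼ ι 100
    spare = subst (_≼ ι 100) (trans (ι-+ 63 1) (cong₂ _⊕_ (trans (ι-+ 38 25) (cong (_⊕ ι 25) (trans (ι-* 19 2) (cong (_⊗ ι 2) (ι-suc 18))))) ι-1))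
      (ι-mono (ℕₚ.≤ᵇ⇒≤ 64 100 _))
    eq : ∀ P s l v w t κ q → P ⊗ ((1ℚ ⊕ s) ⊗ l ⊖ v ⊗ w) ≡
      w ⊕ ((1ℚ ⊕ s) ⊗ (t ⊗ w ⊖ P ⊗ (w ⊖ l)) ⊕ (P ⊗ ((s ⊕ κ ⊖ v) ⊗ w) ⊕ ((q ⊖ P ⊗ κ) ⊗ w ⊕ (P ⊖ ((1ℚ ⊕ s) ⊗ t ⊕ q ⊕ 1ℚ)) ⊗ w)))
    eq = solve-∀ ℚ-ring
  main : ι 1 ≼ ι Q ⊗ (ι 19 ⊗ l ⊖ wt ⊗ w)
  main = begin
    ι 1                                                           ≡⟨ ι-1 ⟩
    1ℚ                                                            ≤⟨ 64w₀ ⟩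
    ι 64 ⊗ Sieve.w S₀                                             ≤⟨ ⊗-monoʳ (0≼ι 64) (w-lower J 0) ⟩
    ι 64 ⊗ (ι (39 ℕ.^ J) ⊗ w)                                     ≤⟨ ⊗-monoʳ (0≼ι 64) (⊗-monoʳ (0≼ι (39 ℕ.^ J)) w≼) ⟩
    ι 64 ⊗ (ι (39 ℕ.^ J) ⊗ (ι 100 ⊗ (ι 19 ⊗ l ⊖ wt ⊗ w)))         ≡⟨ eq (ι 64) (ι (39 ℕ.^ J)) (ι 100) (ι 19 ⊗ l ⊖ wt ⊗ w) ⟩
    (ι (39 ℕ.^ J) ⊗ (ι 64 ⊗ ι 100)) ⊗ (ι 19 ⊗ l ⊖ wt ⊗ w)         ≡⟨ cong (_⊗ (ι 19 ⊗ l ⊖ wt ⊗ w)) (trans (ι-* (39 ℕ.^ J) 6400) (cong (ι (39 ℕ.^ J) ⊗_) (ι-* 64 100))) ⟨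
    ι Q ⊗ (ι 19 ⊗ l ⊖ wt ⊗ w)                                     ∎
    where
    open ℚₚ.≤-Reasoning
    eq : ∀ a b c m → a ⊗ (b ⊗ (c ⊗ m)) ≡ (b ⊗ (a ⊗ c)) ⊗ m
    eq = solve-∀ ℚ-ring

-- Splittings of N

allowed-small : ∀ {y D} {{_ : NonZero D}} → (∀ q → Prime q → 3 ≤ q → ¬ (q ℕ∣.∣ D)) → Allowed y D
allowed-small {{nz}} h = nz , λ q pq 3≤q _ → h q pq 3≤q

odd∤2 : ∀ q → Prime q → 3 ≤ q → ¬ (q ℕ∣.∣ 2)
odd∤2 q pq 3≤q d = ℕₚ.<⇒≱ 3≤q (ℕ∣.∣⇒≤ d)

odd∤4 : ∀ q → Prime q → 3 ≤ q → ¬ (q ℕ∣.∣ 4)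
odd∤4 q pq 3≤q d = [ odd∤2 q pq 3≤q , odd∤2 q pq 3≤q ]′ (euclidsLemma 2 2 pq d)

-- Descent to the least J whose range reaches m + 1. Failure one layer lower means 64 · K (J - 1) =
-- 32 · K J ≤ m.
layer-count : ∀ m J → suc m ≤ K J * 2 ℕ.^ 6 → ∃[ J ] (suc m ≤ K J * 2 ℕ.^ 6 × (J ≡ 0 ⊎ K J * 32 ≤ m))
layer-count m zero    le = 0 , le , inj₁ refl
layer-count m (suc J) le = [ layer-count m J , (λ lt → suc J , le , inj₂ (ℕₚ.≤-trans (ℕₚ.≤-reflexive (eq (K J))) (ℕ.s≤s⁻¹ lt))) ]′ (ℕₚ.≤-<-connex (suc m) (K J * 2 ℕ.^ 6))
  where
  eq : ∀ k → (k + k) * 32 ≡ k * 64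
  eq = ℕS.solve-∀

n<K : ∀ n → n < K n
n<K zero    = ℕ.s≤s ℕ.z≤n
n<K (suc n) = ℕₚ.≤-trans (ℕₚ.≤-reflexive (ℕₚ.+-comm 1 (suc n))) (ℕₚ.+-mono-≤ (n<K n) (1≤K n))

level-bound : ∀ J {m} → 128 ≤ m → J ≡ 0 ⊎ K J * 32 ≤ m → K J ≤ m × level J 0 + 6 * J + (85 + 21) ≤ m
level-bound J 128≤m (inj₁ refl) = ℕₚ.≤-trans (ℕₚ.≤ᵇ⇒≤ 8 128 _) 128≤m , ℕₚ.≤-trans (ℕₚ.≤ᵇ⇒≤ 106 128 _) 128≤m
level-bound J {m} 128≤m (inj₂ le) = ℕₚ.≤-trans (ℕₚ.m≤m*n (K J) 32) le , (begin
  -- The slack 8 (28 + 4 J) = 224 + 32 J of `level-closed` exceeds 6 J + 106 by 26 J + 118.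
  level J 0 + 6 * J + 106               ≤⟨ ℕₚ.m≤m+n (level J 0 + 6 * J + 106) (26 * J + 118) ⟩
  level J 0 + 6 * J + 106 + (26 * J + 118) ≡⟨ eq (level J 0) J ⟩
  level J 0 + (28 + 4 * 0 + 4 * J) * 8  ≡⟨ level-closed J 0 ⟩
  28 * K J                              ≡⟨ ℕₚ.*-comm 28 (K J) ⟩
  K J * 28                              ≤⟨ ℕₚ.*-monoʳ-≤ (K J) (ℕₚ.≤ᵇ⇒≤ 28 32 _) ⟩
  K J * 32                              ≤⟨ le ⟩
  m                                     ∎)
  where
  open ℕₚ.≤-Reasoning
  eq : ∀ v J → v + 6 * J + 106 + (26 * J + 118) ≡ v + (28 + 4 * 0 + 4 * J) * 8
  eq = ℕS.solve-∀

-- The estimates see a base sieve only through these fields, so its list of primes is evaluated only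
-- where `base16` and `base256` are built.
record InitialSieve (N z c ν : ℕ) : Set where
  field
    sieve : Sieve N z
  open Sieve sieve
  field
    l≡w    : l ≡ w
    1≼c⊗w  : 1ℚ ≼ ι c ⊗ w
    0≼w    : 0ℚ ≼ w
    νL≤νW  : νL ≤ νW
    νW≤ν   : νW ≤ ν

initialSieve : ∀ N d c ν → product (primesIn 2 d) ≤ c * product (map (ℕ._∸ 2) (primesIn 2 d)) → 3 ℕ.^ length (primesIn 2 d) * 1 ≤ ν →
  InitialSieve N (2 + d) c ν
initialSieve N d c ν le ν≤ = record
  { sieve = exactSieve N d
  ; l≡w   = refl
  ; 1≼c⊗w = subst (λ z → 1ℚ ≼ ι c ⊗ z) (sym (ℚₚ.*-identityʳ (V (gs N (primesIn 2 d)))))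
              (1≼V N c ch {{productOfPrimes≢0 (chain-prime ch)}} le)
  ; 0≼w   = 0≼⊗ {V (gs N (primesIn 2 d))} {1ℚ} (0≼V (gs-unit ch)) 0≼1
  ; νL≤νW = ℕₚ.≤-refl
  ; νW≤ν  = ν≤
  }
  where
  ch : Chain 2 (2 + d) (primesIn 2 d)
  ch = chain-primesIn 2 d ℕₚ.≤-refl

splits : ∀ {N m D} → 16 ≤ m → 4 ℕ.^ m ≤ N → D ≤ 4 → Allowed (2 ℕ.^ suc m) D → ∀ x → Splits N m D x
splits {N} {m} {D} 16≤m 4^m≤N D≤4 al x = by-size (ℕₚ.≤-<-connex 128 m) (ℕₚ.≤-<-connex 32 m)
  where
  medium : InitialSieve N (2 ℕ.^ 4) 11 243 → ∀ a c → 427684 ≤ c * 2 ℕ.^ m → suc m ≤ 4 * 2 ℕ.^ a →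
    80 * c + (a * 8 * 31 + 190) ≤ 80 * 19 → Splits N m D x
  medium B a c c-large m≤ numeric = split-medium sieve l≡w 1≼c⊗w (ℕₚ.≤-trans νL≤νW νW≤ν) νW≤ν
    a c x 16≤m c-large m≤ numeric 4^m≤N D≤4 al
    where open InitialSieve B
  large : InitialSieve N (2 ℕ.^ 8) 64 (2 ℕ.^ 85) → 128 ≤ m → ∃[ J ] (suc m ≤ K J * 2 ℕ.^ 6 × (J ≡ 0 ⊎ K J * 32 ≤ m)) → Splits N m D x
  large B 128≤m (J , m≤ , size) = split-large sieve l≡w 1≼c⊗w 0≼w νL≤νW νW≤ν
    J x (proj₁ (level-bound J 128≤m size)) m≤ (proj₂ (level-bound J 128≤m size)) 4^m≤N D≤4 al
    where open InitialSieve B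
  -- Over the odd primes up to 16 (up to 256) ∏ (1 - 2/p) ≥ 1/11 (≥ 1/64); there are 5 (53) of them,
  -- each multiplying the number of terms by 3.
  base16 : InitialSieve N (2 ℕ.^ 4) 11 243
  base16 = initialSieve N 14 11 243 (ℕₚ.≤ᵇ⇒≤ 15015 16335 _) ℕₚ.≤-refl
  base256 : InitialSieve N (2 ℕ.^ 8) 64 (2 ℕ.^ 85)
  base256 = initialSieve N 254 64 (2 ℕ.^ 85)
    (ℕₚ.≤ᵇ⇒≤ (product (primesIn 2 254)) (64 * product (map (ℕ._∸ 2) (primesIn 2 254))) _)
    (ℕₚ.≤ᵇ⇒≤ (3 ℕ.^ length (primesIn 2 254) * 1) (2 ℕ.^ 85) _)
  by-size : 128 ≤ m ⊎ m < 128 → 32 ≤ m ⊎ m < 32 → Splits N m D x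
  by-size (inj₁ 128≤m) _ = large base256 128≤m (layer-count m m (ℕₚ.≤-trans (n<K m) (ℕₚ.m≤m*n (K m) (2 ℕ.^ 6))))
  -- Five doublings of 4 reach 128 but leave only c = 1, too little against the error when m is near
  -- 16. Below 32 three doublings suffice and leave c = 7, with 7 · 2 ^ 16 = 458752.
  by-size (inj₂ m<128) (inj₁ 32≤m) = medium base16 5 1
    (ℕₚ.≤-trans (ℕₚ.≤ᵇ⇒≤ 427684 (2 ℕ.^ 32) _) (ℕₚ.≤-trans (ℕₚ.^-monoʳ-≤ 2 32≤m) (ℕₚ.≤-reflexive (sym (ℕₚ.*-identityˡ (2 ℕ.^ m)))))) m<128 (ℕₚ.≤ᵇ⇒≤ 1510 1520 _)
  by-size (inj₂ m<128) (inj₂ m<32) = medium base16 3 7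
    (ℕₚ.≤-trans (ℕₚ.≤ᵇ⇒≤ 427684 458752 _) (ℕₚ.*-monoʳ-≤ 7 (ℕₚ.^-monoʳ-≤ 2 16≤m))) m<32 (ℕₚ.≤ᵇ⇒≤ 1494 1520 _)

module _ {N m D : ℕ} {x : ℤ} (N<4^ : N < 4 ℕ.^ suc m) (sp : Splits N m D x) where
  private
    k = proj₁ sp
    d = proj₁ (proj₂ sp)
    1≤k = proj₁ (proj₂ (proj₂ sp))
    eqm = proj₁ (proj₂ (proj₂ (proj₂ sp)))
  open Split (proj₂ (proj₂ (proj₂ (proj₂ sp))))

  private
    ps = dyadic k d
    M = 2 ℕ.^ suc m

  -- Stated for a general a because it is applied to t, to N - t and, when N is odd, to the half of
  -- t.
  Ω-part : ∀ a → 0 < a → a ≤ N → ¬ (2 ℕ∣.∣ a) → (∀ q → q ℕ∣.∣ a → q ℕ∣.∣ t ⊎ q ℕ∣.∣ N ℕ.∸ t) →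
    Ω a ≤ suc (divisors a ps)
  Ω-part a 0<a a≤N odd h = Ω≤divisors {M} ps {{ℕₚ.m^n≢0 2 (suc m)}} {{ℕ.>-nonZero 0<a}}
    (chain-prime (chain-dyadic k d 1≤k))
    (ℕₚ.≤-<-trans a≤N (ℕₚ.<-≤-trans N<4^ (ℕₚ.≤-reflexive (trans (4^≡ (suc m)) (cong (M *_) (sym (ℕₚ.*-identityʳ M)))))))
    (All.tabulate λ {p} i sq → squarefree p i (h (p * p) sq))
    λ q pq q∣a → [ (λ q≤ → ⊥-elim (sifted q pq (odd-prime≥3 pq q∣a odd) q≤ (h q q∣a)))
                 , (λ q> → [ (λ q≤M → inj₁ (∈-dyadic k d pq q> (ℕₚ.≤-trans q≤M (ℕₚ.≤-reflexive (cong (2 ℕ.^_) (sym eqm))))))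
                           , (λ M<q → inj₂ (ℕₚ.<⇒≤ M<q)) ]′ (ℕₚ.≤-<-connex q M)) ]′ (ℕₚ.≤-<-connex q (2 ℕ.^ k))

  0<N∸t : 0 < N ℕ.∸ t
  0<N∸t = ℕₚ.m<n⇒0<n∸m t<N

  Ω-rest : ¬ (2 ℕ∣.∣ N ℕ.∸ t) → Ω (N ℕ.∸ t) ≤ suc (divisors (N ℕ.∸ t) ps)
  Ω-rest odd = Ω-part (N ℕ.∸ t) 0<N∸t (ℕₚ.m∸n≤m N t) odd (λ q d → inj₂ d)

  few′ : suc (divisors t ps) + suc (divisors (N ℕ.∸ t) ps) ≤ 20
  few′ = ℕₚ.≤-trans (ℕₚ.≤-reflexive (cong suc (ℕₚ.+-suc (divisors t ps) (divisors (N ℕ.∸ t) ps)))) (ℕ.s≤s (ℕ.s≤s few))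

  Ω-odd-split : ¬ (2 ℕ∣.∣ t) → ¬ (2 ℕ∣.∣ N ℕ.∸ t) → Ω (t * (N ℕ.∸ t)) ≤ 20
  Ω-odd-split odd odd′ = begin
    Ω (t * (N ℕ.∸ t))       ≡⟨ Ω-* t (N ℕ.∸ t) {{ℕ.>-nonZero 0<t}} {{ℕ.>-nonZero 0<N∸t}} ⟩
    Ω t + Ω (N ℕ.∸ t)       ≤⟨ ℕₚ.+-mono-≤ (Ω-part t 0<t (ℕₚ.<⇒≤ t<N) odd (λ q d → inj₁ d)) (Ω-rest odd′) ⟩
    suc (divisors t ps) + suc (divisors (N ℕ.∸ t) ps) ≤⟨ few′ ⟩
    20                      ∎
    where
    open ℕₚ.≤-Reasoning
    0<t : 0 < t
    0<t = ℕₚ.n≢0⇒n>0 λ t≡0 → odd (subst (2 ℕ∣.∣_) (sym t≡0) (2 ℕ∣.∣0))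

  Ω-even-split : ∀ b → t ≡ b * 2 → ¬ (2 ℕ∣.∣ b) → ¬ (2 ℕ∣.∣ N ℕ.∸ t) → Ω (t * (N ℕ.∸ t)) ≤ 21
  Ω-even-split b t≡ odd odd′ = begin
    Ω (t * (N ℕ.∸ t))             ≡⟨ Ω-* t (N ℕ.∸ t) {{subst NonZero (sym t≡) (ℕₚ.m*n≢0 b 2 {{b≢0}})}} {{ℕ.>-nonZero 0<N∸t}} ⟩
    Ω t + Ω (N ℕ.∸ t)             ≡⟨ cong (λ z → Ω z + Ω (N ℕ.∸ t)) t≡ ⟩
    Ω (b * 2) + Ω (N ℕ.∸ t)       ≡⟨ cong (_+ Ω (N ℕ.∸ t)) (trans (Ω-* b 2 {{b≢0}}) (trans (cong (λ z → Ω b + z) (Ω-prime prime[2])) (ℕₚ.+-comm (Ω b) 1))) ⟩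
    suc (Ω b) + Ω (N ℕ.∸ t)       ≤⟨ ℕ.s≤s (ℕₚ.+-mono-≤ (ℕₚ.≤-trans (Ω-part b 0<b (ℕₚ.≤-trans (ℕ∣.∣⇒≤ {{t≢0}} b∣t) (ℕₚ.<⇒≤ t<N)) odd (λ q d → inj₁ (ℕ∣.∣-trans d b∣t))) (ℕ.s≤s (divisors-mono ps b∣t))) (Ω-rest odd′)) ⟩
    suc (suc (divisors t ps) + suc (divisors (N ℕ.∸ t) ps)) ≤⟨ ℕ.s≤s few′ ⟩
    21                            ∎
    where
    open ℕₚ.≤-Reasoning
    0<b : 0 < b
    0<b = ℕₚ.n≢0⇒n>0 λ b≡0 → odd (subst (2 ℕ∣.∣_) (sym b≡0) (2 ℕ∣.∣0))
    b≢0 : NonZero b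
    b≢0 = ℕ.>-nonZero 0<b
    t≢0 : NonZero t
    t≢0 = subst NonZero (sym t≡) (ℕₚ.m*n≢0 b 2 {{b≢0}})
    b∣t : b ℕ∣.∣ t
    b∣t = ℕ∣.divides 2 (trans t≡ (ℕₚ.*-comm b 2))

-- The two parities, small N, and the conclusion

Representable : ℕ → Set
Representable N = ∃[ a ] ∃[ b ] (0 < a × 0 < b × N ≡ a + b ×
  (N % 2 ≡ 0 → Ω (a * b) ≤ 20) × (N % 2 ≡ 1 → Ω (a * b) ≤ 21))

even : ∀ N → N % 2 ≡ 0 → 2 ℕ∣.∣ N
even N eq = ℕ∣.m%n≡0⇒n∣m N 2 eq

odd : ∀ N → N % 2 ≡ 1 → ¬ (2 ℕ∣.∣ N)
odd N eq d with trans (sym eq) (ℕ∣.n∣m⇒m%n≡0 N 2 d)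
... | ()

∣t∸ : ∀ {q N t} → t ≤ N → q ℕ∣.∣ N → q ℕ∣.∣ N ℕ.∸ t → q ℕ∣.∣ t
∣t∸ {q} t≤N d d′ = ℕ∣.∣m+n∣m⇒∣n (subst (q ℕ∣.∣_) (sym (ℕₚ.m∸n+n≡m t≤N)) d) d′

class-∣ : ∀ {q t r} → + q ∣ (+ t ℤ.- + r) → q ℕ∣.∣ t → q ℕ∣.∣ r
class-∣ {q} {t} {r} d d′ = ∣⇒∣ᵤ (subst (+ q ∣_) (eq (+ t) (+ r)) (∣m∣n⇒∣m-n {+ q} {+ t} {+ t ℤ.- + r} (∣ᵤ⇒∣ d′) d))
  where
  eq : ∀ t r → t ℤ.- (t ℤ.- r) ≡ r
  eq = ℤS.solve-∀

large-even : ∀ {N m} → 16 ≤ m → 4 ℕ.^ m ≤ N → N < 4 ℕ.^ suc m → N % 2 ≡ 0 → Representable N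
large-even {N} {m} 16≤m lo hi N-even = t , N ℕ.∸ t , 0<t , ℕₚ.m<n⇒0<n∸m t<N , sym (ℕₚ.m+[n∸m]≡n (ℕₚ.<⇒≤ t<N)) ,
  (λ _ → Ω-odd-split hi sp t-odd λ d → t-odd (∣t∸ (ℕₚ.<⇒≤ t<N) (even N N-even) d)) , λ N-odd → ⊥-elim (odd N N-odd (even N N-even))
  where
  sp : Splits N m 2 (+ 1)
  sp = splits 16≤m lo (ℕₚ.≤ᵇ⇒≤ 2 4 _) (allowed-small odd∤2) (+ 1)
  open Split (proj₂ (proj₂ (proj₂ (proj₂ sp))))
  t-odd : ¬ (2 ℕ∣.∣ t)
  t-odd d = ℕₚ.<⇒≱ (ℕₚ.≤-refl {2}) (ℕ∣.∣⇒≤ (class-∣ class d))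
  0<t : 0 < t
  0<t = ℕₚ.n≢0⇒n>0 λ t≡0 → t-odd (subst (2 ℕ∣.∣_) (sym t≡0) (2 ℕ∣.∣0))

large-odd : ∀ {N m} → 16 ≤ m → 4 ℕ.^ m ≤ N → N < 4 ℕ.^ suc m → N % 2 ≡ 1 → Representable N
large-odd {N} {m} 16≤m lo hi N-odd = t , N ℕ.∸ t , 0<t , ℕₚ.m<n⇒0<n∸m t<N , sym (ℕₚ.m+[n∸m]≡n (ℕₚ.<⇒≤ t<N)) ,
  (λ N-even → ⊥-elim (odd N N-odd (even N N-even))) , λ _ → conclude 2∣t
  where
  sp : Splits N m 4 (+ 2)
  sp = splits 16≤m lo ℕₚ.≤-refl (allowed-small odd∤4) (+ 2)
  open Split (proj₂ (proj₂ (proj₂ (proj₂ sp))))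
  4∤t : ¬ (4 ℕ∣.∣ t)
  4∤t d = ℕₚ.<⇒≱ (ℕₚ.≤ᵇ⇒≤ 3 4 _) (ℕ∣.∣⇒≤ (class-∣ class d))
  0<t : 0 < t
  0<t = ℕₚ.n≢0⇒n>0 λ t≡0 → 4∤t (subst (4 ℕ∣.∣_) (sym t≡0) (4 ℕ∣.∣0))
  2∣t : 2 ℕ∣.∣ t
  2∣t = ∣⇒∣ᵤ (subst (+ 2 ∣_) (eq (+ t)) (∣m∣n⇒∣m+n {+ 2} {+ t ℤ.- + 2} {+ 2} (∣ᵤ⇒∣ (ℕ∣.∣-trans (ℕ∣.divides 2 refl) (∣⇒∣ᵤ class))) (divides (+ 1) refl)))
    where
    eq : ∀ t → (t ℤ.- + 2) ℤ.+ + 2 ≡ t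
    eq = ℤS.solve-∀
  conclude : 2 ℕ∣.∣ t → Ω (t * (N ℕ.∸ t)) ≤ 21
  conclude (ℕ∣.divides b t≡) = Ω-even-split hi sp b t≡
    (λ d → 4∤t (subst (4 ℕ∣.∣_) (sym t≡) (ℕ∣.*-monoˡ-∣ 2 d)))
    (λ d → odd N N-odd (subst (2 ℕ∣.∣_) (ℕₚ.m∸n+n≡m (ℕₚ.<⇒≤ t<N)) (ℕ∣.∣m∣n⇒∣m+n d 2∣t)))

Ω-odd≤20 : ∀ {b} → 0 < b → b < 4 ℕ.^ 16 → ¬ (2 ℕ∣.∣ b) → Ω b ≤ 20
Ω-odd≤20 0<b b< b-odd = Ω≤ {3} 20 {{ℕ.>-nonZero 0<b}} (λ p pp d → odd-prime≥3 pp d b-odd)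
  (ℕₚ.<-≤-trans b< (ℕₚ.≤ᵇ⇒≤ (4 ℕ.^ 16) (3 ℕ.^ 21) _))

small-even : ∀ {N} → 2 ≤ N → N < 4 ℕ.^ 16 → N % 2 ≡ 0 → Representable N
small-even {N} 2≤N N< N-even = 1 , N ℕ.∸ 1 , ℕ.s≤s ℕ.z≤n , 0<b , sym (ℕₚ.m+[n∸m]≡n 1≤N) ,
  (λ _ → ℕₚ.≤-trans (ℕₚ.≤-reflexive (cong Ω (ℕₚ.*-identityˡ (N ℕ.∸ 1))))
    (Ω-odd≤20 0<b (ℕₚ.≤-<-trans (ℕₚ.m∸n≤m N 1) N<) (λ d → ℕₚ.<⇒≱ (ℕₚ.≤-refl {2}) (ℕ∣.∣⇒≤ (∣t∸ 1≤N (even N N-even) d))))) ,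
  λ N-odd → ⊥-elim (odd N N-odd (even N N-even))
  where
  1≤N = ℕₚ.≤-trans (ℕₚ.n≤1+n 1) 2≤N
  0<b : 0 < N ℕ.∸ 1
  0<b = ℕₚ.m<n⇒0<n∸m 2≤N

small-odd : ∀ {N} → 2 ≤ N → N < 4 ℕ.^ 16 → N % 2 ≡ 1 → Representable N
small-odd {N} 2≤N N< N-odd = 2 , N ℕ.∸ 2 , ℕ.s≤s ℕ.z≤n , 0<b , sym (ℕₚ.m+[n∸m]≡n 2≤N) ,
  (λ N-even → ⊥-elim (odd N N-odd (even N N-even))) ,
  λ _ → ℕₚ.≤-trans (ℕₚ.≤-reflexive (trans (Ω-* 2 (N ℕ.∸ 2) {{_}} {{ℕ.>-nonZero 0<b}}) (cong (_+ Ω (N ℕ.∸ 2)) (Ω-prime prime[2]))))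
    (ℕ.s≤s (Ω-odd≤20 0<b (ℕₚ.≤-<-trans (ℕₚ.m∸n≤m N 2) N<)
      (λ d → odd N N-odd (subst (2 ℕ∣.∣_) (ℕₚ.m∸n+n≡m 2≤N) (ℕ∣.∣m∣n⇒∣m+n d (ℕ∣.∣-refl {2}))))))
  where
  0<b : 0 < N ℕ.∸ 2
  0<b = ℕₚ.m<n⇒0<n∸m (ℕₚ.≤∧≢⇒< 2≤N λ { refl → odd 2 N-odd (ℕ∣.∣-refl {2}) })

magnitude : ∀ {N} k → 0 < N → N < 4 ℕ.^ k → ∃[ m ] (4 ℕ.^ m ≤ N × N < 4 ℕ.^ suc m)
magnitude zero    0<N lt = ⊥-elim (ℕₚ.<⇒≱ lt 0<N)
magnitude {N} (suc k) 0<N lt = [ (λ le → k , le , lt) , magnitude k 0<N ]′ (ℕₚ.≤-<-connex (4 ℕ.^ k) N)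

n<4^n : ∀ n → n < 4 ℕ.^ n
n<4^n zero    = ℕ.s≤s ℕ.z≤n
n<4^n (suc n) = ℕₚ.≤-trans (ℕₚ.≤-reflexive (ℕₚ.+-comm 1 (suc n)))
  (ℕₚ.+-mono-≤ (n<4^n n) (ℕₚ.≤-trans (ℕₚ.m^n>0 4 n) (ℕₚ.m≤m+n (4 ℕ.^ n) _)))

theorem4 : (N : ℕ) → 2 ≤ N →
    ∃[ a ] ∃[ b ] (0 < a × 0 < b × N ≡ a + b ×
    (N % 2 ≡ 0 → Ω (a * b) ≤ 20) × (N % 2 ≡ 1 → Ω (a * b) ≤ 21))
theorem4 N 2≤N = by-size (ℕₚ.≤-<-connex (4 ℕ.^ 16) N) (parity (N % 2) refl (DM.m%n<n N 2))
  where
  parity : ∀ r → N % 2 ≡ r → r < 2 → N % 2 ≡ 0 ⊎ N % 2 ≡ 1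
  parity 0 eq _ = inj₁ eq
  parity 1 eq _ = inj₂ eq
  parity (suc (suc _)) _ (ℕ.s≤s (ℕ.s≤s ()))
  by-size : 4 ℕ.^ 16 ≤ N ⊎ N < 4 ℕ.^ 16 → N % 2 ≡ 0 ⊎ N % 2 ≡ 1 → Representable N
  by-size (inj₂ N<) = [ small-even 2≤N N< , small-odd 2≤N N< ]′
  by-size (inj₁ N≥) =
    let m , lo , hi = magnitude N (ℕₚ.≤-trans (ℕₚ.n≤1+n 1) 2≤N) (n<4^n N)
        16≤m = ℕ.s≤s⁻¹ (ℕₚ.≰⇒> λ m<16 → ℕₚ.<⇒≱ hi (ℕₚ.≤-trans (ℕₚ.^-monoʳ-≤ 4 m<16) N≥))
    in [ large-even {N} {m} 16≤m lo hi , large-odd {N} {m} 16≤m lo hi ]′
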